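{- (a) For every positive integer $\omega$ there is a constant $C_\omega$ such that every subtree overlap graph $G$ with $\omega(G)\le\omega$ and $n\ge 16$ vertices satisfies $\chi(G)\le C_\omega(\log\log n)^{\binom{\omega}{2}}$; i.e. every subtree overlap graph satisfies $\chi=O_\omega((\log\log n)^{\binom{\omega}{2}})$. (b) Every clean subtree overlap graph satisfies $\chi=O_\omega((\log\log n)^{\omega-1})$. (c) For every fixed $\omega$, there are clean subtree overlap graphs with clique number $\omega$, with arbitrarily large number $n$ of vertices, and with $\chi=\Theta_\omega((\log\log n)^{\omega-1})$. Consequently, there are string graphs with $\chi=\Theta_\omega((\log\log n)^{\omega-1})$.
   Context: Graphs are finite and simple; $n$, $\chi$, $\omega$ denote the number of vertices, chromatic number and clique number of the graph in question. $O_\omega$ and $\Theta_\omega$ denote asymptotics in $n$ with $\omega$ fixed as a constant (constants may depend on $\omega$). Two sets overlap if they intersect and neither contains the other. The overlap graph of a finite family $\mathcal F$ of sets is the graph on $\mathcal F$ whose edges are the overlapping pairs; $G$ is an overlap graph of $\mathcal F$ if there is a bijection $\mu:V(G)\to\mathcal F$ with $uv\in E(G)$ iff $\mu(u),\mu(v)$ overlap (an overlap model). An overlap model is clean if there are no three members such that two overlapping ones both contain the third; an overlap graph is clean if it has a clean overlap model. A subtree overlap graph is an overlap graph of a family of subtrees (viewed as node sets) of a tree. A string graph is an intersection graph of curves in the plane (vertices are curves, edges join intersecting curves). -}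

module Defs where

open import Data.Nat using (ℕ; zero; suc; _+_; _*_; _^_; _≤_)
open import Data.Nat.Logarithm using (⌊log₂_⌋)
open import Data.Fin using (Fin; zero; suc; toℕ; fromℕ)
open import Data.Fin.Subset using (Subset; _∈_; _⊆_; Nonempty) renaming (⊤ to ⊤ₛ)
open import Data.Product using (Σ; ∃; _×_; _,_)
open import Data.Sum using (_⊎_)
open import Data.Empty using (⊥)
open import Data.List.NonEmpty using (List⁺; _∷_)
open import Data.List using (List; []; _∷_)
open import Data.Rational using (ℚ; 0ℚ; 1ℚ) renaming (_+_ to _+ℚ_; _*_ to _*ℚ_; _-_ to _-ℚ_; _≤_ to _≤ℚ_)
open import Relation.Nullary using (¬_)
open import Relation.Binary.PropositionalEquality using (_≡_; _≢_)

record Graph : Set₁ where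
  field
    n     : ℕ
    Adj   : Fin n → Fin n → Set
    sym   : ∀ {u v} → Adj u v → Adj v u
    irrefl : ∀ {u} → ¬ Adj u u
open Graph public

Colourable : (G : Graph) → ℕ → Set
Colourable G k = Σ (Fin (n G) → Fin k) λ c → ∀ u v → Adj G u v → c u ≢ c v

IsClique : (G : Graph) (m : ℕ) → (Fin m → Fin (n G)) → Set
IsClique G m f = (∀ i j → f i ≡ f j → i ≡ j) × (∀ i j → i ≢ j → Adj G (f i) (f j))

CliqueNumber≤ : Graph → ℕ → Set
CliqueNumber≤ G w = ∀ m (f : Fin m → Fin (n G)) → IsClique G m f → m ≤ w

CliqueNumber≡ : Graph → ℕ → Set
CliqueNumber≡ G w = CliqueNumber≤ G w × Σ (Fin w → Fin (n G)) (IsClique G w)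

data WalkIn (G : Graph) (S : Subset (n G)) : Fin (n G) → Fin (n G) → Set where
  here : ∀ {x} → x ∈ S → WalkIn G S x x
  step : ∀ {x y z} → x ∈ S → Adj G x y → WalkIn G S y z → WalkIn G S x z

ConnectedIn : (G : Graph) → Subset (n G) → Set
ConnectedIn G S = ∀ u v → u ∈ S → v ∈ S → WalkIn G S u v

HasCycle : Graph → Set
HasCycle G = Σ ℕ λ k → Σ (Fin (3 + k) → Fin (n G)) λ f →
  (∀ i j → f i ≡ f j → i ≡ j) ×
  (∀ i j → suc (toℕ i) ≡ toℕ j → Adj G (f i) (f j)) ×
  Adj G (f (fromℕ (2 + k))) (f zero)

full : (m : ℕ) → Subset m
full m = ⊤ₛ

IsTree : Graph → Set
IsTree T = Nonempty (full (n T)) × ConnectedIn T (full (n T)) × ¬ HasCycle T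

IsSubtree : (T : Graph) → Subset (n T) → Set
IsSubtree T S = Nonempty S × ConnectedIn T S

Overlap : ∀ {m} → Subset m → Subset m → Set
Overlap S R = (∃ λ x → x ∈ S × x ∈ R) × ¬ (S ⊆ R) × ¬ (R ⊆ S)

-- μ is an overlap model of G (μ injective = bijection onto the family it enumerates)
IsOverlapModel : (G : Graph) {m : ℕ} → (Fin (n G) → Subset m) → Set
IsOverlapModel G μ = (∀ u v → μ u ≡ μ v → u ≡ v) ×
  (∀ u v → (Adj G u v → Overlap (μ u) (μ v)) × (Overlap (μ u) (μ v) → Adj G u v))

IsClean : ∀ {k m} → (Fin k → Subset m) → Set
IsClean μ = ∀ u v w → Overlap (μ u) (μ v) → μ w ⊆ μ u → μ w ⊆ μ v → ⊥

IsSubtreeOverlapGraph : Graph → Set₁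
IsSubtreeOverlapGraph G = Σ Graph λ T → IsTree T × Σ (Fin (n G) → Subset (n T)) λ μ →
  (∀ u → IsSubtree T (μ u)) × IsOverlapModel G μ

IsCleanSubtreeOverlapGraph : Graph → Set₁
IsCleanSubtreeOverlapGraph G = Σ Graph λ T → IsTree T × Σ (Fin (n G) → Subset (n T)) λ μ →
  (∀ u → IsSubtree T (μ u)) × IsOverlapModel G μ × IsClean μ

-- String graphs, via polygonal curves with rational vertices

Point : Set
Point = ℚ × ℚ

OnSegment : Point → Point → Point → Set
OnSegment (px , py) (ax , ay) (bx , by) = Σ ℚ λ t → (0ℚ ≤ℚ t) × (t ≤ℚ 1ℚ) ×
  (px ≡ ax +ℚ t *ℚ (bx -ℚ ax)) × (py ≡ ay +ℚ t *ℚ (by -ℚ ay))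

Curve : Set
Curve = List⁺ Point

OnPolyline : Point → Point → List Point → Set
OnPolyline p a [] = p ≡ a
OnPolyline p a (b ∷ rest) = OnSegment p a b ⊎ OnPolyline p b rest

OnCurve : Point → Curve → Set
OnCurve p (a ∷ rest) = OnPolyline p a rest

CurvesIntersect : Curve → Curve → Set
CurvesIntersect γ δ = Σ Point λ p → OnCurve p γ × OnCurve p δ

IsStringGraph : Graph → Set
IsStringGraph G = Σ (Fin (n G) → Curve) λ γ →
  ∀ u v → u ≢ v → (Adj G u v → CurvesIntersect (γ u) (γ v)) × (CurvesIntersect (γ u) (γ v) → Adj G u v)

loglog : ℕ → ℕ
loglog m = ⌊log₂ ⌊log₂ m ⌋ ⌋

{-# OPTIONS --safe #-}

-- Upper bounds. Root the tree. In a clean family the members containing a given one form a chain, so the members alive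
-- at a node form a forest under inclusion whose antichains are cliques. Colour from the root downwards: v inherits the
-- colour of the least member w containing it, unless w has a living branch below it; then v gets a colour missing on
-- that branch. A maximum clique ending in v either stays one when v is replaced by w or meets the branch, so no maximum
-- clique is monochromatic. Let the level of a member be determined by the logarithm of the number of members below it.
-- If no two overlapping members share a level, the changes of colour along a branch occupy disjoint intervals of levels,
-- and O(log log n) colours suffice; the members of one level are intervals on paths, and for them O(1) colours suffice.
-- Each round lowers the clique number by one, which gives (b). For (a), let the rank of a member be the depth to which
-- overlapping pairs are nested above it. Rank classes are clean; after colouring each of them, and separating ranks by
-- parity, the members of a monochromatic clique have ranks at least 2 apart, so that the pair above the deepest member
-- overlaps all the others, and again the clique number has dropped.
--
-- Lower bound. Let N₁ be a chain with many colours, and N₂ another one obtained by repeating the construction inside N₁.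
-- Either N₁ ∪ N₂ has more colours, or a copy of the construction for clique number ω − 1 placed inside N₁ and across N₂
-- brings colours that are missing in N₂, and mostly also in N₁. All outcomes are realised in one tree.
--
-- String graphs. Walk around the tree drawing every member at its own height; over the parts of the tree which it avoids
-- it dives below everything else. Two such curves cross exactly if the members overlap.

module Submission where

open import Data.Nat using (ℕ; zero; suc; _+_; _*_; _∸_; _^_; _≤_; _<_; z≤n; s≤s; s≤s⁻¹; _≤?_; _<?_)
open import Data.Nat.Properties
open import Data.Nat.Induction using (<-wellFounded)
open import Induction.WellFounded using (Acc; acc)
open import Data.Fin using (Fin; zero; suc; toℕ)
open import Data.Fin.Properties using (any?; all?; toℕ<n; toℕ-injective) renaming (_≟_ to _≟ᶠ_)
open import Data.Product using (Σ; ∃; _×_; _,_; proj₁; proj₂)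
open import Data.Sum using (_⊎_; inj₁; inj₂)
open import Data.Empty using (⊥; ⊥-elim)
open import Relation.Binary.Definitions using (tri<; tri≈; tri>)
open import Relation.Nullary using (¬_; Dec; yes; no; does; contradiction)
open import Relation.Nullary.Decidable using (¬?; _×-dec_; decidable-stable)
open import Relation.Binary.PropositionalEquality using (_≡_; _≢_; refl; sym; trans; cong; cong₂; subst)

-- The two logarithms have different sources. The first counts levels: a level is `suc Λ` minus the
-- rounded logarithm of the number of tops at or below that of the member, so there are about log n
-- levels. The second measures intervals of levels: a change of colour at `v` owns the levels above
-- that of its parent up to its own, and is tagged by the rounded logarithm of their number. The
-- intervals on the branch next to `v` are disjoint and lie in that of `v`, so at most one of them
-- has the tag of `v`; three shades per tag suffice. Inside a single level there is no such measure.
-- There the tops below a member lie on a path, and shades are chosen in the order of decreasing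
-- right ends: the member on the branch gives way to `v`, not `v` to it. In the lower bound a
-- composition raises the size bound to its fourth power, so log log n is at most linear in the
-- number i of compositions, while the forced number of colours grows by half of what clique number
-- ω - 1 forces; summing up gives the order i^(ω-1).

-- Finite searches, greedy colouring, and cliques as lists.

module Finite where

  open import Data.Nat.ListAction using (sum)
  open import Data.Nat.ListAction.Properties using (sum-↭)
  open import Data.Fin using (combine)
  open import Data.Fin.Properties using (pigeonhole; combine-injective)
  open import Data.Maybe using (Maybe; just; nothing; maybe′)
  open import Data.List using (List; []; _∷_; map; length; lookup; tabulate)
  open import Data.List.Properties using (map-cong-local; length-map)
  open import Data.List.Membership.Propositional using (_∈_; _∉_)
  open import Data.List.Membership.Propositional.Properties using (∈-map⁺)
  open import Data.List.Membership.DecPropositional using () renaming (_∈?_ to mem?)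
  open import Data.List.Relation.Unary.Any using (index)
  open import Data.List.Relation.Unary.Any.Properties using (lookup-index)
  open import Data.List.Relation.Unary.All as All using (All; []; _∷_)
  open import Data.List.Relation.Unary.AllPairs using (AllPairs; []; _∷_)
  open import Data.List.Relation.Unary.Unique.Propositional using (Unique)
  open import Data.List.Relation.Binary.Permutation.Propositional using (_↭_; ↭-refl; ↭-trans; prep; swap; ↭⇒↭ₛ)
  open import Data.List.Relation.Binary.Permutation.Propositional.Properties using (All-resp-↭; ↭-length; map⁺)
  open import Data.List.Relation.Binary.Permutation.Setoid.Properties using (AllPairs-resp-↭)
  open import Relation.Binary.PropositionalEquality using (setoid; resp₂)

  Largest Smallest : ∀ {n} → (Fin n → Set) → (Fin n → ℕ) → Fin n → Set
  Largest P key v = P v × (∀ u → P u → key u ≤ key v)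
  Smallest P key v = P v × (∀ u → P u → key v ≤ key u)

  largest : ∀ {n} {P : Fin n → Set} → (∀ v → Dec (P v)) → (key : Fin n → ℕ) → Σ (Fin n) (Largest P key) ⊎ (∀ u → ¬ P u)
  largest {zero} P? key = inj₂ λ ()
  largest {suc n} {P} P? key with P? zero | largest {n} (λ v → P? (suc v)) (λ v → key (suc v))
  ... | no ¬p | inj₂ none = inj₂ λ { zero → ¬p ; (suc u) → none u }
  ... | no ¬p | inj₁ (v , pv , m) = inj₁ (suc v , pv , λ { zero p → contradiction p ¬p ; (suc u) → m u })
  ... | yes p | inj₂ none = inj₁ (zero , p , λ { zero _ → ≤-refl ; (suc u) q → contradiction q (none u) })
  ... | yes p | inj₁ (v , pv , m) with ≤-total (key zero) (key (suc v))
  ...   | inj₁ le = inj₁ (suc v , pv , λ { zero _ → le ; (suc u) → m u })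
  ...   | inj₂ ge = inj₁ (zero , p , λ { zero _ → ≤-refl ; (suc u) q → ≤-trans (m u q) ge })

  bounded : ∀ {n} (f : Fin n → ℕ) → Σ ℕ λ N → ∀ v → f v < N
  bounded {zero} f = 0 , λ ()
  bounded {suc n} f with bounded (λ v → f (suc v))
  ... | N , h = suc (f zero) + N , λ { zero → m≤m+n _ N ; (suc v) → ≤-trans (h v) (m≤n+m N (suc (f zero))) }

  smallest : ∀ {n} {P : Fin n → Set} → (∀ v → Dec (P v)) → (key : Fin n → ℕ) → Σ (Fin n) (Smallest P key) ⊎ (∀ u → ¬ P u)
  smallest P? key with bounded key
  ... | N , below with largest P? (λ v → N ∸ key v)
  ...   | inj₂ none = inj₂ none
  ...   | inj₁ (v , pv , top) = inj₁ (v , pv , λ u pu → ∸-cancelʳ-≤ (<⇒≤ (below v)) (top u pu))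

  -- Course-of-values recursion on `key`. Iterating `F` finitely often is enough, since the value at
  -- `v` is stable after `suc (key v)` rounds, and the result comes with its unfolding equation.
  fixpoint : ∀ {n} {Col : Set} (key : Fin n → ℕ) (F : (Fin n → Col) → Fin n → Col) →
    (∀ c c′ v → (∀ u → key u < key v → c u ≡ c′ u) → F c v ≡ F c′ v) → (Fin n → Col) →
    Σ (Fin n → Col) λ c → ∀ v → c v ≡ F c v
  fixpoint {n} {Col} key F dep c₀ = iter N , λ v → sym (stable N v (proj₂ (bounded key) v))
    where
    N = proj₁ (bounded key)
    iter : ℕ → Fin n → Col
    iter zero = c₀
    iter (suc t) = F (iter t)
    stable : ∀ t v → key v < t → iter (suc t) v ≡ iter t v
    stable (suc t) v (s≤s lt) = dep _ _ v λ u lt′ → stable t u (≤-trans lt′ lt)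

  fresh : ∀ d → List (Fin (suc d)) → Fin (suc d)
  fresh d xs with any? (λ i → ¬? (mem? _≟ᶠ_ i xs))
  ... | yes (i , _) = i
  ... | no _ = zero

  fresh-∉ : ∀ d xs → length xs ≤ d → fresh d xs ∉ xs
  fresh-∉ d xs le with any? (λ i → ¬? (mem? _≟ᶠ_ i xs))
  ... | yes (i , h) = h
  ... | no none = ⊥-elim (lemma (pigeonhole (s≤s le) (λ i → index (all i))))
    where
    all : ∀ i → i ∈ xs
    all i = decidable-stable (mem? _≟ᶠ_ i xs) λ h → none (i , h)
    lemma : (∃ λ i → ∃ λ j → toℕ i < toℕ j × index (all i) ≡ index (all j)) → ⊥
    lemma (i , j , lt , eq) = <⇒≢ lt (cong toℕ (trans (lookup-index (all i)) (trans (cong (lookup xs) eq) (sym (lookup-index (all j))))))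

  -- `nothing` stands for a missing origin; its colour is fixed as `zero`, so that it can be avoided
  -- like a vertex.
  greedy : ∀ {n} d (key : Fin n → ℕ) (avoid : Fin n → List (Maybe (Fin n))) →
    (∀ v u → just u ∈ avoid v → key u < key v) → (∀ v → length (avoid v) ≤ d) →
    Σ (Maybe (Fin n) → Fin (suc d)) λ col → ∀ v x → x ∈ avoid v → col x ≢ col (just v)
  greedy {n} d key avoid down short = ext c , good
    where
    ext : (Fin n → Fin (suc d)) → Maybe (Fin n) → Fin (suc d)
    ext c = maybe′ c zero
    F : (Fin n → Fin (suc d)) → Fin n → Fin (suc d)
    F c v = fresh d (map (ext c) (avoid v))
    same : ∀ c c′ v → (∀ u → key u < key v → c u ≡ c′ u) → F c v ≡ F c′ v
    same c c′ v h = cong (fresh d) (map-cong-local (All.tabulate pointwise))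
      where
      pointwise : ∀ {x} → x ∈ avoid v → ext c x ≡ ext c′ x
      pointwise {nothing} _ = refl
      pointwise {just u} m = h u (down v u m)
    sol = fixpoint key F same (λ _ → zero)
    c = proj₁ sol
    good : ∀ v x → x ∈ avoid v → ext c x ≢ c v
    good v x m eq = fresh-∉ d (map (ext c) (avoid v)) (subst (_≤ d) (sym (length-map (ext c) (avoid v))) (short v))
      (subst (_∈ map (ext c) (avoid v)) (trans eq (proj₂ sol v)) (∈-map⁺ (ext c) m))

  module _ {n : ℕ} where

    Clique : (E : Fin n → Fin n → Set) (X : Fin n → Set) → List (Fin n) → Set
    Clique E X xs = All X xs × AllPairs E xs

    CliqueBound : (E : Fin n → Fin n → Set) (X : Fin n → Set) → ℕ → Set
    CliqueBound E X j = ∀ xs → Clique E X xs → length xs ≤ j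

    clique-resp-↭ : ∀ {E X} → (∀ {u v} → E u v → E v u) → ∀ {xs ys} → xs ↭ ys → Clique E X xs → Clique E X ys
    clique-resp-↭ E-sym p (a , ps) = All-resp-↭ p a , AllPairs-resp-↭ (setoid _) E-sym (resp₂ _) (↭⇒↭ₛ p) ps

    pull-max : (key : Fin n → ℕ) → ∀ x xs → Σ (Fin n) λ y → Σ (List (Fin n)) λ ys → (x ∷ xs) ↭ (y ∷ ys) × All (λ z → key z ≤ key y) ys
    pull-max key x [] = x , [] , ↭-refl , []
    pull-max key x (x′ ∷ xs) with pull-max key x′ xs
    ... | y , ys , p , top with ≤-total (key x) (key y)
    ...   | inj₁ le = y , x ∷ ys , ↭-trans (prep x p) (swap x y ↭-refl) , le ∷ top
    ...   | inj₂ ge = x , y ∷ ys , prep x p , ge ∷ All.map (λ h → ≤-trans h ge) top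

    -- Why a monochromatic clique with last vertex v is not maximum: v can be replaced by an earlier vertex, or the
    -- clique can be extended.
    data Reason (E : Fin n → Fin n → Set) (X : Fin n → Set) {Col : Set} (c : Fin n → Col) (τ : Fin n → ℕ) (v : Fin n) : Set where
      inherit : ∀ w → X w → τ w < τ v → c w ≡ c v → (∀ q → X q → τ q < τ v → E q v → c q ≡ c v → E w q) → Reason E X c τ v
      block   : ∀ ℓ → X ℓ → E ℓ v → (∀ q → X q → τ q < τ v → E q v → c q ≡ c v → E ℓ q) → Reason E X c τ v
      alone   : (∀ q → X q → τ q < τ v → E q v → c q ≢ c v) → Reason E X c τ v

    -- Consider the latest vertex `v` of the clique. `block` adds a vertex, of whatever colour, and
    -- the bound `suc j` applies; `alone` leaves only `v`; `inherit` exchanges `v` for an earlier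
    -- vertex and starts again, which ends because the sum of `τ` drops.
    mono-clique-bound : ∀ {E X} {Col : Set} {c : Fin n → Col} {τ : Fin n → ℕ} → (∀ {u v} → E u v → E v u) → (∀ {u} → ¬ E u u) →
      (∀ {u v} → τ u ≡ τ v → u ≡ v) → (∀ v → X v → Reason E X c τ v) → ∀ j → 1 ≤ j → CliqueBound E X (suc j) →
      ∀ k → CliqueBound E (λ v → X v × c v ≡ k) j
    mono-clique-bound {E} {X} {Col} {c} {τ} E-sym E-irr τ-inj reason j 1≤j bound k xs₀ cl₀ = go xs₀ cl₀ (<-wellFounded _)
      where
      go : ∀ xs → Clique E (λ v → X v × c v ≡ k) xs → Acc _<_ (sum (map τ xs)) → length xs ≤ j
      go [] _ _ = z≤n
      go (x ∷ xs) cl (acc rec) with pull-max τ x xs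
      ... | v , ys , p , top with clique-resp-↭ E-sym p cl
      ...   | (Xv , cv) ∷ Xys , Ev ∷ Eys = subst (_≤ j) (sym (↭-length p)) (by-reason (reason v Xv))
        where
        Step : Fin n → Set
        Step q = X q × τ q < τ v × E q v × c q ≡ c v
        step : All Step ys
        step = All.tabulate λ {q} q∈ → proj₁ (All.lookup Xys q∈) ,
          ≤∧≢⇒< (All.lookup top q∈) (λ eq → E-irr (subst (λ z → E z q) (sym (τ-inj eq)) (All.lookup Ev q∈))) ,
          E-sym (All.lookup Ev q∈) , trans (proj₂ (All.lookup Xys q∈)) (sym cv)
        by-reason : Reason E X c τ v → length (v ∷ ys) ≤ j
        by-reason (inherit w Xw lt eq h) = go (w ∷ ys)
          ((Xw , trans eq cv) ∷ Xys , All.map (λ { (a , b , d , e) → h _ a b d e }) step ∷ Eys)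
          (rec (subst (sum (map τ (w ∷ ys)) <_) (sym (sum-↭ (map⁺ τ p))) (+-monoˡ-< (sum (map τ ys)) lt)))
        by-reason (block ℓ Xℓ Eℓ h) = s≤s⁻¹ (bound (ℓ ∷ v ∷ ys) (Xℓ ∷ Xv ∷ All.map proj₁ Xys ,
          (Eℓ ∷ All.map (λ { (a , b , d , e) → h _ a b d e }) step) ∷ Ev ∷ Eys))
        by-reason (alone h) = none step
          where
          none : ∀ {zs} → All Step zs → suc (length zs) ≤ j
          none [] = 1≤j
          none ((a , b , d , e) ∷ _) = contradiction e (h _ a b d)

    Proper : (E : Fin n → Fin n → Set) (X : Fin n → Set) {Col : Set} → (Fin n → Col) → Set
    Proper E X c = ∀ u v → X u → X v → E u v → c u ≢ c v

    refine : ∀ {E X K L} (c : Fin n → Fin K) → (∀ k → Σ (Fin n → Fin L) (Proper E (λ v → X v × c v ≡ k))) →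
      Σ (Fin n → Fin (K * L)) (Proper E X)
    refine {E} {X} {K} {L} c rest = (λ v → combine (c v) (proj₁ (rest (c v)) v)) , good
      where
      good : Proper E X (λ v → combine (c v) (proj₁ (rest (c v)) v))
      good u v Xu Xv e eq with combine-injective (c u) (proj₁ (rest (c u)) u) (c v) (proj₁ (rest (c v)) v) eq
      ... | eq₁ , eq₂ = proj₂ (rest (c u)) u v (Xu , refl) (Xv , sym eq₁) e (trans eq₂ (cong (λ k → proj₁ (rest k) v) (sym eq₁)))

    -- Every round lowers the clique bound by one, until no edges are left. `J` bounds all the `j`
    -- that occur, so that one `K` serves every round.
    iterate : ∀ {E} (Hyp : (Fin n → Set) → Set) → (∀ {X Y : Fin n → Set} → (∀ v → Y v → X v) → Hyp X → Hyp Y) → ∀ K J →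
      (∀ j X → (∀ v → Dec (X v)) → Hyp X → 1 ≤ j → j < J → CliqueBound E X (suc j) →
        Σ (Fin n → Fin K) λ c → ∀ k → CliqueBound E (λ v → X v × c v ≡ k) j) →
      ∀ j X → (∀ v → Dec (X v)) → Hyp X → j < J → CliqueBound E X (suc j) → Σ (Fin n → Fin (K ^ j)) (Proper E X)
    iterate Hyp sub K J step zero X X? H _ bound = (λ _ → zero) , λ u v Xu Xv e _ →
      contradiction (bound (u ∷ v ∷ []) (Xu ∷ Xv ∷ [] , (e ∷ []) ∷ [] ∷ [])) λ { (s≤s ()) }
    iterate Hyp sub K J step (suc j) X X? H lt bound with step (suc j) X X? H (s≤s z≤n) lt bound
    ... | c , h = refine c λ k → iterate Hyp sub K J step j (λ v → X v × c v ≡ k) (λ v → X? v ×-dec (c v ≟ᶠ k))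
      (sub (λ _ → proj₁) H) (<-trans (n<1+n j) lt) (h k)

    allPairs-unique : ∀ {E : Fin n → Fin n → Set} {P : Fin n → Set} → (∀ {u v} → P u → P v → u ≢ v → E u v) →
      ∀ {xs} → All P xs → Unique xs → AllPairs E xs
    allPairs-unique h [] [] = []
    allPairs-unique h (p ∷ ps) (ne ∷ u) = All.tabulate (λ m → h p (All.lookup ps m) (All.lookup ne m)) ∷ allPairs-unique h ps u

-- The abstract model of a rooted family, and the inheritance of colours in a clean class.

module Inheritance where

  open import Data.Nat.Logarithm using (⌊log₂_⌋; ⌊log₂⌋-mono-≤; ⌊log₂[2^n]⌋≡n)
  open import Data.Maybe using (Maybe; just; nothing)
  open import Data.Maybe.Properties using (just-injective)
  open import Relation.Nullary.Decidable using (_→-dec_)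
  open Finite

  bump : ℕ → ℕ → ℕ
  bump t n with 2 ^ suc t ≤? n
  ... | yes _ = suc t
  ... | no _ = t

  -- The binary logarithm rounded down, grown one number at a time so that a single induction gives
  -- both bounds of `lg-spec`.
  lg : ℕ → ℕ
  lg zero = 0
  lg (suc zero) = 0
  lg (suc (suc n)) = bump (lg (suc n)) (suc (suc n))

  bump-spec : ∀ t n → 2 ^ t ≤ n → n < 2 ^ suc t → 2 ^ bump t (suc n) ≤ suc n × suc n < 2 ^ suc (bump t (suc n))
  bump-spec t n lo hi with 2 ^ suc t ≤? suc n
  ... | no gt = ≤-trans lo (n≤1+n _) , ≰⇒> gt
  ... | yes le = le , (begin-strict
      suc n ≤⟨ hi ⟩
      2 ^ suc t <⟨ m<m+n (2 ^ suc t) (m^n>0 2 (suc t)) ⟩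
      2 ^ suc t + 2 ^ suc t ≡⟨ cong (2 ^ suc t +_) (sym (+-identityʳ _)) ⟩
      2 ^ suc (suc t) ∎)
    where open ≤-Reasoning

  lg-spec : ∀ n → 1 ≤ n → 2 ^ lg n ≤ n × n < 2 ^ suc (lg n)
  lg-spec (suc zero) _ = ≤-refl , ≤-refl
  lg-spec (suc (suc n)) _ with lg-spec (suc n) (s≤s z≤n)
  ... | lo , hi = bump-spec (lg (suc n)) (suc n) lo hi

  lg≤log₂ : ∀ n → lg n ≤ ⌊log₂ n ⌋
  lg≤log₂ zero = z≤n
  lg≤log₂ n@(suc _) = subst (_≤ ⌊log₂ n ⌋) (⌊log₂[2^n]⌋≡n (lg n)) (⌊log₂⌋-mono-≤ (proj₁ (lg-spec n (s≤s z≤n))))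

  -- A family of subtrees S u of a rooted tree with tops ρ u, as seen by the colouring arguments:
  -- Anc u v says that ρ u is an ancestor of ρ v, A u v that ρ v ∈ S u, C u v that S v ⊆ S u, and O is overlap.
  record Model (n : ℕ) : Set₁ where
    field
      Anc A C O : Fin n → Fin n → Set
      A? : ∀ u v → Dec (A u v)
      C? : ∀ u v → Dec (C u v)
      O? : ∀ u v → Dec (O u v)
      τ dep : Fin n → ℕ
      τ-inj : ∀ {u v} → τ u ≡ τ v → u ≡ v
      Anc-trans : ∀ {u v w} → Anc u v → Anc v w → Anc u w
      Anc-flip : ∀ {u v} → Anc u v → dep v ≤ dep u → Anc v u
      A-refl : ∀ {u} → A u u
      A⇒Anc : ∀ {u v} → A u v → Anc u v
      A-mid : ∀ {u v w} → A u w → Anc u v → Anc v w → A u v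
      C-refl : ∀ {u} → C u u
      C-trans : ∀ {u v w} → C u v → C v w → C u w
      C-A : ∀ {u v w} → C u v → A v w → A u w
      C-τ : ∀ {u v} → C u v → u ≢ v → τ u < τ v
      O-sym : ∀ {u v} → O u v → O v u
      O-¬C : ∀ {u v} → O u v → ¬ C u v
      O-A : ∀ {u v} → O u v → τ u < τ v → A u v
      meet : ∀ {u v w} → A u w → A v w → C u v ⊎ C v u ⊎ O u v

    C⇒A : ∀ {u v} → C u v → A u v
    C⇒A c = C-A c A-refl

    O-irr : ∀ {u} → ¬ O u u
    O-irr o = O-¬C o C-refl

    O-¬C′ : ∀ {u v} → O u v → ¬ C v u
    O-¬C′ o = O-¬C (O-sym o)

    C-τ≤ : ∀ {u v} → C u v → τ u ≤ τ v
    C-τ≤ {u} {v} c with u ≟ᶠ v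
    ... | yes refl = ≤-refl
    ... | no ne = <⇒≤ (C-τ c ne)

    C-antisym : ∀ {u v} → C u v → C v u → u ≡ v
    C-antisym c c′ = τ-inj (≤-antisym (C-τ≤ c) (C-τ≤ c′))

    later-¬C : ∀ {u v} → τ u < τ v → ¬ C v u
    later-¬C lt c = <⇒≱ lt (C-τ≤ c)

    earlier-≢ : ∀ {u v} → τ u < τ v → u ≢ v
    earlier-≢ lt refl = <-irrefl refl lt

    Clean : (Fin n → Set) → Set
    Clean X = ∀ {u v w} → X u → X v → X w → O u v → C u w → C v w → ⊥

  module Skeleton {n : ℕ} (M : Model n) (X : Fin n → Set) (X? : ∀ v → Dec (X v)) (clean : Model.Clean M X) where
    open Model M

    Sup : Fin n → Fin n → Set
    Sup v z = X z × C z v × z ≢ v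

    sup? : ∀ v z → Dec (Sup v z)
    sup? v z = X? z ×-dec (C? z v ×-dec ¬? (z ≟ᶠ v))

    -- Being inside the parent of `v` is phrased with all proper supersets of `v`, so that it also
    -- makes sense for a `v` without parent.
    Inside : Fin n → Fin n → Set
    Inside v u = ∀ z → Sup v z → C z u

    inside? : ∀ v u → Dec (Inside v u)
    inside? v u = all? λ z → sup? v z →-dec C? z u

    -- The members that are alive when v arrives and lie next to v, below the parent of v.
    Below : Fin n → Fin n → Set
    Below v u = X u × τ u < τ v × A u v × ¬ C u v × Inside v u

    below? : ∀ v u → Dec (Below v u)
    below? v u = X? u ×-dec ((τ u <? τ v) ×-dec (A? u v ×-dec (¬? (C? u v) ×-dec inside? v u)))

    Parent : Fin n → Fin n → Set
    Parent v = Largest (Sup v) τ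

    Last : Fin n → Fin n → Set
    Last v = Largest (Below v) τ

    findParent : ∀ v → Σ (Fin n) (Parent v) ⊎ (∀ z → ¬ Sup v z)
    findParent v = largest (sup? v) τ

    findLast : ∀ v → Σ (Fin n) (Last v) ⊎ (∀ u → ¬ Below v u)
    findLast v = largest (below? v) τ

    largest-unique : ∀ {P : Fin n → Set} {a b} → Largest P τ a → Largest P τ b → a ≡ b
    largest-unique (pa , ma) (pb , mb) = τ-inj (≤-antisym (mb _ pa) (ma _ pb))

    comparable : ∀ {u v w} → X u → X v → X w → C u w → C v w → C u v ⊎ C v u
    comparable Xu Xv Xw c c′ with meet (C⇒A c) (C⇒A c′)
    ... | inj₁ h = inj₁ h
    ... | inj₂ (inj₁ h) = inj₂ h
    ... | inj₂ (inj₂ o) = ⊥-elim (clean Xu Xv Xw o c c′)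

    -- The parent is chosen as the latest superset; cleanness makes the supersets of `v` a chain,
    -- along which `τ` grows inwards.
    parent-least : ∀ {v w z} → X v → Parent v w → Sup v z → C z w
    parent-least {v} {w} {z} Xv ((Xw , cw , w≢v) , top) s@(Xz , cz , _) with comparable Xz Xw Xv cz cw
    ... | inj₁ h = h
    ... | inj₂ h = subst (λ y → C y w) (τ-inj (≤-antisym (C-τ≤ h) (top z s))) C-refl

    parentOrigin : (Fin n → Maybe (Fin n)) → ∀ {v} → Σ (Fin n) (Parent v) ⊎ (∀ z → ¬ Sup v z) → Maybe (Fin n)
    parentOrigin o (inj₁ (w , _)) = o w
    parentOrigin o (inj₂ _) = nothing

    originStep : (Fin n → Maybe (Fin n)) → ∀ v → Σ (Fin n) (Last v) ⊎ (∀ u → ¬ Below v u) → Maybe (Fin n)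
    originStep o v (inj₁ _) = just v
    originStep o v (inj₂ _) = parentOrigin o (findParent v)

    originFix : Σ (Fin n → Maybe (Fin n)) λ o → ∀ v → o v ≡ originStep o v (findLast v)
    originFix = fixpoint τ (λ o v → originStep o v (findLast v)) same (λ _ → nothing)
      where
      same : ∀ o o′ v → (∀ u → τ u < τ v → o u ≡ o′ u) → originStep o v (findLast v) ≡ originStep o′ v (findLast v)
      same o o′ v h with findLast v
      ... | inj₁ _ = refl
      ... | inj₂ _ with findParent v
      ...   | inj₁ (w , (_ , c , ne) , _) = h w (C-τ c ne)
      ...   | inj₂ _ = refl

    -- Colours are inherited from the parent by members with nothing below; the origin is where the colour came from.
    origin : Fin n → Maybe (Fin n)
    origin = proj₁ originFix

    above : Fin n → Maybe (Fin n)
    above v = parentOrigin origin (findParent v)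

    origin-self : ∀ {v u} → Below v u → origin v ≡ just v
    origin-self {v} {u} b with findLast v | proj₂ originFix v
    ... | inj₁ _ | eq = eq
    ... | inj₂ none | _ = contradiction b (none u)

    origin-above : ∀ {v} → (∀ u → ¬ Below v u) → origin v ≡ above v
    origin-above {v} none with findLast v | proj₂ originFix v
    ... | inj₁ (ℓ , b , _) | _ = contradiction b (none ℓ)
    ... | inj₂ _ | eq = eq

    above-parent : ∀ {v w} → Parent v w → above v ≡ origin w
    above-parent {v} {w} p with findParent v
    ... | inj₁ (w′ , p′) = cong origin (largest-unique p′ p)
    ... | inj₂ none = contradiction (proj₁ p) (none w)

    above-root : ∀ {v} → (∀ z → ¬ Sup v z) → above v ≡ nothing
    above-root {v} none with findParent v
    ... | inj₁ (w , s , _) = contradiction s (none w)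
    ... | inj₂ _ = refl

    Branching : Fin n → Set
    Branching v = Σ (Fin n) (Below v)

    origin-C : ∀ {v y} → origin v ≡ just y → C y v × Branching y
    origin-C {v} = go v (<-wellFounded _)
      where
      go : ∀ v {y} → Acc _<_ (τ v) → origin v ≡ just y → C y v × Branching y
      go v {y} (acc rec) eq with findLast v
      ... | inj₁ (ℓ , b , _) with refl ← just-injective (trans (sym eq) (origin-self b)) = C-refl , ℓ , b
      ... | inj₂ none with findParent v
      ...   | inj₂ root = contradiction (trans (sym eq) (trans (origin-above none) (above-root root))) λ ()
      ...   | inj₁ (w , p@((_ , c , ne) , _)) with go w (rec (C-τ c ne)) (trans (sym (trans (origin-above none) (above-parent p))) eq)
      ...     | c′ , b = C-trans c′ c , b

    above-C : ∀ {v y} → above v ≡ just y → Σ (Fin n) λ w → Parent v w × C y w × Branching y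
    above-C {v} eq with findParent v
    ... | inj₁ (w , p) with origin-C eq
    ...   | c , b = w , p , c , b

    -- The branch next to v that ends in ℓ.
    Side : Fin n → Fin n → Fin n → Set
    Side v ℓ z = X z × C z ℓ × ¬ C z v

    side? : ∀ v ℓ z → Dec (Side v ℓ z)
    side? v ℓ z = X? z ×-dec (C? z ℓ ×-dec ¬? (C? z v))

    -- Both `z` and `q` contain `ℓ`, hence are comparable, and `q` cannot contain `z`, as it would
    -- then contain `v`.
    side-inside : ∀ {v ℓ q z} → X v → Below v ℓ → Side v ℓ q → Sup v z → Sup q z
    side-inside {v} {ℓ} {q} {z} Xv (Xℓ , _ , _ , _ , ins) (Xq , cq , ¬c) s@(Xz , cz , _)
      with comparable Xz Xq Xℓ (ins z s) cq
    ... | inj₁ h = Xz , h , λ { refl → ¬c cz }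
    ... | inj₂ h = contradiction (C-trans h cz) ¬c

    side-below : ∀ {v ℓ q} → X v → Below v ℓ → Side v ℓ q → Below v q
    side-below Xv b@(Xℓ , lt , a , _) s@(Xq , cq , ¬c) =
      Xq , ≤-<-trans (C-τ≤ cq) lt , C-A cq a , ¬c , λ z sz → proj₁ (proj₂ (side-inside Xv b s sz))

    below-O : ∀ {v u} → Below v u → O u v
    below-O (_ , lt , a , ¬c , _) with meet a A-refl
    ... | inj₁ c = contradiction c ¬c
    ... | inj₂ (inj₁ c) = contradiction c (later-¬C lt)
    ... | inj₂ (inj₂ o) = o

    -- Climb from parent to parent. Either a member still on the branch has a colour of its own, or
    -- the climb leaves the branch at a member containing `v`, which is then the parent of `v` too,
    -- or it ends without a parent, and then `v` has none either.
    side-origin : ∀ {v ℓ q} → X v → Below v ℓ → Side v ℓ q →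
      origin q ≡ above v ⊎ Σ (Fin n) λ y → origin q ≡ just y × Branching y × Side v ℓ y
    side-origin {v} {ℓ} {q} Xv bℓ = go q (<-wellFounded _)
      where
      go : ∀ q → Acc _<_ (τ q) → Side v ℓ q → origin q ≡ above v ⊎ Σ (Fin n) λ y → origin q ≡ just y × Branching y × Side v ℓ y
      go q (acc rec) s@(Xq , cq , ¬c) with findLast q
      ... | inj₁ (m , b , _) = inj₂ (q , origin-self b , (m , b) , s)
      ... | inj₂ none with findParent q
      ...   | inj₂ root = inj₁ (trans (origin-above none) (trans (above-root root)
                (sym (above-root λ z sz → root z (side-inside Xv bℓ s sz)))))
      ...   | inj₁ (p , par@((Xp , cp , ne) , top)) with C? p v
      ...     | no ¬cp with go p (rec (C-τ cp ne)) (Xp , C-trans cp cq , ¬cp)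
      ...       | inj₁ eq = inj₁ (trans (origin-above none) (trans (above-parent par) eq))
      ...       | inj₂ (y , eq , r) = inj₂ (y , trans (origin-above none) (trans (above-parent par) eq) , r)
      go q (acc rec) s@(Xq , cq , ¬c) | inj₂ none | inj₁ (p , par@((Xp , cp , ne) , top)) | yes cpv =
        inj₁ (trans (origin-above none) (trans (above-parent par) (sym (above-parent
          ((Xp , cpv , λ { refl → later-¬C (≤-<-trans (C-τ≤ cq) (proj₁ (proj₂ bℓ))) cp }) ,
           λ z sz → top z (side-inside Xv bℓ s sz))))))

    -- The skeleton lives on `X`, the cliques in `X₀`, and `back` returns members with the colour of
    -- `v` to `X`. If `ℓ` is last below `v`, a `q` of that colour not overlapping `ℓ` either
    -- contains it, so lies on the branch, or is inside it, so would come later below `v`. If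
    -- nothing is below `v`, the parent replaces `v`: an overlapping `q` inside the parent would
    -- itself be below `v`.
    reason : ∀ {X₀ : Fin n → Set} {Col : Set} {c : Fin n → Col} {v} → (∀ {u} → X u → X₀ u) → (∀ q → X₀ q → c q ≡ c v → X q) → X v →
      ((∀ u → ¬ Below v u) → ∀ w → Parent v w → c w ≡ c v) →
      (∀ ℓ → Last v ℓ → ∀ q → Side v ℓ q → c q ≢ c v) → Reason O X₀ c τ v
    reason {X₀} {Col} {c} {v} X⇒X₀ back Xv heads sides with findLast v
    ... | inj₁ (ℓ , b@(Xℓ , ltℓ , aℓ , ¬cℓ , ins) , top) = block ℓ (X⇒X₀ Xℓ) (below-O b) against
      where
      against : ∀ q → X₀ q → τ q < τ v → O q v → c q ≡ c v → O ℓ q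
      against q X₀q lt o eq with meet aℓ (O-A o lt)
      ... | inj₂ (inj₂ h) = h
      ... | inj₂ (inj₁ cq) = contradiction eq (sides ℓ (b , top) q (back q X₀q eq , cq , O-¬C o))
      ... | inj₁ cℓ with ℓ ≟ᶠ q
      ...   | yes refl = contradiction eq (sides ℓ (b , top) ℓ (Xℓ , C-refl , ¬cℓ))
      ...   | no ne = contradiction (top q (back q X₀q eq , lt , O-A o lt , O-¬C o , λ z s → C-trans (ins z s) cℓ)) (<⇒≱ (C-τ cℓ ne))
    ... | inj₂ none with findParent v
    ...   | inj₂ root = alone λ q X₀q lt o eq →
      none q (back q X₀q eq , lt , O-A o lt , O-¬C o , λ z s → contradiction s (root z))
    ...   | inj₁ (w , p@((Xw , cw , ne) , _)) = inherit w (X⇒X₀ Xw) (C-τ cw ne) (heads none w p) keep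
      where
      keep : ∀ q → X₀ q → τ q < τ v → O q v → c q ≡ c v → O w q
      keep q X₀q lt o eq with meet (C⇒A cw) (O-A o lt)
      ... | inj₂ (inj₂ h) = h
      ... | inj₂ (inj₁ cq) = contradiction (C-trans cq cw) (O-¬C o)
      ... | inj₁ c′ = contradiction (back q X₀q eq , lt , O-A o lt , O-¬C o , λ z s → C-trans (parent-least Xv p s) c′) (none q)

-- The tree step: overlapping members have different levels.

module Levels where

  open import Data.Nat.Logarithm using (⌊log₂_⌋; ⌊log₂⌋-mono-≤)
  open import Data.Fin using (combine; fromℕ<)
  open import Data.Fin.Properties using (combine-injective; fromℕ<-injective)
  open import Data.Maybe using (Maybe; just; nothing)
  open import Data.List using (List; []; _∷_; length)
  open import Data.List.Membership.Propositional using (_∈_)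
  open import Data.List.Relation.Unary.Any using (here; there)
  open Finite
  open Inheritance

  module Levelled {n : ℕ} (M : Model n) (lev : Fin n → ℕ) (Λ : ℕ) (lev-pos : ∀ v → 1 ≤ lev v) (lev-top : ∀ v → lev v ≤ suc Λ)
    (lev-mono : ∀ {u v} → Model.A M u v → lev u ≤ lev v) where
    open Model M

    Apart : (Fin n → Set) → Set
    Apart X = ∀ {u v} → X u → X v → O u v → lev u ≢ lev v

    module Within (X : Fin n → Set) (X? : ∀ v → Dec (X v)) (clean : Clean X) (apart : Apart X) where
      open Skeleton M X X? clean

      -- The window of `v` consists of the levels above `base v` up to `lev v`. Levels start at 1,
      -- so base 0 gives a member without parent all of them.
      baseOf : ∀ {v} → Σ (Fin n) (Parent v) ⊎ (∀ z → ¬ Sup v z) → ℕ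
      baseOf (inj₁ (w , _)) = lev w
      baseOf (inj₂ _) = 0

      base win tag : Fin n → ℕ
      base v = baseOf (findParent v)
      win v = lev v ∸ base v
      tag v = lg (win v)

      base-sup : ∀ {v z} → X v → Sup v z → lev z ≤ base v
      base-sup {v} {z} Xv s with findParent v
      ... | inj₁ (w , p) = lev-mono (C⇒A (parent-least Xv p s))
      ... | inj₂ root = contradiction s (root z)

      base-side : ∀ {v ℓ q} → X v → Below v ℓ → Side v ℓ q → base v ≤ base q
      base-side {v} Xv b s@(Xq , _) with findParent v
      ... | inj₁ (w , (sw , _)) = base-sup Xq (side-inside Xv b s sw)
      ... | inj₂ _ = z≤n

      lev-below : ∀ {v u} → X v → Below v u → lev u < lev v
      lev-below Xv b@(Xu , lt , a , _) = ≤∧≢⇒< (lev-mono a) (apart Xu Xv (below-O b))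

      -- A parent may share the level of `v`, as only overlapping members are kept apart. A member
      -- below `v` overlaps `v` and lies inside the parent, which forces a strict gap.
      base-below : ∀ {v u} → X v → Below v u → base v < lev v
      base-below {v} Xv b@(_ , _ , _ , _ , ins) with findParent v
      ... | inj₁ (w , (sw , _)) = ≤-<-trans (lev-mono (C⇒A (ins w sw))) (lev-below Xv b)
      ... | inj₂ _ = lev-pos v

      win-pos : ∀ {v u} → X v → Below v u → 1 ≤ win v
      win-pos Xv b = m<n⇒0<n∸m (base-below Xv b)

      branching? : ∀ v → Dec (Branching v)
      branching? v = any? (below? v)

      Rival : Fin n → Fin n → Fin n → Set
      Rival v ℓ y = Side v ℓ y × Branching y × tag y ≡ tag v

      rival? : ∀ v ℓ y → Dec (Rival v ℓ y)
      rival? v ℓ y = side? v ℓ y ×-dec (branching? y ×-dec (tag y ≟ tag v))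

      -- Two nested rivals would have disjoint windows inside the window of v, each more than half as long.
      no-nested-rivals : ∀ {v ℓ y y′} → X v → Below v ℓ → Rival v ℓ y → Rival v ℓ y′ → C y y′ → y ≡ y′
      no-nested-rivals {v} {ℓ} {y} {y′} Xv b (s , (u , by) , t) (s′@(Xy′ , _) , (u′ , by′) , t′) c with y ≟ᶠ y′
      ... | yes eq = eq
      ... | no ne = contradiction (proj₂ (lg-spec (win v) (win-pos Xv b))) (≤⇒≯ (begin
          2 ^ suc (tag v) ≡⟨ cong (2 ^ tag v +_) (+-identityʳ _) ⟩
          2 ^ tag v + 2 ^ tag v ≡⟨ cong₂ (λ a b → 2 ^ a + 2 ^ b) (sym t) (sym t′) ⟩
          2 ^ tag y + 2 ^ tag y′ ≤⟨ +-mono-≤ (proj₁ (lg-spec (win y) (win-pos (proj₁ s) by))) (proj₁ (lg-spec (win y′) (win-pos Xy′ by′))) ⟩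
          win y + win y′ ≤⟨ m+n≤o⇒m≤o∸n (win y + win y′) (begin
            win y + win y′ + base v ≡⟨ +-comm (win y + win y′) (base v) ⟩
            base v + (win y + win y′) ≤⟨ +-monoˡ-≤ (win y + win y′) (base-side Xv b s) ⟩
            base y + (win y + win y′) ≡⟨ sym (+-assoc (base y) (win y) (win y′)) ⟩
            base y + win y + win y′ ≡⟨ cong (_+ win y′) (m+[n∸m]≡n (<⇒≤ (base-below (proj₁ s) by))) ⟩
            lev y + win y′ ≤⟨ +-monoˡ-≤ (win y′) (base-sup Xy′ (proj₁ s , c , ne)) ⟩
            base y′ + win y′ ≡⟨ m+[n∸m]≡n (<⇒≤ (base-below Xy′ by′)) ⟩
            lev y′ ≤⟨ <⇒≤ (lev-below Xv (side-below Xv b s′)) ⟩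
            lev v ∎) ⟩
          win v ∎))
        where open ≤-Reasoning

      rival-unique : ∀ {v ℓ y y′} → X v → Below v ℓ → Rival v ℓ y → Rival v ℓ y′ → y ≡ y′
      rival-unique Xv b r@((Xy , cy , _) , _) r′@((Xy′ , cy′ , _) , _) with comparable Xy Xy′ (proj₁ b) cy cy′
      ... | inj₁ c = no-nested-rivals Xv b r r′ c
      ... | inj₂ c = sym (no-nested-rivals Xv b r′ r c)

      rivalOf : ∀ {v ℓ} → Σ (Fin n) (Largest (Rival v ℓ) τ) ⊎ (∀ y → ¬ Rival v ℓ y) → List (Maybe (Fin n))
      rivalOf (inj₁ (y , _)) = just y ∷ []
      rivalOf (inj₂ _) = []

      -- Members of the branch may still carry the colour of the parent of `v`, or have one of their
      -- own. The first has to be avoided always, the second only for the unique rival; hence two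
      -- entries and three shades.
      avoidOf : ∀ v → Σ (Fin n) (Last v) ⊎ (∀ u → ¬ Below v u) → List (Maybe (Fin n))
      avoidOf v (inj₁ (ℓ , _)) = above v ∷ rivalOf (largest (rival? v ℓ) τ)
      avoidOf v (inj₂ _) = []

      avoid : Fin n → List (Maybe (Fin n))
      avoid v = avoidOf v (findLast v)

      avoid-earlier : ∀ v u → just u ∈ avoid v → τ u < τ v
      avoid-earlier v u m with findLast v
      ... | inj₁ (ℓ , b , _) with m
      ...   | here eq with above-C (sym eq)
      ...     | w , ((_ , c , ne) , _) , c′ , _ = ≤-<-trans (C-τ≤ c′) (C-τ c ne)
      avoid-earlier v u m | inj₁ (ℓ , b , _) | there m′ with largest (rival? v ℓ) τ
      avoid-earlier v u m | inj₁ (ℓ , b , _) | there (here refl) | inj₁ (y , ((_ , c , _) , _) , _) =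
        ≤-<-trans (C-τ≤ c) (proj₁ (proj₂ b))

      avoid-length : ∀ v → length (avoid v) ≤ 2
      avoid-length v with findLast v
      ... | inj₂ _ = z≤n
      ... | inj₁ (ℓ , _) with largest (rival? v ℓ) τ
      ...   | inj₁ _ = ≤-refl
      ...   | inj₂ _ = s≤s z≤n

      avoid-above : ∀ {v ℓ} → Last v ℓ → above v ∈ avoid v
      avoid-above {v} {ℓ} (b , _) with findLast v
      ... | inj₁ _ = here refl
      ... | inj₂ none = contradiction b (none ℓ)

      avoid-rival : ∀ {v ℓ y} → X v → Last v ℓ → Rival v ℓ y → just y ∈ avoid v
      avoid-rival {v} {ℓ} {y} Xv l r with findLast v
      ... | inj₂ none = contradiction (proj₁ l) (none ℓ)
      ... | inj₁ (ℓ′ , l′) with refl ← largest-unique l′ l with largest (rival? v ℓ) τ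
      ...   | inj₂ none = contradiction r (none y)
      ...   | inj₁ (y′ , r′ , _) = there (here (cong just (rival-unique Xv (proj₁ l) r r′)))

      module Bounded (T : ℕ) (small : ⌊log₂ suc Λ ⌋ < T) where

        tag-small : ∀ v → tag v < T
        tag-small v = ≤-<-trans (≤-trans (lg≤log₂ (win v)) (⌊log₂⌋-mono-≤ (≤-trans (m∸n≤m (lev v) (base v)) (lev-top v)))) small

        tagged : Maybe (Fin n) → Fin T
        -- A default tag: a colour coming from the parent is told apart by its shade alone.
        tagged nothing = fromℕ< (≤-trans (s≤s z≤n) small)
        tagged (just v) = fromℕ< (tag-small v)

        solution : Σ (Maybe (Fin n) → Fin 3) λ col → ∀ v x → x ∈ avoid v → col x ≢ col (just v)
        solution = greedy 2 τ avoid avoid-earlier avoid-length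

        shade : Maybe (Fin n) → Fin 3
        shade = proj₁ solution

        paint : Maybe (Fin n) → Fin (T * 3)
        paint x = combine (tagged x) (shade x)

        colour : Fin n → Fin (T * 3)
        colour v = paint (origin v)

        side-differs : ∀ {v ℓ q} → X v → Last v ℓ → Side v ℓ q → colour q ≢ colour v
        side-differs {v} {ℓ} {q} Xv l@(b , _) s eq
          with combine-injective (tagged (origin q)) (shade (origin q)) (tagged (just v)) (shade (just v))
                 (trans eq (cong paint (origin-self b)))
        ... | tag≡ , shade≡ with side-origin Xv b s
        ...   | inj₁ o≡ = proj₂ solution v (above v) (avoid-above l) (trans (cong shade (sym o≡)) shade≡)
        ...   | inj₂ (y , o≡ , br , sy) = proj₂ solution v (just y)
                  (avoid-rival Xv l (sy , br , fromℕ<-injective _ _ (tag-small y) (tag-small v) (trans (cong tagged (sym o≡)) tag≡)))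
                  (trans (cong shade (sym o≡)) shade≡)

        colour-reason : ∀ v → X v → Reason O X colour τ v
        colour-reason v Xv = reason (λ Xu → Xu) (λ _ Xq _ → Xq) Xv
          (λ none w p → cong paint (sym (trans (origin-above none) (above-parent p))))
          (λ ℓ l q s → side-differs Xv l s)

    abstract
      tree-colouring : ∀ T → ⌊log₂ suc Λ ⌋ < T → ∀ j X → (∀ v → Dec (X v)) → Clean X × Apart X → 1 ≤ j → CliqueBound O X (suc j) →
        Σ (Fin n → Fin (T * 3)) λ c → ∀ k → CliqueBound O (λ v → X v × c v ≡ k) j
      tree-colouring T small j X X? (clean , apart) 1≤j bound = colour ,
        mono-clique-bound O-sym O-irr τ-inj colour-reason j 1≤j bound
        where
        open Within X X? clean apart
        open Bounded T small

-- The path step: tops below a given top lie on one path.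

module Paths where

  open import Data.Maybe using (Maybe; just)
  open import Data.List using (List; []; _∷_; map; length; filter; allFin)
  open import Data.List.Properties using (length-map)
  open import Data.List.Membership.Propositional using (_∈_)
  open import Data.List.Membership.Propositional.Properties using (∈-map⁺; ∈-map⁻; ∈-filter⁺; ∈-filter⁻; ∈-allFin)
  open import Data.List.Relation.Unary.Any using (here; there)
  open import Data.List.Relation.Unary.All as All using (All; []; _∷_)
  open import Data.List.Relation.Unary.AllPairs using (AllPairs; []; _∷_)
  open import Data.List.Relation.Unary.Unique.Propositional.Properties using (allFin⁺; filter⁺)
  open Finite
  open Inheritance

  module Linear {n : ℕ} (M : Model n) where
    open Model M

    Chain : (Fin n → Set) → Set
    Chain X = ∀ {u v w} → X u → X v → X w → Anc u v → Anc u w → Anc v w ⊎ Anc w v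

    module Within (X : Fin n → Set) (X? : ∀ v → Dec (X v)) (clean : Clean X) (chain : Chain X) where

      module SX = Skeleton M X X? clean
      open SX using (comparable)

      farthest : ∀ u → Σ (Fin n) (Largest (λ z → X z × A u z) dep) ⊎ (∀ z → ¬ (X z × A u z))
      farthest u = largest (λ z → X? z ×-dec A? u z) dep

      depthOf : ∀ {u} → Σ (Fin n) (Largest (λ z → X z × A u z) dep) ⊎ (∀ z → ¬ (X z × A u z)) → ℕ
      depthOf (inj₁ (z , _)) = dep z
      depthOf (inj₂ _) = 0

      reach : Fin n → ℕ
      reach u = depthOf (farthest u)

      dep≤reach : ∀ {u z} → X z → A u z → dep z ≤ reach u
      dep≤reach {u} {z} Xz a with farthest u
      ... | inj₁ (_ , _ , top) = top z (Xz , a)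
      ... | inj₂ none = contradiction (Xz , a) (none z)

      reach-antitone : ∀ {u v} → C u v → reach v ≤ reach u
      reach-antitone {u} {v} c with farthest v
      ... | inj₁ (z , (Xz , a) , _) = dep≤reach Xz (C-A c a)
      ... | inj₂ _ = z≤n

      -- By `Chain` the tops of `X` below that of `u` are linearly ordered, and by convexity those
      -- in `u` form an initial segment, which `reach u` determines.
      within-reach : ∀ {u v} → X u → X v → Anc u v → dep v ≤ reach u → A u v
      within-reach {u} {v} Xu Xv anc le with farthest u
      ... | inj₂ none = contradiction (Xu , A-refl) (none u)
      ... | inj₁ (z , (Xz , a) , _) with chain Xu Xv Xz anc (A⇒Anc a)
      ...   | inj₁ h = A-mid a anc h
      ...   | inj₂ h = A-mid a anc (Anc-flip h le)

      -- The obstacle to ordering by right ends: `v` ends no later than a member next to it. Such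
      -- `v`, and everything inside them, become `Star` and share one colour.
      Coverer : Fin n → Fin n → Set
      Coverer v a = SX.Below v a × reach v ≤ reach a

      coverer? : ∀ v a → Dec (Coverer v a)
      coverer? v a = SX.below? v a ×-dec (reach v ≤? reach a)

      CoveredSup : Fin n → Fin n → Set
      CoveredSup v z = X z × C z v × ∃ (Coverer z)

      coveredSup? : ∀ v z → Dec (CoveredSup v z)
      coveredSup? v z = X? z ×-dec (C? z v ×-dec any? (coverer? z))

      Star : Fin n → Set
      Star v = ∃ (CoveredSup v)

      star? : ∀ v → Dec (Star v)
      star? v = any? (coveredSup? v)

      star-down : ∀ {u v} → C u v → Star u → Star v
      star-down c (z , Xz , c′ , cov) = z , Xz , C-trans c′ c , cov

      Plain : Fin n → Set
      Plain v = X v × ¬ Star v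

      plain? : ∀ v → Dec (Plain v)
      plain? v = X? v ×-dec ¬? (star? v)

      -- Earliest choices work. Let a covered `z′` contain `a`. If it contains `z`, it equals `z`,
      -- which cannot contain the earlier `a`. Otherwise `z′` covers `z` too, so it is `a` itself,
      -- and a coverer of `a` is a still earlier coverer of `z`.
      plain-coverer : ∀ {v} → Star v → Σ (Fin n) λ z → Σ (Fin n) λ a → X z × C z v × Coverer z a × Plain a
      plain-coverer {v} (z₀ , cs₀@(_ , _ , a₀ , cov₀)) with smallest (coveredSup? v) τ
      ... | inj₂ none = contradiction cs₀ (none z₀)
      ... | inj₁ (z , (Xz , cz , a₁ , cov₁) , first) with smallest (coverer? z) τ
      ...   | inj₂ none = contradiction cov₁ (none a₁)
      ...   | inj₁ (a , cov@((Xa , lt , az , ¬caz , ins) , le) , firstA) = z , a , Xz , cz , cov , Xa , λ { (z′ , Xz′ , c′ , b , cov′) → absurd z′ Xz′ c′ b cov′ }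
        where
        Anc-az : Anc a z
        Anc-az = A⇒Anc az
        absurd-a : ∀ b → Coverer a b → ⊥
        absurd-a b ((Xb , ltb , ab , ¬cba , insb) , leb) = <⇒≱ ltb (firstA b
          ((Xb , <-trans ltb lt ,
            within-reach Xb Xz (Anc-trans (A⇒Anc ab) Anc-az) (≤-trans (dep≤reach Xz A-refl) (≤-trans le leb)) ,
            (λ c → ¬cba (ins b (Xb , c , earlier-≢ (<-trans ltb lt)))) ,
            λ y s@(Xy , cy , ne) → insb y (Xy , ins y s , λ { refl → ¬caz cy })) ,
           ≤-trans le leb))
        absurd : ∀ z′ → X z′ → C z′ a → ∀ b → Coverer z′ b → ⊥
        absurd z′ Xz′ c′ b cov′ with C? z′ z
        ... | yes c = later-¬C lt (subst (λ y → C y a) (τ-inj (≤-antisym (C-τ≤ c) (first z′ (Xz′ , C-trans c cz , b , cov′)))) c′)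
        ... | no ¬c with τ-inj (≤-antisym (C-τ≤ c′) (firstA z′
                ((Xz′ , ≤-<-trans (C-τ≤ c′) lt , C-A c′ az , ¬c , inside) , ≤-trans le (reach-antitone c′))))
          where
          inside : ∀ y → SX.Sup z y → C y z′
          inside y s@(Xy , cy , _) with comparable Xy Xz′ Xa (ins y s) c′
          ... | inj₁ h = h
          ... | inj₂ h = contradiction (C-trans h cy) ¬c
        ...   | refl = absurd-a b cov′

      coverer-alive : ∀ {z a q v} → X z → C z q → Coverer z a → X v → A q v → A a v
      coverer-alive Xz c ((Xa , _ , az , _) , le) Xv qv =
        within-reach Xa Xv (Anc-trans (A⇒Anc az) (A⇒Anc (C-A c qv))) (≤-trans (dep≤reach Xv (C-A c qv)) le)

      -- The blocker is the latest plain member inside `a` alive at `v`. Being plain, it is inside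
      -- no star. It does not contain `v`, as `a` and `z` overlap and the class is clean. If it
      -- contained a star `q`, it would contain a plain coverer coming with `q`, which is alive at
      -- `v` and later.
      star-block : ∀ {v} → X v → Star v → Σ (Fin n) λ ℓ → X ℓ × O ℓ v × (∀ q → X q → τ q < τ v → O q v → Star q → O ℓ q)
      star-block {v} Xv star with plain-coverer star
      ... | z , a , Xz , cz , cov@(ba@(_ , ltz , az , ¬caz , _) , _) , (Xa , ¬sa)
        with largest (λ u → plain? u ×-dec (A? u v ×-dec C? a u)) τ
      ...   | inj₂ none = contradiction ((Xa , ¬sa) , coverer-alive Xz cz cov Xv A-refl , C-refl) (none a)
      ...   | inj₁ (ℓ , ((Xℓ , ¬sℓ) , aℓ , caℓ) , top) = ℓ , Xℓ , Oℓv , against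
        where
        Oℓv : O ℓ v
        Oℓv with meet aℓ A-refl
        ... | inj₂ (inj₂ o) = o
        ... | inj₂ (inj₁ c) = contradiction (star-down c star) ¬sℓ
        ... | inj₁ c = ⊥-elim (clean Xa Xz Xv (SX.below-O ba) (C-trans caℓ c) cz)
        against : ∀ q → X q → τ q < τ v → O q v → Star q → O ℓ q
        against q Xq lt o sq with meet aℓ (O-A o lt)
        ... | inj₂ (inj₂ h) = h
        ... | inj₂ (inj₁ c) = contradiction (star-down c sq) ¬sℓ
        ... | inj₁ c with plain-coverer sq
        ...   | z′ , a′ , Xz′ , cz′ , cov′@((_ , ltz′ , _ , ¬c′ , ins′) , _) , (Xa′ , ¬sa′) with comparable Xℓ Xz′ Xq c cz′
        ...     | inj₂ h = contradiction (star-down h (z′ , Xz′ , C-refl , a′ , cov′)) ¬sℓ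
        ...     | inj₁ h = ⊥-elim (<⇒≱ (C-τ cℓa′ (λ { refl → ¬c′ h }))
                    (top a′ ((Xa′ , ¬sa′) , coverer-alive Xz′ cz′ cov′ Xv (O-A o lt) , C-trans caℓ cℓa′)))
          where
          cℓa′ : C ℓ a′
          cℓa′ = ins′ ℓ (Xℓ , h , λ { refl → ¬sℓ (ℓ , Xℓ , C-refl , a′ , cov′) })

      module S = Skeleton M Plain plain? (λ pu pv pw → clean (proj₁ pu) (proj₁ pv) (proj₁ pw))
      open S using (Last; findLast; Side; side?; side-below; above; above-C; origin; side-origin; below-O)

      -- The branch relation read from `y`. The duty to differ is laid on `y` rather than on `v`,
      -- because few `v` can be over one `y`.
      Over : Fin n → Fin n → Set
      Over y v = Plain v × Σ (Fin n) λ ℓ → Last v ℓ × Side v ℓ y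

      over? : ∀ y v → Dec (Over y v)
      over? y v with plain? v | findLast v
      ... | no ¬p | _ = no λ o → ¬p (proj₁ o)
      ... | yes p | inj₂ none = no λ { (_ , ℓ , l , _) → none ℓ (proj₁ l) }
      ... | yes p | inj₁ (ℓ , l) with side? v ℓ y
      ...   | yes s = yes (p , ℓ , l , s)
      ...   | no ¬s = no λ { (_ , ℓ′ , l′ , s) → ¬s (subst (λ m → Side v m y) (S.largest-unique l′ l) s) }

      over-below : ∀ {y v} → Over y v → S.Below v y
      over-below (p , ℓ , (b , _) , s) = side-below p b s

      -- Otherwise `y` would cover `v`. Changing from the skeleton of `Plain` to that of `X` is
      -- harmless, since a member of `X` containing the plain `v` is plain.
      over-reach : ∀ {y v} → Over y v → reach y < reach v
      over-reach {y} {v} o@((Xv , ¬sv) , _) with over-below o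
      ... | (Xy , _) , lt , a , ¬c , ins = ≰⇒> λ le → ¬sv (v , Xv , C-refl , y , (Xy , lt , a , ¬c ,
            λ { z (Xz , c , ne) → ins z ((Xz , λ sz → ¬sv (star-down c sz)) , c , ne) }) , le)

      -- Any two members over y contain the last point reached by y.
      over-pair : ∀ {y v v′} → Over y v → Over y v′ → v ≢ v′ → O v v′
      over-pair {y} {v} {v′} o o′ ne = both (chain (proj₁ (proj₁ (over-below o))) (proj₁ (proj₁ o)) (proj₁ (proj₁ o′))
          (A⇒Anc (alive o)) (A⇒Anc (alive o′)))
        where
        alive : ∀ {v} → Over y v → A y v
        alive o = proj₁ (proj₂ (proj₂ (over-below o)))
        separate : ∀ {v v′} → Over y v → Over y v′ → v ≢ v′ → ¬ C v v′
        separate o o′ ne c = O-¬C′ (below-O (over-below o)) (proj₂ (proj₂ (proj₂ (proj₂ (over-below o′)))) _ (proj₁ o , c , ne))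
        hit : ∀ {v v′} → Over y v → Over y v′ → v ≢ v′ → Anc v v′ → O v v′
        hit {v} {v′} o o′ ne anc with meet (within-reach (proj₁ (proj₁ o)) (proj₁ (proj₁ o′)) anc
              (≤-trans (dep≤reach (proj₁ (proj₁ o′)) (alive o′)) (<⇒≤ (over-reach o)))) (A-refl {v′})
        ... | inj₁ c = contradiction c (separate o o′ ne)
        ... | inj₂ (inj₁ c) = contradiction c (separate o′ o λ eq → ne (sym eq))
        ... | inj₂ (inj₂ h) = h
        both : Anc v v′ ⊎ Anc v′ v → O v v′
        both (inj₁ h) = hit o o′ ne h
        both (inj₂ h) = O-sym (hit o′ o (λ eq → ne (sym eq)) h)

      overs : Fin n → List (Fin n)
      overs y = filter (over? y) (allFin n)

      over-∈ : ∀ {y v} → v ∈ overs y → Over y v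
      over-∈ {y} m = proj₂ (∈-filter⁻ (over? y) {xs = allFin n} m)

      -- Together with `y` they form a clique.
      overs-short : ∀ j → CliqueBound O X (suc j) → ∀ y → length (overs y) ≤ j
      overs-short j bound y = go (overs y) refl
        where
        all : All (Over y) (overs y)
        all = All.tabulate over-∈
        go : ∀ xs → xs ≡ overs y → length xs ≤ j
        go [] _ = z≤n
        go (x ∷ xs) eq = s≤s⁻¹ (bound (y ∷ x ∷ xs)
          ( proj₁ (proj₁ (over-below (All.lookup all′ (here refl)))) ∷ All.map (λ o → proj₁ (proj₁ o)) all′
          , All.map (λ o → below-O (over-below o)) all′ ∷ allPairs-unique over-pair all′
              (subst (AllPairs _≢_) (sym eq) (filter⁺ (over? y) (allFin⁺ n)))))
          where
          all′ : All (Over y) (x ∷ xs)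
          all′ = subst (All (Over y)) (sym eq) all

      B R : ℕ
      B = proj₁ (bounded τ)
      R = proj₁ (bounded reach)

      -- Lexicographic: farther reach first, then `τ`. Both the members over `y` and those properly
      -- containing `y` precede it.
      key : Fin n → ℕ
      key v = (R ∸ reach v) * B + τ v

      key-reach : ∀ {y v} → reach y < reach v → key v < key y
      key-reach {y} {v} lt = begin-strict
        (R ∸ reach v) * B + τ v <⟨ +-monoʳ-< ((R ∸ reach v) * B) (proj₂ (bounded τ) v) ⟩
        (R ∸ reach v) * B + B ≡⟨ +-comm ((R ∸ reach v) * B) B ⟩
        suc (R ∸ reach v) * B ≤⟨ *-monoˡ-≤ B (∸-monoʳ-< lt (<⇒≤ (proj₂ (bounded reach) v))) ⟩
        (R ∸ reach y) * B ≤⟨ m≤m+n _ (τ y) ⟩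
        (R ∸ reach y) * B + τ y ∎
        where open ≤-Reasoning

      key-earlier : ∀ {u v} → C u v → u ≢ v → key u < key v
      key-earlier c ne = +-mono-≤-< (*-monoˡ-≤ B (∸-monoʳ-≤ R (reach-antitone c))) (C-τ c ne)

      avoid : Fin n → List (Maybe (Fin n))
      avoid y = above y ∷ map just (overs y)

      avoid-key : ∀ y u → just u ∈ avoid y → key u < key y
      avoid-key y u (here eq) with above-C (sym eq)
      ... | w , ((_ , c , ne) , _) , c′ , _ = key-earlier (C-trans c′ c) λ { refl → ne (C-antisym c c′) }
      avoid-key y u (there m) with ∈-map⁻ just m
      ... | v , v∈ , refl = key-reach (over-reach (over-∈ v∈))

      module Bounded (j J : ℕ) (j<J : j < J) (bound : CliqueBound O X (suc j)) where

        solution : Σ (Maybe (Fin n) → Fin (suc J)) λ col → ∀ y x → x ∈ avoid y → col x ≢ col (just y)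
        -- At most `j` members over `y` and one inherited colour make `suc j ≤ J` entries.
        solution = greedy J key avoid avoid-key λ y →
          ≤-trans (s≤s (subst (_≤ j) (sym (length-map just (overs y))) (overs-short j bound y))) j<J

        shade : Maybe (Fin n) → Fin (suc J)
        shade = proj₁ solution

        paint : ∀ v → Dec (Star v) → Fin (suc (suc J))
        paint v (yes _) = zero
        paint v (no _) = suc (shade (origin v))

        colour : Fin n → Fin (suc (suc J))
        colour v = paint v (star? v)

        colour-plain : ∀ {v} → ¬ Star v → colour v ≡ suc (shade (origin v))
        colour-plain {v} ¬s = by (star? v)
          where
          by : ∀ d → paint v d ≡ suc (shade (origin v))
          by (yes s) = contradiction s ¬s
          by (no _) = refl

        colour-star : ∀ {v} → Star v → colour v ≡ zero
        colour-star {v} s = by (star? v)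
          where
          by : ∀ d → paint v d ≡ zero
          by (yes _) = refl
          by (no ¬s) = contradiction s ¬s

        suc-inj : ∀ {m} {a b : Fin m} → Fin.suc a ≡ suc b → a ≡ b
        suc-inj refl = refl

        plain-back : ∀ {q v} → ¬ Star v → X q → colour q ≡ colour v → Plain q
        plain-back {q} ¬sv Xq eq = Xq , λ sq → contradiction (trans (sym (colour-star sq)) (trans eq (colour-plain ¬sv))) λ ()

        star-back : ∀ {q v} → Star v → colour q ≡ colour v → Star q
        star-back {q} sv eq = by (star? q)
          where
          by : Dec (Star q) → Star q
          by (yes s) = s
          by (no ¬s) = contradiction (trans (sym (colour-plain ¬s)) (trans eq (colour-star sv))) λ ()

        side-differs : ∀ {v ℓ q} → Plain v → Last v ℓ → Side v ℓ q → colour q ≢ colour v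
        side-differs {v} {ℓ} {q} pv@(Xv , ¬sv) l@(b , _) s@((_ , ¬sq) , _) eq = shades (side-origin pv b s)
          where
          shade≡ : shade (origin q) ≡ shade (just v)
          shade≡ = trans (suc-inj (trans (sym (colour-plain ¬sq)) (trans eq (colour-plain ¬sv)))) (cong shade (S.origin-self b))
          shades : origin q ≡ above v ⊎ (Σ (Fin n) λ y → origin q ≡ just y × S.Branching y × Side v ℓ y) → ⊥
          shades (inj₁ o≡) = proj₂ solution v (above v) (here refl) (trans (cong shade (sym o≡)) shade≡)
          shades (inj₂ (y , o≡ , _ , sy)) = proj₂ solution y (just v)
            (there (∈-map⁺ just (∈-filter⁺ (over? y) (∈-allFin v) (pv , ℓ , l , sy))))
            (trans (sym shade≡) (cong shade o≡))

        colour-reason : ∀ v → X v → Reason O X colour τ v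
        colour-reason v Xv = by (star? v)
          where
          by : Dec (Star v) → Reason O X colour τ v
          by (no ¬s) = S.reason proj₁ (λ q Xq eq → plain-back ¬s Xq eq) (Xv , ¬s)
            (λ { none w p@((( _ , ¬sw) , _) , _) → trans (colour-plain ¬sw)
              (trans (cong (λ x → suc (shade x)) (sym (trans (S.origin-above none) (S.above-parent p)))) (sym (colour-plain ¬s))) })
            (λ ℓ l q sd → side-differs (Xv , ¬s) l sd)
          by (yes s) with star-block Xv s
          ... | ℓ , Xℓ , o , h = block ℓ Xℓ o λ q Xq lt oq eq → h q Xq lt oq (star-back s eq)

    abstract
      path-colouring : ∀ J j X → (∀ v → Dec (X v)) → Clean X × Chain X → 1 ≤ j → j < J → CliqueBound O X (suc j) →
        Σ (Fin n → Fin (suc (suc J))) λ c → ∀ k → CliqueBound O (λ v → X v × c v ≡ k) j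
      path-colouring J j X X? (clean , chain) 1≤j j<J bound = colour ,
        mono-clique-bound O-sym O-irr τ-inj colour-reason j 1≤j bound
        where
        open Within X X? clean chain
        open Bounded j J j<J bound

-- From single rounds to clean and then to general families.

module UpperBounds where

  open import Data.List.Relation.Binary.Permutation.Propositional.Properties using (↭-length)
  open import Data.Nat.Logarithm using (⌊log₂_⌋)
  open import Data.Fin using (combine)
  open import Data.Fin.Properties using (combine-injective)
  open import Data.List using ([]; _∷_; map; length)
  open import Data.List.Membership.Propositional using (_∈_)
  open import Data.List.Relation.Unary.Any using (here)
  open import Data.List.Relation.Unary.All as All using (All; []; _∷_)
  open import Data.List.Relation.Unary.AllPairs using ([]; _∷_)
  open Finite
  open Inheritance
  open Levels
  open Paths

  parity : ℕ → Fin 2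
  parity zero = zero
  parity (suc zero) = suc zero
  parity (suc (suc n)) = parity n

  parity-suc : ∀ n → parity n ≢ parity (suc n)
  parity-suc zero ()
  parity-suc (suc zero) ()
  parity-suc (suc (suc n)) = parity-suc n

  parity-gap : ∀ {a b} → a < b → parity a ≡ parity b → suc (suc a) ≤ b
  parity-gap {a} {b} lt eq with m≤n⇒m<n∨m≡n lt
  ... | inj₁ h = h
  ... | inj₂ refl = contradiction eq (parity-suc a)

  cliqueBound-sub : ∀ {n j} {E : Fin n → Fin n → Set} {X Y : Fin n → Set} → (∀ v → Y v → X v) → CliqueBound E X j → CliqueBound E Y j
  cliqueBound-sub sub bound xs (a , ps) = bound xs (All.map (λ {v} → sub v) a , ps)

  -- `w` rounds of the path step with `J = suc w`, hence `3 + w` colours each, and `w` rounds of the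
  -- tree step.
  cleanColours : ℕ → ℕ → ℕ
  cleanColours T w = (3 + w) ^ w * (T * 3) ^ w

  colours : ℕ → ℕ → ℕ
  colours T zero = 1
  colours T (suc w) = 2 * cleanColours T (suc w) * colours T w

  module Bounds {n : ℕ} (M : Model n) (lev : Fin n → ℕ) (Λ : ℕ) (lev-pos : ∀ v → 1 ≤ lev v) (lev-top : ∀ v → lev v ≤ suc Λ)
    (lev-mono : ∀ {u v} → Model.A M u v → lev u ≤ lev v)
    (lev-chain : ∀ {u v w} → Model.Anc M u v → Model.Anc M u w → lev u ≡ lev v → lev u ≡ lev w → Model.Anc M v w ⊎ Model.Anc M w v)
    (T : ℕ) (small : ⌊log₂ suc Λ ⌋ < T) where
    open Model M
    open Levelled M lev Λ lev-pos lev-top lev-mono using (Apart; tree-colouring)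
    open Linear M using (Chain; path-colouring)

    abstract
      -- Colouring every level properly comes first: it leaves classes in which overlapping members
      -- differ in level, as the tree step requires.
      clean-colouring : ∀ w X → (∀ v → Dec (X v)) → Clean X → CliqueBound O X (suc w) →
        Σ (Fin n → Fin (cleanColours T w)) (Proper O X)
      clean-colouring w X X? clean bound = refine c₁ class
        where
        sub-clean : ∀ {X Y : Fin n → Set} → (∀ v → Y v → X v) → Clean X → Clean Y
        sub-clean sub cl Xu Xv Xw = cl (sub _ Xu) (sub _ Xv) (sub _ Xw)
        level : ∀ k → Σ (Fin n → Fin ((3 + w) ^ w)) (Proper O (λ v → X v × lev v ≡ k))
        level k = iterate (λ Y → Clean Y × Chain Y)
          (λ sub → λ { (cl , ch) → sub-clean sub cl , λ Xu Xv Xw → ch (sub _ Xu) (sub _ Xv) (sub _ Xw) })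
          (3 + w) (suc w) (λ j Y Y? H 1≤j j<J → path-colouring (suc w) j Y Y? H 1≤j j<J) w
          (λ v → X v × lev v ≡ k) (λ v → X? v ×-dec (lev v ≟ k))
          (sub-clean (λ _ → proj₁) clean , λ { (_ , refl) (_ , ev) (_ , ew) au av → lev-chain au av (sym ev) (sym ew) })
          ≤-refl (cliqueBound-sub (λ _ → proj₁) bound)
        c₁ : Fin n → Fin ((3 + w) ^ w)
        c₁ v = proj₁ (level (lev v)) v
        c₁-apart : ∀ {u v} → X u → X v → O u v → c₁ u ≡ c₁ v → lev u ≢ lev v
        c₁-apart {u} {v} Xu Xv o eq l = proj₂ (level (lev u)) u v (Xu , refl) (Xv , sym l) o (trans eq (cong (λ k → proj₁ (level k) v) (sym l)))
        class : ∀ i → Σ (Fin n → Fin ((T * 3) ^ w)) (Proper O (λ v → X v × c₁ v ≡ i))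
        class i = iterate (λ Y → Clean Y × Apart Y)
          (λ sub → λ { (cl , ap) → sub-clean sub cl , λ Xu Xv → ap (sub _ Xu) (sub _ Xv) })
          (T * 3) (suc w) (λ j Y Y? H 1≤j _ → tree-colouring T small j Y Y? H 1≤j) w
          (λ v → X v × c₁ v ≡ i) (λ v → X? v ×-dec (c₁ v ≟ᶠ i))
          (sub-clean (λ _ → proj₁) clean , λ { (Xu , refl) (Xv , ev) o → c₁-apart Xu Xv o (sym ev) })
          ≤-refl (cliqueBound-sub (λ _ → proj₁) bound)

    module Depths (X : Fin n → Set) (X? : ∀ v → Dec (X v)) where

      Deep : ℕ → Fin n → Set
      Deep zero z = X z
      Deep (suc i) z = X z × ∃ λ u₁ → ∃ λ u₂ → Deep i u₁ × Deep i u₂ × O u₁ u₂ × C u₁ z × C u₂ z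

      deep? : ∀ i z → Dec (Deep i z)
      deep? zero z = X? z
      deep? (suc i) z = X? z ×-dec any? λ u₁ → any? λ u₂ → deep? i u₁ ×-dec (deep? i u₂ ×-dec (O? u₁ u₂ ×-dec (C? u₁ z ×-dec C? u₂ z)))

      deep-X : ∀ i {z} → Deep i z → X z
      deep-X zero d = d
      deep-X (suc i) d = proj₁ d

      deep-C : ∀ i {u w} → Deep i u → C u w → X w → Deep i w
      deep-C zero _ _ Xw = Xw
      deep-C (suc i) (_ , u₁ , u₂ , d₁ , d₂ , o , c₁ , c₂) c Xw = Xw , u₁ , u₂ , d₁ , d₂ , o , C-trans c₁ c , C-trans c₂ c

      deep-pred : ∀ i {z} → Deep (suc i) z → Deep i z
      deep-pred zero d = proj₁ d
      deep-pred (suc i) (Xz , u₁ , u₂ , d₁ , d₂ , r) = Xz , u₁ , u₂ , deep-pred i d₁ , deep-pred i d₂ , r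

      deep-≤ : ∀ {i j z} → i ≤ j → Deep j z → Deep i z
      deep-≤ {i} {j} le d with m≤n⇒m<n∨m≡n le
      ... | inj₂ refl = d
      deep-≤ {i} {suc j} le d | inj₁ (s≤s lt) = deep-≤ lt (deep-pred j d)

      -- A member of an overlapping pair properly contains what lies in both, so `τ` rises at every
      -- nesting. This makes the search for the rank finite.
      deep-τ : ∀ i {z} → Deep i z → i ≤ τ z
      deep-τ zero _ = z≤n
      deep-τ (suc i) (_ , u₁ , u₂ , d₁ , _ , o , c₁ , c₂) = ≤-trans (s≤s (deep-τ i d₁)) (C-τ c₁ λ { refl → O-¬C′ o c₂ })

      search : ℕ → Fin n → ℕ
      search-step : ∀ k z → Dec (Deep k z) → ℕ
      search zero z = 0
      search (suc k) z = search-step k z (deep? k z)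
      search-step k z (yes _) = k
      search-step k z (no _) = search k z

      search-spec : ∀ k z → X z → ¬ Deep k z → Deep (search k z) z × ¬ Deep (suc (search k z)) z
      search-spec zero z Xz h = contradiction Xz h
      search-spec (suc k) z Xz h = by (deep? k z)
        where
        by : ∀ d → Deep (search-step k z d) z × ¬ Deep (suc (search-step k z d)) z
        by (yes d) = d , h
        by (no ¬d) = search-spec k z Xz ¬d

      rank : Fin n → ℕ
      rank z = search (suc (τ z)) z

      rank-spec : ∀ {z} → X z → Deep (rank z) z × ¬ Deep (suc (rank z)) z
      rank-spec {z} Xz = search-spec (suc (τ z)) z Xz λ d → <-irrefl refl (deep-τ _ d)

      deep⇒≤rank : ∀ {i z} → X z → Deep i z → i ≤ rank z
      deep⇒≤rank Xz d = ≮⇒≥ λ lt → proj₂ (rank-spec Xz) (deep-≤ lt d)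

      Layer : ℕ → Fin n → Set
      Layer i z = Deep i z × ¬ Deep (suc i) z

      layer? : ∀ i z → Dec (Layer i z)
      layer? i z = deep? i z ×-dec ¬? (deep? (suc i) z)

      -- An overlapping pair of depth `i` gives depth `suc i` to whatever both contain.
      layer-clean : ∀ i → Clean (Layer i)
      layer-clean i (du , _) (dv , _) (dw , ¬dw) o c c′ = ¬dw (deep-X i dw , _ , _ , du , dv , o , c , c′)

    -- A common point of `q` and `y` also lies in `u`. In the model the top of the later of `q` and
    -- `y` serves as this point.
    touch : ∀ {q y u} → O q y → C u y → C q u ⊎ C u q ⊎ O q u
    touch {q} {y} {u} o c with <-cmp (τ q) (τ y)
    ... | tri< lt _ _ = meet (O-A o lt) (C⇒A c)
    ... | tri≈ _ eq _ = contradiction (subst (O q) (sym (τ-inj eq)) o) O-irr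
    ... | tri> _ _ gt with meet (C-A c (O-A (O-sym o) gt)) (A-refl {q})
    ...   | inj₁ h = inj₂ (inj₁ h)
    ...   | inj₂ (inj₁ h) = inj₁ h
    ...   | inj₂ (inj₂ h) = inj₂ (inj₂ (O-sym h))

    general-colouring : ∀ w X → (∀ v → Dec (X v)) → CliqueBound O X (suc w) → Σ (Fin n → Fin (colours T w)) (Proper O X)
    general-colouring zero X X? bound = (λ _ → zero) , λ u v Xu Xv o _ →
      contradiction (bound (u ∷ v ∷ []) (Xu ∷ Xv ∷ [] , (o ∷ []) ∷ [] ∷ [])) λ { (s≤s ()) }
    general-colouring (suc w) X X? bound = refine c₀ rest
      where
      open Depths X X?
      layer : ∀ i → Σ (Fin n → Fin (cleanColours T (suc w))) (Proper O (Layer i))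
      layer i = clean-colouring (suc w) (Layer i) (layer? i) (layer-clean i) (cliqueBound-sub (λ v d → deep-X i (proj₁ d)) bound)
      c₀ : Fin n → Fin (2 * cleanColours T (suc w))
      c₀ v = combine (parity (rank v)) (proj₁ (layer (rank v)) v)
      -- The pair above the deepest member of a monochromatic clique overlaps all the others.
      class-bound : ∀ k → CliqueBound O (λ v → X v × c₀ v ≡ k) (suc w)
      class-bound k [] _ = z≤n
      class-bound k (x ∷ xs) cl with pull-max rank x xs
      ... | y , ys , p , top with clique-resp-↭ O-sym p cl
      ...   | (Xy , cy) ∷ Xys , Ey ∷ Eys = subst (_≤ suc w) (sym (↭-length p)) (extend (rank y) refl)
        where
        gap : ∀ {q} → q ∈ ys → suc (suc (rank q)) ≤ rank y
        -- Equal ranks are excluded by the colouring of the layer, consecutive ones by parity.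
        gap {q} q∈ = parity-gap (≤∧≢⇒< (All.lookup top q∈) λ eq →
            proj₂ (layer (rank y)) q y (subst (λ i → Layer i q) eq (rank-spec Xq)) (rank-spec Xy) (O-sym (All.lookup Ey q∈))
              (trans (cong (λ i → proj₁ (layer i) q) (sym eq)) (proj₂ same))) (proj₁ same)
          where
          Xq : X q
          Xq = proj₁ (All.lookup Xys q∈)
          same : parity (rank q) ≡ parity (rank y) × proj₁ (layer (rank q)) q ≡ proj₁ (layer (rank y)) y
          same = combine-injective (parity (rank q)) (proj₁ (layer (rank q)) q) (parity (rank y)) (proj₁ (layer (rank y)) y)
            (trans (proj₂ (All.lookup Xys q∈)) (sym cy))
        tiny : ∀ zs → (∀ {q} → q ∈ zs → suc (suc (rank q)) ≤ 0) → suc (length zs) ≤ suc w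
        tiny [] _ = s≤s z≤n
        tiny (q ∷ zs) h = contradiction (h (here refl)) λ ()
        extend : ∀ r → r ≡ rank y → suc (length ys) ≤ suc w
        extend zero eq = tiny ys (λ q∈ → subst (_ ≤_) (sym eq) (gap q∈))
        extend (suc i) eq with subst (λ r → Deep r y) (sym eq) (proj₁ (rank-spec Xy))
        ... | _ , u₁ , u₂ , d₁ , d₂ , o , k₁ , k₂ = s≤s⁻¹ (bound (u₁ ∷ u₂ ∷ ys)
          ( deep-X i d₁ ∷ deep-X i d₂ ∷ All.map proj₁ Xys
          , (o ∷ All.tabulate (hits d₁ k₁)) ∷ All.tabulate (hits d₂ k₂) ∷ Eys))
          where
          hits : ∀ {u} → Deep i u → C u y → ∀ {q} → q ∈ ys → O u q
          hits d c {q} q∈ with touch (O-sym (All.lookup Ey q∈)) c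
          ... | inj₁ h = contradiction (C-trans h c) (O-¬C′ (All.lookup Ey q∈))
          ... | inj₂ (inj₂ h) = O-sym h
          -- If `u` contained `q`, then `q` would have rank at least `i`, only one less than `y`.
          ... | inj₂ (inj₁ h) = contradiction (s≤s⁻¹ (subst (suc (suc (rank q)) ≤_) (sym eq) (gap q∈)))
                  (≤⇒≯ (deep⇒≤rank (proj₁ (All.lookup Xys q∈)) (deep-C i d h (proj₁ (All.lookup Xys q∈)))))
      rest : ∀ k → Σ (Fin n → Fin (colours T w)) (Proper O (λ v → X v × c₀ v ≡ k))
      rest k = general-colouring w (λ v → X v × c₀ v ≡ k) (λ v → X? v ×-dec (c₀ v ≟ᶠ k)) (class-bound k)

-- Rooting a tree, ancestors, and the tops of subtrees.

module RootedTrees where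

  open import Defs renaming (sym to Adj-sym; irrefl to Adj-irrefl)
  open import Data.Bool using (Bool; true)
  open import Data.Fin using (fromℕ)
  open import Data.Fin.Subset using (Subset; _∈_; _∉_)
  open import Data.Fin.Subset.Properties using (_∈?_; ∈⊤)
  open import Data.List using (List; []; _∷_; map; length; lookup; allFin)
  import Data.List.Membership.Propositional as L
  import Data.List.Membership.DecPropositional as LD
  open import Data.List.Membership.Propositional.Properties using (∈-allFin; ∈-lookup)
  open import Data.List.Relation.Unary.Any using (here; there)
  open import Data.List.Relation.Unary.All as All using (All; []; _∷_)
  open import Data.List.Relation.Unary.AllPairs using (AllPairs; []; _∷_)
  open import Data.List.Relation.Unary.Unique.Propositional using (Unique)
  open import Relation.Binary.Construct.Closure.ReflexiveTransitive using (Star; ε; _◅_; _◅◅_; reverse)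
  open import Relation.Nullary.Decidable using (_⊎-dec_)
  open Finite
  open Inheritance

  allPairs-lookup : ∀ {A : Set} {R : A → A → Set} → (∀ {x y} → R x y → R y x) → ∀ {xs} → AllPairs R xs →
    ∀ i j → i ≢ j → R (lookup xs i) (lookup xs j)
  allPairs-lookup R-sym (r ∷ rs) zero zero ne = contradiction refl ne
  allPairs-lookup R-sym (r ∷ rs) zero (suc j) ne = All.lookup r (∈-lookup j)
  allPairs-lookup R-sym {x ∷ xs} (r ∷ rs) (suc i) zero ne = R-sym (allPairs-lookup R-sym (r ∷ rs) zero (suc i) λ ())
  allPairs-lookup R-sym (r ∷ rs) (suc i) (suc j) ne = allPairs-lookup R-sym rs i j λ eq → ne (cong suc eq)

  module _ {V : Set} (_≟_ : (x y : V) → Dec (x ≡ y)) (R : V → V → Set) where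

    data Route : V → V → List V → Set where
      end : ∀ {x} → Route x x (x ∷ [])
      _then_ : ∀ {x y z zs} → R x z → Route z y zs → Route x y (x ∷ zs)

    suffix : ∀ {x y z zs} → x L.∈ zs → Route z y zs → Unique zs → Σ (List V) λ ws → Route x y ws × Unique ws
    suffix (here refl) end u = _ , end , u
    suffix (here refl) (r then p) u = _ , r then p , u
    suffix (there m) (r then p) (_ ∷ u) = suffix m p u

    simpleRoute : ∀ {x y} → Star R x y → Σ (List V) λ zs → Route x y zs × Unique zs
    simpleRoute {x} ε = x ∷ [] , end , [] ∷ []
    simpleRoute {x} (r ◅ w) with simpleRoute w
    ... | zs , p , u with LD._∈?_ _≟_ x zs
    ...   | yes m = suffix m p u
    ...   | no x∉ = x ∷ zs , r then p , All.tabulate (λ { m refl → x∉ m }) ∷ u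

    route-step : ∀ {x y zs} → Route x y zs → ∀ i j → suc (toℕ i) ≡ toℕ j → R (lookup zs i) (lookup zs j)
    route-step (r then end) zero (suc zero) _ = r
    route-step (r then (_ then _)) zero (suc zero) _ = r
    route-step (r then p) (suc i) (suc j) eq = route-step p i j (suc-injective eq)
    route-step end zero zero ()

    route-last : ∀ {x y z zs} → Route x y (z ∷ zs) → lookup (z ∷ zs) (fromℕ (length zs)) ≡ y
    route-last end = refl
    route-last (r then end) = refl
    route-last (r then p@(_ then _)) = route-last p

  update : ∀ {m} {A : Set} → (Fin m → A) → Fin m → A → Fin m → A
  update f b a x with x ≟ᶠ b
  ... | yes _ = a
  ... | no _ = f x

  update-same : ∀ {m} {A : Set} (f : Fin m → A) b a → update f b a b ≡ a
  update-same f b a with b ≟ᶠ b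
  ... | yes _ = refl
  ... | no ne = contradiction refl ne

  update-other : ∀ {m} {A : Set} (f : Fin m → A) b a {x} → x ≢ b → update f b a x ≡ f x
  update-other f b a {x} ne with x ≟ᶠ b
  ... | yes eq = contradiction eq ne
  ... | no _ = refl

  module Rooted (T : Graph) (tree : IsTree T) where

    private
      V : Set
      V = Fin (n T)

    root : V
    root = proj₁ (proj₁ tree)

    record Grown : Set where
      field
        vis : V → Bool
        par : V → V
        dep : V → ℕ
        ok : ∀ x → vis x ≡ true → x ≢ root → vis (par x) ≡ true × Adj T x (par x) × dep x ≡ suc (dep (par x))
        start : vis root ≡ true

    open Grown

    infix 4 _⊑_
    _⊑_ : Grown → Grown → Set
    g ⊑ g′ = ∀ x → vis g x ≡ true → vis g′ x ≡ true

    attach : ∀ g a b → vis g a ≡ true → vis g b ≢ true → Adj T a b → Σ Grown λ g′ → g ⊑ g′ × vis g′ b ≡ true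
    attach g a b va ¬vb e = record
      { vis = update (vis g) b true
      ; par = update (par g) b a
      ; dep = update (dep g) b (suc (dep g a))
      ; ok = ok′
      ; start = keep root (start g)
      } , keep , update-same (vis g) b true
      where
      old : ∀ {x} → vis g x ≡ true → x ≢ b
      old v refl = ¬vb v
      keep : ∀ x → vis g x ≡ true → update (vis g) b true x ≡ true
      keep x v = trans (update-other (vis g) b true (old v)) v
      ok′ : ∀ x → update (vis g) b true x ≡ true → x ≢ root →
        update (vis g) b true (update (par g) b a x) ≡ true × Adj T x (update (par g) b a x) ×
        update (dep g) b (suc (dep g a)) x ≡ suc (update (dep g) b (suc (dep g a)) (update (par g) b a x))
      ok′ x v ne = by (x ≟ᶠ b)
        where
        by : Dec (x ≡ b) → update (vis g) b true (update (par g) b a x) ≡ true × Adj T x (update (par g) b a x) ×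
          update (dep g) b (suc (dep g a)) x ≡ suc (update (dep g) b (suc (dep g a)) (update (par g) b a x))
        by (yes refl) rewrite update-same (par g) x a | update-same (dep g) x (suc (dep g a))
          | update-other (dep g) x (suc (dep g a)) (old va) = keep a va , Adj-sym T e , refl
        by (no x≢b) rewrite update-other (par g) b a x≢b | update-other (dep g) b (suc (dep g a)) x≢b
          with ok g x (trans (sym (update-other (vis g) b true x≢b)) v) ne
        ... | vp , ad , de = keep (par g x) vp , ad , trans de (cong suc (sym (update-other (dep g) b (suc (dep g a)) (old vp))))

    grow : ∀ {S a x} g → WalkIn T S a x → vis g a ≡ true → Σ Grown λ g′ → g ⊑ g′ × vis g′ x ≡ true
    grow g (here _) va = g , (λ _ v → v) , va
    grow g (step {y = b} _ e w) va with vis g b Data.Bool.≟ true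
    ... | yes vb = grow g w vb
    ... | no ¬vb with attach g _ b va ¬vb e
    ...   | g₁ , le₁ , vb with grow g₁ w vb
    ...     | g₂ , le₂ , vx = g₂ , (λ x v → le₂ x (le₁ x v)) , vx

    growAll : ∀ xs → Σ Grown λ g → All (λ x → vis g x ≡ true) xs
    growAll [] = record
      { vis = λ x → Dec.does (x ≟ᶠ root)
      ; par = λ x → x
      ; dep = λ _ → 0
      ; ok = λ x v ne → contradiction (true⇒ v) ne
      ; start = does-refl
      } , []
      where
      true⇒ : ∀ {x} → Dec.does (x ≟ᶠ root) ≡ true → x ≡ root
      true⇒ {x} eq with x ≟ᶠ root
      ... | yes p = p
      true⇒ {x} () | no _
      does-refl : Dec.does (root ≟ᶠ root) ≡ true
      does-refl with root ≟ᶠ root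
      ... | yes _ = refl
      ... | no ne = contradiction refl ne
    growAll (x ∷ xs) with growAll xs
    ... | g , vs with grow g (proj₁ (proj₂ tree) root x ∈⊤ ∈⊤) (start g)
    ...   | g′ , le , vx = g′ , vx ∷ All.map (λ {y} v → le y v) vs

    abstract
      grown : Grown
      grown = proj₁ (growAll (allFin (n T)))

      visited : ∀ x → vis grown x ≡ true
      visited x = All.lookup (proj₂ (growAll (allFin (n T)))) (∈-allFin x)

    parent : V → V
    parent = par grown

    depth : V → ℕ
    depth = dep grown

    parent-edge : ∀ {x} → x ≢ root → Adj T x (parent x)
    parent-edge ne = proj₁ (proj₂ (ok grown _ (visited _) ne))

    depth-suc : ∀ {x} → x ≢ root → depth x ≡ suc (depth (parent x))
    depth-suc ne = proj₂ (proj₂ (ok grown _ (visited _) ne))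

    TreeEdge : V → V → Set
    TreeEdge x y = (x ≢ root × parent x ≡ y) ⊎ (y ≢ root × parent y ≡ x)

    treeEdge? : ∀ x y → Dec (TreeEdge x y)
    treeEdge? x y = (¬? (x ≟ᶠ root) ×-dec (parent x ≟ᶠ y)) ⊎-dec (¬? (y ≟ᶠ root) ×-dec (parent y ≟ᶠ x))

    treeEdge-sym : ∀ {x y} → TreeEdge x y → TreeEdge y x
    treeEdge-sym (inj₁ h) = inj₂ h
    treeEdge-sym (inj₂ h) = inj₁ h

    treeEdge-adj : ∀ {x y} → TreeEdge x y → Adj T x y
    treeEdge-adj (inj₁ (ne , refl)) = parent-edge ne
    treeEdge-adj (inj₂ (ne , refl)) = Adj-sym T (parent-edge ne)

    climb : ∀ x → Star TreeEdge x root
    climb x = go x (<-wellFounded (depth x))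
      where
      go : ∀ x → Acc _<_ (depth x) → Star TreeEdge x root
      go x (acc rec) with x ≟ᶠ root
      ... | yes refl = ε
      ... | no ne = inj₁ (ne , refl) ◅ go (parent x) (rec (≤-reflexive (sym (depth-suc ne))))

    -- An edge outside the spanning tree would close a simple route of tree edges to a cycle. A
    -- route with one node makes the edge a loop, one with two nodes is a tree edge already.
    adj-treeEdge : ∀ {x y} → Adj T x y → TreeEdge x y
    adj-treeEdge {x} {y} e = decidable-stable (treeEdge? x y) λ ¬te →
      cycle ¬te (simpleRoute _≟ᶠ_ TreeEdge (climb x ◅◅ reverse treeEdge-sym (climb y)))
      where
      closed : ∀ {a b c ws} → Route _≟ᶠ_ TreeEdge x y (a ∷ b ∷ c ∷ ws) → Unique (a ∷ b ∷ c ∷ ws) → a ≡ x → ⊥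
      closed {a} {b} {c} {ws} p u refl = proj₂ (proj₂ tree) (length ws , lookup (a ∷ b ∷ c ∷ ws) , inj ,
        (λ i j eq → treeEdge-adj (route-step _≟ᶠ_ TreeEdge p i j eq)) ,
        subst (λ z → Adj T z x) (sym (route-last _≟ᶠ_ TreeEdge p)) (Adj-sym T e))
        where
        inj : ∀ i j → lookup (a ∷ b ∷ c ∷ ws) i ≡ lookup (a ∷ b ∷ c ∷ ws) j → i ≡ j
        inj i j eq = decidable-stable (i ≟ᶠ j) λ ne → allPairs-lookup (λ h eq → h (sym eq)) u i j ne eq
      cycle : ¬ TreeEdge x y → (Σ (List V) λ zs → Route _≟ᶠ_ TreeEdge x y zs × Unique zs) → ⊥
      cycle ¬te (_ , end , _) = Adj-irrefl T e
      cycle ¬te (_ , (r then end) , _) = ¬te r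
      cycle ¬te (_ , p@(_ then (_ then end)) , u) = closed p u refl
      cycle ¬te (_ , p@(_ then (_ then (_ then _))) , u) = closed p u refl

    data Anc (x : V) : V → Set where
      self : Anc x x
      up : ∀ {y} → y ≢ root → Anc x (parent y) → Anc x y

    anc-depth : ∀ {x y} → Anc x y → depth x ≤ depth y
    anc-depth self = ≤-refl
    anc-depth (up ne a) = ≤-trans (anc-depth a) (≤-trans (n≤1+n _) (≤-reflexive (sym (depth-suc ne))))

    anc-eq : ∀ {x y} → Anc x y → depth y ≤ depth x → x ≡ y
    anc-eq self _ = refl
    anc-eq (up ne a) le = contradiction (≤-trans (≤-reflexive (sym (depth-suc ne))) (≤-trans le (anc-depth a))) (<-irrefl refl)

    anc-trans : ∀ {x y z} → Anc x y → Anc y z → Anc x z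
    anc-trans a self = a
    anc-trans a (up ne b) = up ne (anc-trans a b)

    anc-linear : ∀ {x y z} → Anc x z → Anc y z → Anc x y ⊎ Anc y x
    anc-linear a self = inj₁ a
    anc-linear self b = inj₂ b
    anc-linear (up _ a) (up _ b) = anc-linear a b

    anc? : ∀ x y → Dec (Anc x y)
    anc? x y = go y (<-wellFounded (depth y))
      where
      go : ∀ y → Acc _<_ (depth y) → Dec (Anc x y)
      go y (acc rec) with x ≟ᶠ y | y ≟ᶠ root
      ... | yes refl | _ = yes self
      ... | no x≢y | yes r = no λ { self → x≢y refl ; (up ne _) → ne r }
      ... | no x≢y | no ne with go (parent y) (rec (≤-reflexive (sym (depth-suc ne))))
      ...   | yes a = yes (up ne a)
      ...   | no ¬a = no λ { self → x≢y refl ; (up _ a) → ¬a a }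

    anc-root : ∀ y → Anc root y
    anc-root y = go y (<-wellFounded (depth y))
      where
      go : ∀ y → Acc _<_ (depth y) → Anc root y
      go y (acc rec) with y ≟ᶠ root
      ... | yes refl = self
      ... | no ne = up ne (go (parent y) (rec (≤-reflexive (sym (depth-suc ne)))))

    Closed : Subset (n T) → V → Set
    Closed S ρ = ρ ∈ S × (∀ {x} → x ∈ S → x ≢ ρ → x ≢ root × parent x ∈ S)

    walk-start : ∀ {S a b} → WalkIn T S a b → a ∈ S
    walk-start (here a∈) = a∈
    walk-start (step a∈ _ _) = a∈

    -- The part of the tree below `x` can be left only through `parent x`.
    walk-stays : ∀ {S x a b} → parent x ∉ S → WalkIn T S a b → Anc x a → Anc x b
    walk-stays p∉ (here _) a = a
    walk-stays p∉ (step a∈ e w) a with adj-treeEdge e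
    ... | inj₂ (ne , refl) = walk-stays p∉ w (up ne a)
    ... | inj₁ (ne , refl) with a
    ...   | self = contradiction (walk-start w) p∉
    ...   | up _ a′ = walk-stays p∉ w a′

    abstract
      -- The shallowest node serves: if another node `x` of `S` had its parent outside, the walk in
      -- `S` from `x` to the shallowest node would stay below `x`.
      top : ∀ S → IsSubtree T S → Σ V (Closed S)
      top S ((x₀ , x₀∈) , conn) with smallest (_∈? S) depth
      ... | inj₂ none = contradiction x₀∈ (none x₀)
      ... | inj₁ (ρ , ρ∈ , least) = ρ , ρ∈ , λ x∈ ne → (λ { refl → ne (anc-eq (anc-root ρ) (least _ x∈)) }) ,
          decidable-stable (_ ∈? S) λ p∉ → ne (anc-eq (walk-stays p∉ (conn _ ρ x∈ ρ∈) self) (least _ x∈))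

    closed-anc : ∀ {S ρ} → Closed S ρ → ∀ {x} → x ∈ S → Anc ρ x
    closed-anc {S} {ρ} (_ , cl) {x} = go x (<-wellFounded (depth x))
      where
      go : ∀ x → Acc _<_ (depth x) → x ∈ S → Anc ρ x
      go x (acc rec) x∈ with x ≟ᶠ ρ
      ... | yes refl = self
      ... | no ne with cl x∈ ne
      ...   | nr , p∈ = up nr (go (parent x) (rec (≤-reflexive (sym (depth-suc nr)))) p∈)

    closed-mid : ∀ {S ρ} → Closed S ρ → ∀ {x y} → x ∈ S → Anc ρ y → Anc y x → y ∈ S
    closed-mid C x∈ ρy self = x∈
    closed-mid {S} {ρ} C@(ρ∈ , cl) {x} x∈ ρy yx@(up ne a) with x ≟ᶠ ρ
    ... | yes refl = subst (_∈ S) (anc-eq ρy (anc-depth yx)) x∈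
    ... | no x≢ρ = closed-mid C (proj₂ (cl x∈ x≢ρ)) ρy a

    closed-meet : ∀ {S R ρ σ} → Closed S ρ → Closed R σ → ∀ {x} → x ∈ S → x ∈ R → depth ρ ≤ depth σ → σ ∈ S
    closed-meet CS CR x∈S x∈R le with anc-linear (closed-anc CS x∈S) (closed-anc CR x∈R)
    ... | inj₁ a = closed-mid CS x∈S a (closed-anc CR x∈R)
    ... | inj₂ a with anc-eq a le
    ...   | refl = proj₁ CS

-- Subtree families as models, their levels, and the bounds (a) and (b).

module SubtreeFamilies where

  open import Defs renaming (sym to Adj-sym; irrefl to Adj-irrefl)
  open import Data.Nat.Logarithm using (⌊log₂_⌋; ⌊log₂⌋-mono-≤; ⌊log₂[2*b]⌋≡1+⌊log₂b⌋)
  open import Data.Fin.Subset using (Subset; _∈_; _⊆_; ∣_∣)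
  open import Data.Fin.Subset.Properties using (_∈?_; _⊆?_; ⊆-antisym; p⊂q⇒∣p∣<∣q∣; ∣p∣≤n)
  open import Data.List using ([]; _∷_; length; lookup; filter; allFin)
  open import Data.List.Properties using (length-filter; length-tabulate)
  import Data.List.Membership.Propositional as L
  import Data.List.Membership.DecPropositional as LD
  open import Data.List.Membership.Propositional.Properties using (∈-filter⁺; ∈-allFin)
  open import Data.List.Relation.Unary.Any using (here; there)
  open Finite
  open Inheritance
  open UpperBounds
  open RootedTrees
  open import Data.Fin.Subset using (_⊂_)
  open import Data.Nat.Combinatorics using (_C_; nC1≡n; nCk+nC[k+1]≡[n+1]C[k+1])
  open import Data.Nat.Solver using (module +-*-Solver)
  open +-*-Solver using (solve; _:+_; _:*_; _:=_; con)

  lg-mono : ∀ {a b} → 1 ≤ a → a ≤ b → lg a ≤ lg b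
  lg-mono {a} {b} pos le = ≮⇒≥ λ lt → <⇒≱ (proj₂ (lg-spec b (≤-trans pos le)))
    (≤-trans (^-monoʳ-≤ 2 lt) (≤-trans (proj₁ (lg-spec a pos)) le))

  lex : ∀ {N a b i j} → a < b → i < N → a * N + i < b * N + j
  lex {N} {a} {b} {i} {j} lt i<N = begin-strict
    a * N + i <⟨ +-monoʳ-< (a * N) i<N ⟩
    a * N + N ≡⟨ +-comm (a * N) N ⟩
    suc a * N ≤⟨ *-monoˡ-≤ N lt ⟩
    b * N ≤⟨ m≤m+n (b * N) j ⟩
    b * N + j ∎
    where open ≤-Reasoning

  lex-injective : ∀ {N a b i j} → i < N → j < N → a * N + i ≡ b * N + j → i ≡ j
  lex-injective {N} {a} {b} i<N j<N eq with <-cmp a b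
  ... | tri< lt _ _ = contradiction eq (<⇒≢ (lex lt i<N))
  ... | tri≈ _ refl _ = +-cancelˡ-≡ (a * N) _ _ eq
  ... | tri> _ _ gt = contradiction (sym eq) (<⇒≢ (lex gt j<N))

  module Counting {A : Set} {P Q R : A → Set} (P? : ∀ x → Dec (P x)) (Q? : ∀ x → Dec (Q x)) (R? : ∀ x → Dec (R x)) where

    count-disjoint : (∀ {x} → P x → R x) → (∀ {x} → Q x → R x) → (∀ {x} → P x → ¬ Q x) → ∀ xs →
      length (filter P? xs) + length (filter Q? xs) ≤ length (filter R? xs)
    count-disjoint pr qr pq [] = z≤n
    count-disjoint pr qr pq (x ∷ xs) with P? x | Q? x | R? x | count-disjoint pr qr pq xs
    ... | yes p | yes q | _ | _ = contradiction q (pq p)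
    ... | yes p | no _ | no ¬r | _ = contradiction (pr p) ¬r
    ... | no _ | yes q | no ¬r | _ = contradiction (qr q) ¬r
    ... | yes _ | no _ | yes _ | h = s≤s h
    ... | no _ | yes _ | yes _ | h = ≤-trans (≤-reflexive (+-suc _ _)) (s≤s h)
    ... | no _ | no _ | yes _ | h = m≤n⇒m≤1+n h
    ... | no _ | no _ | no _ | h = h

  overlap? : ∀ {m} (S R : Subset m) → Dec (Overlap S R)
  overlap? S R = any? (λ x → (x ∈? S) ×-dec (x ∈? R)) ×-dec (¬? (S ⊆? R) ×-dec ¬? (R ⊆? S))

  overlap-sym : ∀ {m} {S R : Subset m} → Overlap S R → Overlap R S
  overlap-sym ((x , xS , xR) , a , b) = (x , xR , xS) , b , a

  proper-subset : ∀ {m} {S R : Subset m} → S ⊆ R → ¬ (R ⊆ S) → S ⊂ R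
  proper-subset {m} {S} {R} le ¬ge with any? (λ x → (x ∈? R) ×-dec ¬? (x ∈? S))
  ... | yes h = le , h
  ... | no none = contradiction (λ {x} x∈ → decidable-stable (x ∈? S) λ x∉ → none (x , x∈ , x∉)) ¬ge

  module Members (T : Graph) (tree : IsTree T) {k : ℕ} (μ : Fin k → Subset (n T)) (sub : ∀ u → IsSubtree T (μ u))
    (inj : ∀ u v → μ u ≡ μ v → u ≡ v) where
    open Rooted T tree

    ρ : Fin k → Fin (n T)
    ρ u = proj₁ (top (μ u) (sub u))

    closed : ∀ u → Closed (μ u) (ρ u)
    closed u = proj₂ (top (μ u) (sub u))

    -- With `τ`, a lexicographic order packed into numbers: shallower top, larger set, smaller
    -- index. The second key puts containing members first even when tops coincide; the third makes
    -- `τ` injective.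
    size : Fin k → ℕ
    size u = depth (ρ u) * suc (n T) + (n T ∸ ∣ μ u ∣)

    τ : Fin k → ℕ
    τ u = size u * k + toℕ u

    τ-inj : ∀ {u v} → τ u ≡ τ v → u ≡ v
    τ-inj {u} {v} eq = toℕ-injective (lex-injective {a = size u} {b = size v} (toℕ<n u) (toℕ<n v) eq)

    depth-τ : ∀ {u v} → depth (ρ u) < depth (ρ v) → τ u < τ v
    depth-τ {u} {v} lt = lex (lex lt (s≤s (m∸n≤m (n T) ∣ μ u ∣))) (toℕ<n u)

    τ-depth : ∀ {u v} → τ u < τ v → depth (ρ u) ≤ depth (ρ v)
    τ-depth lt = ≮⇒≥ λ gt → <-asym lt (depth-τ gt)

    ⊆-τ : ∀ {u v} → μ v ⊆ μ u → u ≢ v → τ u < τ v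
    ⊆-τ {u} {v} le ne with m≤n⇒m<n∨m≡n (anc-depth (closed-anc (closed u) (le (proj₁ (closed v)))))
    ... | inj₁ lt = depth-τ lt
    ... | inj₂ eq = lex (subst (λ d → d * suc (n T) + (n T ∸ ∣ μ u ∣) < size v) (sym eq)
          (+-monoʳ-< (depth (ρ v) * suc (n T)) (∸-monoʳ-< (p⊂q⇒∣p∣<∣q∣ (proper-subset le λ ge → ne (inj u v (⊆-antisym ge le)))) (∣p∣≤n (μ u)))))
          (toℕ<n u)

    model : Model k
    model = record
      { Anc = λ u v → Anc (ρ u) (ρ v)
      ; A = λ u v → ρ v ∈ μ u
      ; C = λ u v → μ v ⊆ μ u
      ; O = λ u v → Overlap (μ u) (μ v)
      ; A? = λ u v → ρ v ∈? μ u
      ; C? = λ u v → μ v ⊆? μ u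
      ; O? = λ u v → overlap? (μ u) (μ v)
      ; τ = τ
      ; dep = λ u → depth (ρ u)
      ; τ-inj = τ-inj
      ; Anc-trans = anc-trans
      ; Anc-flip = λ {u} {v} a le → subst (λ x → Anc x (ρ u)) (anc-eq a le) self
      ; A-refl = λ {u} → proj₁ (closed u)
      ; A⇒Anc = λ {u} a → closed-anc (closed u) a
      ; A-mid = λ {u} a b c → closed-mid (closed u) a b c
      ; C-refl = λ x∈ → x∈
      ; C-trans = λ a b x∈ → a (b x∈)
      ; C-A = λ c a → c a
      ; C-τ = λ {u} {v} → ⊆-τ {u} {v}
      ; O-sym = overlap-sym
      ; O-¬C = λ o → proj₂ (proj₂ o)
      ; O-A = λ { {u} {v} ((x , xu , xv) , _) lt → closed-meet (closed u) (closed v) xu xv (τ-depth lt) }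
      ; meet = meet
      }
      where
      meet : ∀ {u v w} → ρ w ∈ μ u → ρ w ∈ μ v → μ v ⊆ μ u ⊎ μ u ⊆ μ v ⊎ Overlap (μ u) (μ v)
      meet {u} {v} {w} a b with μ v ⊆? μ u | μ u ⊆? μ v
      ... | yes c | _ = inj₁ c
      ... | no _ | yes c = inj₂ (inj₁ c)
      ... | no ¬c | no ¬c′ = inj₂ (inj₂ ((ρ w , a , b) , ¬c′ , ¬c))

    -- The level of a member is the logarithm of the number of members rooted below it, so that on every
    -- path there are few levels, and the members of one level below a given one form a chain.
    weight : Fin k → ℕ
    weight u = length (filter (λ v → anc? (ρ u) (ρ v)) (allFin k))

    Λ : ℕ
    Λ = ⌊log₂ k ⌋

    lev : Fin k → ℕ
    lev u = suc Λ ∸ lg (weight u)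

    weight-pos : ∀ u → 1 ≤ weight u
    weight-pos u = nonempty (∈-filter⁺ (λ v → anc? (ρ u) (ρ v)) (∈-allFin u) self)
      where
      nonempty : ∀ {x : Fin k} {xs} → x L.∈ xs → 1 ≤ length xs
      nonempty (here _) = s≤s z≤n
      nonempty (there _) = s≤s z≤n

    lg-weight : ∀ u → lg (weight u) ≤ Λ
    lg-weight u = ≤-trans (lg≤log₂ (weight u)) (⌊log₂⌋-mono-≤
      (≤-trans (length-filter (λ v → anc? (ρ u) (ρ v)) (allFin k)) (≤-reflexive (length-tabulate {n = k} (λ i → i)))))

    lev-pos : ∀ u → 1 ≤ lev u
    lev-pos u = m<n⇒0<n∸m (s≤s (lg-weight u))

    lev-top : ∀ u → lev u ≤ suc Λ
    lev-top u = m∸n≤m (suc Λ) (lg (weight u))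

    weight-anc : ∀ {u v} → Anc (ρ u) (ρ v) → weight v ≤ weight u
    weight-anc {u} {v} a = ≤-trans (m≤m+n (weight v) _)
      (count-disjoint (λ b → anc-trans a b) (λ ()) (λ _ ()) (allFin k))
      where open Counting (λ w → anc? (ρ v) (ρ w)) (λ _ → no (λ (x : ⊥) → x)) (λ w → anc? (ρ u) (ρ w))

    lev-mono : ∀ {u v} → ρ v ∈ μ u → lev u ≤ lev v
    lev-mono {u} {v} a = ∸-monoʳ-≤ (suc Λ) (lg-mono (weight-pos v) (weight-anc (closed-anc (closed u) a)))

    -- Incomparable tops have disjoint sets of tops below them. If both weights had the same rounded
    -- logarithm as the weight of `u`, their sum would exceed the latter.
    lev-chain : ∀ {u v w} → Anc (ρ u) (ρ v) → Anc (ρ u) (ρ w) → lev u ≡ lev v → lev u ≡ lev w → Anc (ρ v) (ρ w) ⊎ Anc (ρ w) (ρ v)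
    lev-chain {u} {v} {w} av aw ev ew with anc? (ρ v) (ρ w) | anc? (ρ w) (ρ v)
    ... | yes h | _ = inj₁ h
    ... | no _ | yes h = inj₂ h
    ... | no ¬h | no ¬h′ = contradiction (proj₂ (lg-spec (weight u) (weight-pos u))) (≤⇒≯ (begin
        2 ^ suc (lg (weight u)) ≡⟨ cong (2 ^ lg (weight u) +_) (+-identityʳ _) ⟩
        2 ^ lg (weight u) + 2 ^ lg (weight u) ≡⟨ cong₂ (λ a b → 2 ^ a + 2 ^ b) (same v ev) (same w ew) ⟩
        2 ^ lg (weight v) + 2 ^ lg (weight w) ≤⟨ +-mono-≤ (proj₁ (lg-spec (weight v) (weight-pos v))) (proj₁ (lg-spec (weight w) (weight-pos w))) ⟩
        weight v + weight w ≤⟨ count-disjoint (anc-trans av) (anc-trans aw) disjoint (allFin k) ⟩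
        weight u ∎))
      where
      open ≤-Reasoning
      open Counting (λ x → anc? (ρ v) (ρ x)) (λ x → anc? (ρ w) (ρ x)) (λ x → anc? (ρ u) (ρ x))
      same : ∀ v → lev u ≡ lev v → lg (weight u) ≡ lg (weight v)
      same v e = ∸-cancelˡ-≡ (m≤n⇒m≤1+n (lg-weight u)) (m≤n⇒m≤1+n (lg-weight v)) e
      disjoint : ∀ {x} → Anc (ρ v) (ρ x) → ¬ Anc (ρ w) (ρ x)
      disjoint a b with anc-linear a b
      ... | inj₁ h = ¬h h
      ... | inj₂ h = ¬h′ h

  log-log : ∀ k → 16 ≤ k → ⌊log₂ suc ⌊log₂ k ⌋ ⌋ < 2 + loglog k
  log-log k le = s≤s (≤-trans (⌊log₂⌋-mono-≤ (≤-trans (+-monoˡ-≤ ⌊log₂ k ⌋ big) (≤-reflexive (cong (⌊log₂ k ⌋ +_) (sym (+-identityʳ _))))))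
    (≤-reflexive (⌊log₂[2*b]⌋≡1+⌊log₂b⌋ ⌊log₂ k ⌋ ⦃ Data.Nat.>-nonZero big ⦄)))
    where
    big : 1 ≤ ⌊log₂ k ⌋
    big = ≤-trans (s≤s z≤n) (⌊log₂⌋-mono-≤ le)

  loglog-pos : ∀ k → 16 ≤ k → 2 ≤ loglog k
  loglog-pos k le = ⌊log₂⌋-mono-≤ (⌊log₂⌋-mono-≤ le)

  colourable-≤ : ∀ {G a b} → a ≤ b → Colourable G a → Colourable G b
  colourable-≤ le (c , h) = (λ v → Data.Fin.inject≤ (c v) le) , λ u v e eq → h u v e (Data.Fin.Properties.inject≤-injective le le (c u) (c v) eq)

  module Upper (G : Graph) (T : Graph) (tree : IsTree T) (μ : Fin (n G) → Subset (n T)) (sub : ∀ u → IsSubtree T (μ u))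
    (om : IsOverlapModel G μ) (w : ℕ) (cn : CliqueNumber≤ G (suc w)) (big : 16 ≤ n G) where
    open Members T tree μ sub (proj₁ om)
    open Bounds model lev Λ lev-pos lev-top (λ {u} {v} → lev-mono {u} {v}) (λ {u} {v} {w} → lev-chain {u} {v} {w})
      (2 + loglog (n G)) (log-log (n G) big)

    Everything : Fin (n G) → Set
    Everything v = v ≡ v

    everything? : ∀ v → Dec (Everything v)
    everything? v = yes refl

    bound : CliqueBound (λ u v → Overlap (μ u) (μ v)) Everything (suc w)
    bound xs (_ , ps) = cn (length xs) (lookup xs) (inj , adj)
      where
      adj : ∀ i j → i ≢ j → Adj G (lookup xs i) (lookup xs j)
      adj i j ne = proj₂ (proj₂ om _ _) (allPairs-lookup {R = λ u v → Overlap (μ u) (μ v)} overlap-sym ps i j ne)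
      inj : ∀ i j → lookup xs i ≡ lookup xs j → i ≡ j
      inj i j eq = decidable-stable (i ≟ᶠ j) λ ne → Adj-irrefl G (subst (Adj G (lookup xs i)) (sym eq) (adj i j ne))

    proper⇒colourable : ∀ {K} → Σ (Fin (n G) → Fin K) (Proper (λ u v → Overlap (μ u) (μ v)) Everything) → Colourable G K
    proper⇒colourable (c , h) = c , λ u v e → h u v refl refl (proj₁ (proj₂ om u v) e)

    general : Colourable G (colours (2 + loglog (n G)) w)
    general = proper⇒colourable (general-colouring w Everything everything? bound)

    clean : IsClean μ → Colourable G (cleanColours (2 + loglog (n G)) w)
    clean cl = proper⇒colourable (clean-colouring w Everything everything? (λ {u} {v} {x} _ _ _ o → cl u v x o) bound)

  ^-distrib-* : ∀ m n k → (m * n) ^ k ≡ m ^ k * n ^ k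
  ^-distrib-* m n zero = refl
  ^-distrib-* m n (suc k) = trans (cong (m * n *_) (^-distrib-* m n k))
    (solve 4 (λ a b c d → a :* b :* (c :* d) := a :* c :* (b :* d)) refl m n (m ^ k) (n ^ k))

  cleanFactor : ℕ → ℕ
  cleanFactor w = (3 + w) ^ w * 6 ^ w

  clean-count : ∀ L w → 2 ≤ L → cleanColours (2 + L) w ≤ cleanFactor w * L ^ w
  clean-count L w le = begin
    (3 + w) ^ w * ((2 + L) * 3) ^ w ≤⟨ *-monoʳ-≤ ((3 + w) ^ w) (^-monoˡ-≤ w six) ⟩
    (3 + w) ^ w * (6 * L) ^ w ≡⟨ cong ((3 + w) ^ w *_) (^-distrib-* 6 L w) ⟩
    (3 + w) ^ w * (6 ^ w * L ^ w) ≡⟨ sym (*-assoc ((3 + w) ^ w) (6 ^ w) (L ^ w)) ⟩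
    (3 + w) ^ w * 6 ^ w * L ^ w ∎
    where
    open ≤-Reasoning
    -- `2 + L ≤ 2 * L` from `2 ≤ L` on, which 16 vertices guarantee.
    six : (2 + L) * 3 ≤ 6 * L
    six = begin
      (2 + L) * 3 ≤⟨ *-monoˡ-≤ 3 (+-monoˡ-≤ L le) ⟩
      (L + L) * 3 ≡⟨ solve 1 (λ x → (x :+ x) :* con 3 := con 6 :* x) refl L ⟩
      6 * L ∎

  triangle : ℕ → ℕ
  triangle zero = 0
  triangle (suc w) = suc w + triangle w

  triangle-C : ∀ w → triangle w ≡ suc w C 2
  triangle-C zero = refl
  triangle-C (suc w) = trans (cong₂ _+_ (sym (nC1≡n (suc w))) (triangle-C w)) (nCk+nC[k+1]≡[n+1]C[k+1] (suc w) 1)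

  factor : ℕ → ℕ
  factor zero = 1
  factor (suc w) = 2 * cleanFactor (suc w) * factor w

  general-count : ∀ L w → 2 ≤ L → colours (2 + L) w ≤ factor w * L ^ triangle w
  general-count L zero _ = ≤-refl
  general-count L (suc w) le = begin
    2 * cleanColours (2 + L) (suc w) * colours (2 + L) w
      ≤⟨ *-mono-≤ (*-monoʳ-≤ 2 (clean-count L (suc w) le)) (general-count L w le) ⟩
    2 * (cleanFactor (suc w) * L ^ suc w) * (factor w * L ^ triangle w)
      ≡⟨ solve 4 (λ a b c d → con 2 :* (a :* b) :* (c :* d) := con 2 :* a :* c :* (b :* d)) refl
           (cleanFactor (suc w)) (L ^ suc w) (factor w) (L ^ triangle w) ⟩
    2 * cleanFactor (suc w) * factor w * (L ^ suc w * L ^ triangle w)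
      ≡⟨ cong (2 * cleanFactor (suc w) * factor w *_) (sym (^-distribˡ-+-* L (suc w) (triangle w))) ⟩
    2 * cleanFactor (suc w) * factor w * L ^ (suc w + triangle w) ∎
    where open ≤-Reasoning

  part-a : ∀ ω → 1 ≤ ω → Σ ℕ λ K → ∀ G → IsSubtreeOverlapGraph G → CliqueNumber≤ G ω → 16 ≤ n G →
    Colourable G (K * loglog (n G) ^ (ω C 2))
  part-a (suc w) _ = factor w , λ { G (T , tree , μ , sub , om) cn big →
    colourable-≤ {G} (subst (λ e → colours (2 + loglog (n G)) w ≤ factor w * loglog (n G) ^ e) (triangle-C w)
        (general-count (loglog (n G)) w (loglog-pos (n G) big)))
      (Upper.general G T tree μ sub om w cn big) }

  part-b : ∀ ω → 1 ≤ ω → Σ ℕ λ K → ∀ G → IsCleanSubtreeOverlapGraph G → CliqueNumber≤ G ω → 16 ≤ n G →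
    Colourable G (K * loglog (n G) ^ (ω ∸ 1))
  part-b (suc w) _ = cleanFactor w , λ { G (T , tree , μ , sub , om , cl) cn big →
    colourable-≤ {G} (clean-count (loglog (n G)) w (loglog-pos (n G) big))
      (Upper.clean G T tree μ sub om w cn big cl) }

-- Drawing subtree overlap graphs with polygonal curves over integer columns.

module StringCurves where

  open import Defs renaming (sym to Adj-sym; irrefl to Adj-irrefl)
  open import Data.Fin.Subset using (Subset; _∈_; _∉_; _⊆_)
  open import Data.Fin.Subset.Properties using (_∈?_; _⊆?_)
  open import Data.List using (List; []; _∷_)
  open import Data.List.NonEmpty using (_∷_)
  open import Data.Rational as ℚ using (ℚ; 0ℚ; 1ℚ; 1/_; positive; nonNegative) renaming (_+_ to _+ᵠ_; _*_ to _*ᵠ_; _-_ to _-ᵠ_; _≤_ to _≤ᵠ_; _<_ to _<ᵠ_)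
  import Data.Rational.Properties as ℚₚ
  open import Data.Rational.Solver using (module +-*-Solver)
  open import Algebra.Properties.Group ℚₚ.+-0-group using (∙-cancelˡ)
  open +-*-Solver using (solve; _:+_; _:*_; _:-_; _:=_; con)
  open import Relation.Binary.PropositionalEquality using (subst₂)
  open Finite
  open RootedTrees
  open SubtreeFamilies

  ι : ℕ → ℚ
  ι zero = 0ℚ
  ι (suc n) = 1ℚ +ᵠ ι n

  0<1 : 0ℚ <ᵠ 1ℚ
  0<1 = ℚₚ.positive⁻¹ 1ℚ

  ι-suc : ∀ n → ι n <ᵠ ι (suc n)
  ι-suc n = subst (_<ᵠ ι (suc n)) (ℚₚ.+-identityˡ (ι n)) (ℚₚ.+-monoˡ-< (ι n) 0<1)

  ι-≤ : ∀ {m n} → m ≤ n → ι m ≤ᵠ ι n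
  ι-≤ {zero} {zero} _ = ℚₚ.≤-refl
  ι-≤ {zero} {suc n} _ = ℚₚ.≤-trans (ι-≤ {zero} {n} z≤n) (ℚₚ.<⇒≤ (ι-suc n))
  ι-≤ {suc m} {suc n} (s≤s le) = ℚₚ.+-monoʳ-≤ 1ℚ (ι-≤ le)

  ι-< : ∀ {m n} → m < n → ι m <ᵠ ι n
  ι-< {m} lt = ℚₚ.<-≤-trans (ι-suc m) (ι-≤ lt)

  point : (ℕ → ℕ) → ℕ → Point
  point f j = ι j , ι (f j)

  points : (ℕ → ℕ) → ℕ → ℕ → List Point
  points f j zero = []
  points f j (suc l) = point f j ∷ points f (suc j) l

  plot : (ℕ → ℕ) → ℕ → ℕ → Curve
  plot f s l = point f s ∷ points f (suc s) l

  height : (ℕ → ℕ) → ℕ → ℚ → ℚ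
  height f j t = ι (f j) +ᵠ t *ᵠ (ι (f (suc j)) -ᵠ ι (f j))

  -- The offset is kept below 1, so that a point determines its column and offset; `inner` says that
  -- nothing is drawn beyond the last column.
  record On (f : ℕ → ℕ) (s l : ℕ) (p : Point) : Set where
    constructor on
    field
      col : ℕ
      off : ℚ
      lower : s ≤ col
      upper : col ≤ s + l
      nonneg : 0ℚ ≤ᵠ off
      below : off <ᵠ 1ℚ
      inner : 0ℚ <ᵠ off → col < s + l
      x-eq : proj₁ p ≡ ι col +ᵠ off
      y-eq : proj₂ p ≡ height f col off

  point-on : ∀ f s l p → p ≡ point f s → On f s l p
  point-on f s l p refl = on s 0ℚ ≤-refl (m≤m+n s l) ℚₚ.≤-refl 0<1 (λ lt → contradiction lt (ℚₚ.<-irrefl refl))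
    (sym (ℚₚ.+-identityʳ (ι s))) (sym (trans (cong (ι (f s) +ᵠ_) (ℚₚ.*-zeroˡ (ι (f (suc s)) -ᵠ ι (f s)))) (ℚₚ.+-identityʳ (ι (f s)))))

  step-x : ∀ x t → x +ᵠ t *ᵠ ((1ℚ +ᵠ x) -ᵠ x) ≡ x +ᵠ t
  step-x x t = solve 2 (λ x t → x :+ t :* ((con 1ℚ :+ x) :- x) := x :+ t) refl x t

  end-x : ∀ x → x +ᵠ 1ℚ *ᵠ ((1ℚ +ᵠ x) -ᵠ x) ≡ 1ℚ +ᵠ x
  end-x x = trans (step-x x 1ℚ) (ℚₚ.+-comm x 1ℚ)

  end-y : ∀ y z → y +ᵠ 1ℚ *ᵠ (z -ᵠ y) ≡ z
  end-y y z = trans (cong (y +ᵠ_) (ℚₚ.*-identityˡ (z -ᵠ y))) (solve 2 (λ y z → y :+ (z :- y) := z) refl y z)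

  on-later : ∀ {f s l p} → On f (suc s) l p → On f s (suc l) p
  on-later {s = s} {l} (on c t lo hi t≥ t< inn xe ye) = on c t (<⇒≤ lo) (≤-trans hi (≤-reflexive (sym (+-suc s l)))) t≥ t<
    (λ pos → ≤-trans (inn pos) (≤-reflexive (sym (+-suc s l)))) xe ye

  segment-point : ∀ f s l p → OnSegment p (point f s) (point f (suc s)) → On f s (suc l) p
  segment-point f s l p (t , t≥ , t≤ , xe , ye) = by (t ℚ.<? 1ℚ)
    where
    by : Dec (t <ᵠ 1ℚ) → On f s (suc l) p
    by (yes t<) = on s t ≤-refl (m≤m+n s (suc l)) t≥ t< (λ _ → m<m+n s (s≤s z≤n)) (trans xe (step-x (ι s) t)) ye
    by (no t≮) = on-later (point-on f (suc s) l p (cong₂ _,_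
        (trans xe (trans (cong (λ t → ι s +ᵠ t *ᵠ (ι (suc s) -ᵠ ι s)) t≡1) (end-x (ι s))))
        (trans ye (trans (cong (λ t → ι (f s) +ᵠ t *ᵠ (ι (f (suc s)) -ᵠ ι (f s))) t≡1) (end-y (ι (f s)) (ι (f (suc s))))))))
      where
      t≡1 : t ≡ 1ℚ
      t≡1 = ℚₚ.≤-antisym t≤ (ℚₚ.≮⇒≥ t≮)

  plot-on : ∀ f s l p → OnCurve p (plot f s l) → On f s l p
  plot-on f s zero p eq = point-on f s zero p eq
  plot-on f s (suc l) p (inj₂ h) = on-later (plot-on f (suc s) l p h)
  plot-on f s (suc l) p (inj₁ seg) = segment-point f s l p seg

  segment-on : ∀ f s l j {p} → s ≤ j → j < s + l → OnSegment p (point f j) (point f (suc j)) → OnCurve p (plot f s l)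
  segment-on f s zero j le lt seg = contradiction (≤-trans lt (≤-reflexive (+-identityʳ s))) (≤⇒≯ le)
  segment-on f s (suc l) j le lt seg with m≤n⇒m<n∨m≡n le
  ... | inj₂ refl = inj₁ seg
  ... | inj₁ lt′ = inj₂ (segment-on f (suc s) l j lt′ (≤-trans lt (≤-reflexive (+-suc s l))) seg)

  integer-part : ∀ {i j t t′} → 0ℚ ≤ᵠ t → t′ <ᵠ 1ℚ → ι i +ᵠ t ≡ ι j +ᵠ t′ → i ≤ j
  integer-part {i} {j} {t} {t′} t≥ t′< eq = ≮⇒≥ λ lt → ℚₚ.<-irrefl (sym eq) (begin-strict
    ι j +ᵠ t′ <⟨ ℚₚ.+-monoʳ-< (ι j) t′< ⟩
    ι j +ᵠ 1ℚ ≡⟨ ℚₚ.+-comm (ι j) 1ℚ ⟩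
    ι (suc j) ≤⟨ ι-≤ lt ⟩
    ι i ≡⟨ sym (ℚₚ.+-identityʳ (ι i)) ⟩
    ι i +ᵠ 0ℚ ≤⟨ ℚₚ.+-monoʳ-≤ (ι i) t≥ ⟩
    ι i +ᵠ t ∎)
    where open ℚₚ.≤-Reasoning

  -- Heights are convex combinations of the values at two columns. At offset 0 the right one has no
  -- weight, so it is compared only for positive offsets; this matters at the end of a curve.
  height-< : ∀ f g j t → 0ℚ ≤ᵠ t → t <ᵠ 1ℚ → g j < f j → (0ℚ <ᵠ t → g (suc j) < f (suc j)) → height g j t <ᵠ height f j t
  height-< f g j t t≥ t< lt next = subst₂ _<ᵠ_ (split g) (split f)
      (ℚₚ.+-mono-<-≤ (ℚₚ.*-monoʳ-<-pos (1ℚ -ᵠ t) ⦃ positive gap ⦄ (ι-< lt)) (right (ℚₚ.<-cmp 0ℚ t)))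
    where
    split : ∀ f → (1ℚ -ᵠ t) *ᵠ ι (f j) +ᵠ t *ᵠ ι (f (suc j)) ≡ height f j t
    split f = solve 3 (λ y z t → (con 1ℚ :- t) :* y :+ t :* z := y :+ t :* (z :- y)) refl (ι (f j)) (ι (f (suc j))) t
    gap : 0ℚ <ᵠ 1ℚ -ᵠ t
    gap = subst (_<ᵠ 1ℚ -ᵠ t) (ℚₚ.+-inverseʳ t) (ℚₚ.+-monoˡ-< (ℚ.- t) t<)
    right : _ → t *ᵠ ι (g (suc j)) ≤ᵠ t *ᵠ ι (f (suc j))
    right (tri< pos _ _) = ℚₚ.*-monoˡ-≤-nonNeg t ⦃ nonNegative t≥ ⦄ (ℚₚ.<⇒≤ (ι-< (next pos)))
    right (tri≈ _ refl _) = ℚₚ.≤-reflexive (trans (ℚₚ.*-zeroˡ (ι (g (suc j)))) (sym (ℚₚ.*-zeroˡ (ι (f (suc j))))))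
    right (tri> _ _ neg) = contradiction (ℚₚ.<-≤-trans neg t≥) (ℚₚ.<-irrefl refl)

  plots-disjoint : ∀ f g {s l s′ l′} → (∀ j → s ≤ j → j ≤ s + l → s′ ≤ j → j ≤ s′ + l′ → g j < f j) →
    ¬ CurvesIntersect (plot f s l) (plot g s′ l′)
  plots-disjoint f g {s} {l} {s′} {l′} lt (p , a , b) with plot-on f s l p a | plot-on g s′ l′ p b
  ... | on i t lo hi t≥ t< inn xe ye | on j t′ lo′ hi′ t≥′ t<′ inn′ xe′ ye′
    with ≤-antisym (integer-part {i} {j} t≥ t<′ (trans (sym xe) xe′)) (integer-part {j} {i} t≥′ t< (trans (sym xe′) xe))
  ... | refl with ∙-cancelˡ (ι i) _ _ (trans (sym xe) xe′)
  ...   | refl = ℚₚ.<-irrefl (trans (sym ye′) ye) (height-< f g i t t≥ t< (lt i lo hi lo′ hi′) λ pos →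
          lt (suc i) (m≤n⇒m≤1+n lo) (inn pos) (m≤n⇒m≤1+n lo′) (inn′ pos))

  abstract
    cross : ∀ a b a′ b′ → b <ᵠ a → a′ <ᵠ b′ → Σ ℚ λ t → 0ℚ ≤ᵠ t × t ≤ᵠ 1ℚ × a +ᵠ t *ᵠ (a′ -ᵠ a) ≡ b +ᵠ t *ᵠ (b′ -ᵠ b)
    cross a b a′ b′ b<a a′<b′ = t , t≥ , t≤ , eq
      where
      A B : ℚ
      A = a -ᵠ b
      B = b′ -ᵠ a′
      diff : ∀ {x y} → x <ᵠ y → 0ℚ <ᵠ y -ᵠ x
      diff {x} {y} lt = subst (_<ᵠ y -ᵠ x) (ℚₚ.+-inverseʳ x) (ℚₚ.+-monoˡ-< (ℚ.- x) lt)
      A>0 : 0ℚ <ᵠ A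
      A>0 = diff b<a
      A+B>0 : 0ℚ <ᵠ A +ᵠ B
      A+B>0 = ℚₚ.+-mono-< A>0 (diff a′<b′)
      instance
        pos : ℚ.Positive (A +ᵠ B)
        pos = positive A+B>0
        nz : ℚ.NonZero (A +ᵠ B)
        nz = ℚₚ.pos⇒nonZero (A +ᵠ B)
        posr : ℚ.NonNegative (1/ (A +ᵠ B))
        posr = ℚₚ.pos⇒nonNeg (1/ (A +ᵠ B)) ⦃ ℚₚ.1/pos⇒pos (A +ᵠ B) ⦄
      -- The difference of the two heights runs linearly from `A` to the negative of `B`; `t` is its
      -- zero.
      t : ℚ
      t = A *ᵠ 1/ (A +ᵠ B)
      t≥ : 0ℚ ≤ᵠ t
      t≥ = subst (_≤ᵠ t) (ℚₚ.*-zeroˡ (1/ (A +ᵠ B))) (ℚₚ.*-monoʳ-≤-nonNeg (1/ (A +ᵠ B)) (ℚₚ.<⇒≤ A>0))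
      A≤A+B : A ≤ᵠ A +ᵠ B
      A≤A+B = subst (_≤ᵠ A +ᵠ B) (ℚₚ.+-identityʳ A) (ℚₚ.+-monoʳ-≤ A (ℚₚ.<⇒≤ (diff a′<b′)))
      t≤ : t ≤ᵠ 1ℚ
      t≤ = subst (t ≤ᵠ_) (ℚₚ.*-inverseʳ (A +ᵠ B)) (ℚₚ.*-monoʳ-≤-nonNeg (1/ (A +ᵠ B)) A≤A+B)
      tAB : t *ᵠ (A +ᵠ B) ≡ A
      tAB = trans (ℚₚ.*-assoc A (1/ (A +ᵠ B)) (A +ᵠ B)) (trans (cong (A *ᵠ_) (ℚₚ.*-inverseˡ (A +ᵠ B))) (ℚₚ.*-identityʳ A))
      eq : a +ᵠ t *ᵠ (a′ -ᵠ a) ≡ b +ᵠ t *ᵠ (b′ -ᵠ b)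
      eq = trans (solve 5 (λ a b a′ b′ t → a :+ t :* (a′ :- a) := b :+ t :* (b′ :- b) :+ ((a :- b) :- t :* ((a :- b) :+ (b′ :- a′)))) refl a b a′ b′ t)
        (trans (cong (λ z → b +ᵠ t *ᵠ (b′ -ᵠ b) +ᵠ (A -ᵠ z)) tAB)
          (trans (cong (b +ᵠ t *ᵠ (b′ -ᵠ b) +ᵠ_) (ℚₚ.+-inverseʳ A)) (ℚₚ.+-identityʳ _)))

  plots-cross : ∀ f g {s l s′ l′} j → s ≤ j → j < s + l → s′ ≤ j → j < s′ + l′ → g j < f j → f (suc j) < g (suc j) →
    CurvesIntersect (plot f s l) (plot g s′ l′)
  plots-cross f g {s} {l} {s′} {l′} j lo hi lo′ hi′ lt gt = at (cross (ι (f j)) (ι (g j)) (ι (f (suc j))) (ι (g (suc j))) (ι-< lt) (ι-< gt))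
    where
    at : (Σ ℚ λ t → 0ℚ ≤ᵠ t × t ≤ᵠ 1ℚ × height f j t ≡ height g j t) → CurvesIntersect (plot f s l) (plot g s′ l′)
    at (t , t≥ , t≤ , eq) = (ι j +ᵠ t *ᵠ (ι (suc j) -ᵠ ι j) , height f j t) ,
      segment-on f s l j lo hi (t , t≥ , t≤ , refl , refl) ,
      segment-on g s′ l′ j lo′ hi′ (t , t≥ , t≤ , refl , eq)

  sign-change : ∀ (f g : ℕ → ℕ) d j → (∀ i → f i ≢ g i) → g j < f j → f (j + d) < g (j + d) →
    Σ ℕ λ i → j ≤ i × i < j + d × g i < f i × f (suc i) < g (suc i)
  sign-change f g zero j ne lt gt = contradiction (subst (λ i → f i < g i) (+-identityʳ j) gt) (<-asym lt)
  sign-change f g (suc d) j ne lt gt with <-cmp (f (suc j)) (g (suc j))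
  ... | tri< h _ _ = j , ≤-refl , m<m+n j (s≤s z≤n) , lt , h
  ... | tri≈ _ eq _ = contradiction eq (ne (suc j))
  ... | tri> _ _ h with sign-change f g d (suc j) ne h (subst (λ i → f i < g i) (+-suc j d) gt)
  ...   | i , lo , hi , a , b = i , <⇒≤ lo , ≤-trans hi (≤-reflexive (sym (+-suc j d))) , a , b

  module Layout (T : Graph) (tree : IsTree T) where
    open Rooted T tree

    private
      m : ℕ
      m = n T

    D : ℕ
    D = proj₁ (bounded depth)

    depth<D : ∀ x → depth x < D
    depth<D = proj₂ (bounded depth)

    -- With base `suc m` the columns of a node split into one block for each of `m` possible
    -- children and a block 0 free of children, in which the node can be seen alone.
    width : ℕ → ℕ
    width d = suc m ^ (D ∸ d)

    width-pos : ∀ d → 1 ≤ width d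
    width-pos d = m^n>0 (suc m) (D ∸ d)

    startStep : (Fin m → ℕ) → ∀ x → Dec (x ≡ root) → ℕ
    startStep a x (yes _) = 0
    startStep a x (no _) = a (parent x) + suc (toℕ x) * width (depth x)

    abstract
      startFix : Σ (Fin m → ℕ) λ a → ∀ x → a x ≡ startStep a x (x ≟ᶠ root)
      startFix = fixpoint depth (λ a x → startStep a x (x ≟ᶠ root)) (λ a a′ x h → same a a′ x h (x ≟ᶠ root)) (λ _ → 0)
        where
        same : ∀ a a′ x → (∀ u → depth u < depth x → a u ≡ a′ u) → ∀ d → startStep a x d ≡ startStep a′ x d
        same a a′ x h (yes _) = refl
        same a a′ x h (no ne) = cong (_+ suc (toℕ x) * width (depth x)) (h (parent x) (≤-reflexive (sym (depth-suc ne))))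

    -- The subtree below x occupies the columns from first x to first x + width (depth x).
    first : Fin m → ℕ
    first = proj₁ startFix

    first-step : ∀ {x} → x ≢ root → first x ≡ first (parent x) + suc (toℕ x) * width (depth x)
    first-step {x} ne = trans (proj₂ startFix x) (by (x ≟ᶠ root))
      where
      by : ∀ d → startStep first x d ≡ first (parent x) + suc (toℕ x) * width (depth x)
      by (yes eq) = contradiction eq ne
      by (no _) = refl

    last : Fin m → ℕ
    last x = first x + width (depth x)

    parent-first : ∀ {x} → x ≢ root → first (parent x) < first x
    parent-first {x} ne = subst (first (parent x) <_) (sym (first-step ne))
      (m<m+n (first (parent x)) (≤-trans (width-pos (depth x)) (m≤m+n (width (depth x)) _)))

    last-step : ∀ {x} → x ≢ root → last x ≡ first (parent x) + (2 + toℕ x) * width (depth x)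
    last-step {x} ne = begin
      first x + w ≡⟨ cong (_+ w) (first-step ne) ⟩
      first (parent x) + suc (toℕ x) * w + w ≡⟨ +-assoc (first (parent x)) _ w ⟩
      first (parent x) + (suc (toℕ x) * w + w) ≡⟨ cong (first (parent x) +_) (+-comm (suc (toℕ x) * w) w) ⟩
      first (parent x) + (2 + toℕ x) * w ∎
      where
      open Relation.Binary.PropositionalEquality.≡-Reasoning
      w = width (depth x)

    parent-width : ∀ {x} → x ≢ root → width (depth (parent x)) ≡ suc m * width (depth x)
    parent-width {x} ne = trans (cong (suc m ^_) (+-∸-assoc 1 (depth<D (parent x))))
      (cong (λ d → suc m * width d) (sym (depth-suc ne)))

    parent-last : ∀ {x} → x ≢ root → last x ≤ last (parent x)
    parent-last {x} ne = begin
      last x ≡⟨ last-step ne ⟩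
      first (parent x) + (2 + toℕ x) * width (depth x) ≤⟨ +-monoʳ-≤ (first (parent x)) (*-monoˡ-≤ (width (depth x)) (s≤s (toℕ<n x))) ⟩
      first (parent x) + suc m * width (depth x) ≡⟨ cong (first (parent x) +_) (sym (parent-width ne)) ⟩
      last (parent x) ∎
      where open ≤-Reasoning

    anc-first : ∀ {x y} → Anc x y → first x ≤ first y
    anc-first self = ≤-refl
    anc-first (up ne a) = ≤-trans (anc-first a) (<⇒≤ (parent-first ne))

    anc-last : ∀ {x y} → Anc x y → last y ≤ last x
    anc-last self = ≤-refl
    anc-last (up ne a) = ≤-trans (parent-last ne) (anc-last a)

    first-injective : ∀ {x y} → Anc x y → first y ≤ first x → x ≡ y
    first-injective self _ = refl
    first-injective (up ne a) le = contradiction (≤-trans le (anc-first a)) (<⇒≱ (parent-first ne))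

    siblings : ∀ {x y} → x ≢ root → y ≢ root → parent x ≡ parent y → toℕ x < toℕ y → last x ≤ first y
    siblings {x} {y} nx ny eq lt = begin
      last x ≡⟨ last-step nx ⟩
      first (parent x) + (2 + toℕ x) * width (depth x) ≤⟨ +-monoʳ-≤ (first (parent x)) (*-monoˡ-≤ (width (depth x)) (s≤s lt)) ⟩
      first (parent x) + suc (toℕ y) * width (depth x) ≡⟨ cong₂ (λ p d → first p + suc (toℕ y) * width d) eq
        (trans (depth-suc nx) (trans (cong (λ p → suc (depth p)) eq) (sym (depth-suc ny)))) ⟩
      first (parent y) + suc (toℕ y) * width (depth y) ≡⟨ sym (first-step ny) ⟩
      first y ∎
      where open ≤-Reasoning

    Disjoint : Fin m → Fin m → Set
    Disjoint x y = last x ≤ first y ⊎ last y ≤ first x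

    -- The deeper node, or both at equal depth, gives way to its parent until the parents agree;
    -- siblings occupy different blocks.
    disjoint : ∀ {x y} → ¬ Anc x y → ¬ Anc y x → Disjoint x y
    disjoint {x} {y} = go x y (<-wellFounded (depth x + depth y))
      where
      lower : ∀ {x} → x ≢ root → depth (parent x) < depth x
      lower ne = ≤-reflexive (sym (depth-suc ne))
      liftˡ : ∀ {x y} → x ≢ root → Disjoint (parent x) y → Disjoint x y
      liftˡ ne (inj₁ h) = inj₁ (≤-trans (parent-last ne) h)
      liftˡ ne (inj₂ h) = inj₂ (≤-trans h (<⇒≤ (parent-first ne)))
      liftʳ : ∀ {x y} → y ≢ root → Disjoint x (parent y) → Disjoint x y
      liftʳ ne (inj₁ h) = inj₁ (≤-trans h (<⇒≤ (parent-first ne)))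
      liftʳ ne (inj₂ h) = inj₂ (≤-trans (parent-last ne) h)
      above-parent : ∀ {x y} → y ≢ root → depth x < depth y → ¬ Anc x y → ¬ Anc (parent y) x
      above-parent {x} {y} ny lt ¬a b = ¬a (up ny (subst (Anc x) (sym (anc-eq b (s≤s⁻¹ (≤-trans lt (≤-reflexive (depth-suc ny)))))) self))
      go : ∀ x y → Acc _<_ (depth x + depth y) → ¬ Anc x y → ¬ Anc y x → Disjoint x y
      go x y (acc rec) ¬a ¬b = by (<-cmp (depth x) (depth y))
        where
        nx : x ≢ root
        nx refl = ¬a (anc-root y)
        ny : y ≢ root
        ny refl = ¬b (anc-root x)
        by : _ → Disjoint x y
        by (tri< lt _ _) = liftʳ ny (go x (parent y) (rec (+-monoʳ-< (depth x) (lower ny))) (λ a → ¬a (up ny a)) (above-parent ny lt ¬a))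
        by (tri> _ _ gt) = liftˡ nx (go (parent x) y (rec (+-monoˡ-< (depth y) (lower nx))) (above-parent nx gt ¬b) (λ a → ¬b (up nx a)))
        by (tri≈ _ eq _) with parent x ≟ᶠ parent y
        ... | no ne = liftˡ nx (liftʳ ny (go (parent x) (parent y) (rec (+-mono-< (lower nx) (lower ny)))
                (λ a → ne (anc-eq a (≤-reflexive (sym same)))) (λ a → ne (sym (anc-eq a (≤-reflexive same))))))
          where
          same : depth (parent x) ≡ depth (parent y)
          same = suc-injective (trans (sym (depth-suc nx)) (trans eq (depth-suc ny)))
        ... | yes pe with <-cmp (toℕ x) (toℕ y)
        ...   | tri< lt _ _ = inj₁ (siblings nx ny pe lt)
        ...   | tri≈ _ e _ = contradiction (subst (Anc x) (toℕ-injective e) self) ¬a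
        ...   | tri> _ _ gt = inj₂ (siblings ny nx (sym pe) gt)

    Column : Fin m → ℕ → Set
    Column x j = first x ≤ j × j < last x

    column? : ∀ x j → Dec (Column x j)
    column? x j = (first x ≤? j) ×-dec (j <? last x)

    column-anc : ∀ {x y j} → Anc x y → Column y j → Column x j
    column-anc a (lo , hi) = ≤-trans (anc-first a) lo , ≤-trans hi (anc-last a)

    column-comparable : ∀ {x y j} → Column x j → Column y j → Anc x y ⊎ Anc y x
    column-comparable {x} {y} (lo , hi) (lo′ , hi′) with anc? x y | anc? y x
    ... | yes a | _ = inj₁ a
    ... | no _ | yes b = inj₂ b
    ... | no ¬a | no ¬b with disjoint ¬a ¬b
    ...   | inj₁ h = contradiction (≤-trans hi (≤-trans h lo′)) (<-irrefl refl)
    ...   | inj₂ h = contradiction (≤-trans hi′ (≤-trans h lo)) (<-irrefl refl)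

    column-first : ∀ x → Column x (first x)
    column-first x = ≤-refl , m<m+n (first x) (width-pos (depth x))

    column-of-first : ∀ {x y} → Column x (first y) → Anc x y
    column-of-first {x} {y} c with column-comparable c (column-first y)
    ... | inj₁ a = a
    ... | inj₂ b with first-injective b (proj₁ c)
    ...   | refl = self

  module Drawing (T : Graph) (tree : IsTree T) {k : ℕ} (μ : Fin k → Subset (n T)) (sub : ∀ u → IsSubtree T (μ u))
    (inj : ∀ u v → μ u ≡ μ v → u ≡ v) where
    open Rooted T tree
    open Members T tree μ sub inj using (ρ; closed; τ; τ-inj; τ-depth; ⊆-τ)
    open Layout T tree

    -- The roots of the parts of the tree hanging off `μ u`, where its curve has to dive.
    Gap : Fin k → Fin (n T) → Set
    Gap u y = y ≢ root × parent y ∈ μ u × y ∉ μ u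

    gap? : ∀ u y → Dec (Gap u y)
    gap? u y = ¬? (y ≟ᶠ root) ×-dec ((parent y ∈? μ u) ×-dec ¬? (y ∈? μ u))

    gap-anc : ∀ {u y} → Gap u y → Anc (ρ u) y
    gap-anc {u} (ne , p∈ , _) = up ne (closed-anc (closed u) p∈)

    gap-deep : ∀ {u y} → Gap u y → depth (ρ u) < depth y
    gap-deep {u} (ne , p∈ , _) = ≤-trans (s≤s (anc-depth (closed-anc (closed u) p∈))) (≤-reflexive (sym (depth-suc ne)))

    gap-above-member : ∀ {u y x} → Gap u y → Anc y x → x ∉ μ u
    gap-above-member {u} g a x∈ = proj₂ (proj₂ g) (closed-mid (closed u) x∈ (gap-anc g) a)

    gap-unique : ∀ {u y y′} → Gap u y → Gap u y′ → Anc y y′ → y ≡ y′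
    gap-unique g g′ self = refl
    gap-unique g g′ (up _ a) = contradiction (proj₁ (proj₂ g′)) (gap-above-member g a)

    exit : ∀ u {x} → Anc (ρ u) x → x ∉ μ u → Σ (Fin (n T)) λ z → Gap u z × Anc z x
    exit u self x∉ = contradiction (proj₁ (closed u)) x∉
    exit u {x} (up ne a) x∉ with parent x ∈? μ u
    ... | yes p∈ = x , (ne , p∈ , x∉) , self
    ... | no p∉ with exit u a p∉
    ...   | z , g , b = z , g , up ne b

    GapAt : Fin k → ℕ → Fin (n T) → Set
    GapAt u j y = Gap u y × Column y j

    gapAt? : ∀ u j y → Dec (GapAt u j y)
    gapAt? u j y = gap? u y ×-dec column? y j

    gapAt-unique : ∀ {u j y y′} → GapAt u j y → GapAt u j y′ → y ≡ y′
    gapAt-unique (g , c) (g′ , c′) with column-comparable c c′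
    ... | inj₁ a = gap-unique g g′ a
    ... | inj₂ a = sym (gap-unique g′ g a)

    levelOf : ∀ {u j} → Dec (∃ (GapAt u j)) → ℕ
    levelOf (yes (y , _)) = depth y
    levelOf (no _) = D

    abstract
      level : Fin k → ℕ → ℕ
      level u j = levelOf (any? (gapAt? u j))

      level-gap : ∀ {u j y} → GapAt u j y → level u j ≡ depth y
      level-gap {u} {j} {y} g = by (any? (gapAt? u j))
        where
        by : ∀ d → levelOf {u} {j} d ≡ depth y
        by (yes (y′ , g′)) = cong depth (gapAt-unique g′ g)
        by (no none) = contradiction (y , g) none

      level-full : ∀ {u j} → (∀ y → ¬ GapAt u j y) → level u j ≡ D
      level-full {u} {j} h = by (any? (gapAt? u j))
        where
        by : ∀ d → levelOf {u} {j} d ≡ D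
        by (yes (y , g)) = contradiction g (h y)
        by (no _) = refl

      level-cases : ∀ u j → (Σ (Fin (n T)) λ y → GapAt u j y × level u j ≡ depth y) ⊎ level u j ≡ D
      level-cases u j = by (any? (gapAt? u j))
        where
        by : Dec (∃ (GapAt u j)) → (Σ (Fin (n T)) λ y → GapAt u j y × level u j ≡ depth y) ⊎ level u j ≡ D
        by (yes (y , g)) = inj₁ (y , g , level-gap g)
        by (no none) = inj₂ (level-full λ y g → none (y , g))

    level≤D : ∀ u j → level u j ≤ D
    level≤D u j with level-cases u j
    ... | inj₁ (y , _ , eq) = ≤-trans (≤-reflexive eq) (<⇒≤ (depth<D y))
    ... | inj₂ eq = ≤-reflexive eq

    -- Only ancestors of `x` spread over its first column, and no gap of `u` is an ancestor of a
    -- node of `μ u`.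
    level-member : ∀ {u x} → x ∈ μ u → level u (first x) ≡ D
    level-member x∈ = level-full λ { y (g , c) → gap-above-member g (column-of-first c) x∈ }

    H : ℕ
    H = proj₁ (bounded τ)

    -- Members run at heights decreasing in τ; over a subtree they do not meet they dive below everything else,
    -- the deeper the closer to the root that subtree is attached.
    profile : Fin k → ℕ → ℕ
    profile u j = level u j * suc H + (H ∸ τ u)

    profile-level : ∀ {u v j} → level u j < level v j → profile u j < profile v j
    profile-level {u} lt = lex lt (s≤s (m∸n≤m H (τ u)))

    profile-τ : ∀ {u v j} → τ u < τ v → level v j ≤ level u j → profile v j < profile u j
    profile-τ {u} {v} lt le = +-mono-≤-< (*-monoˡ-≤ (suc H) le) (∸-monoʳ-< lt (<⇒≤ (proj₂ (bounded τ) v)))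

    profile-distinct : ∀ {u v} → u ≢ v → ∀ j → profile u j ≢ profile v j
    profile-distinct {u} {v} ne j eq = ne (τ-inj (∸-cancelˡ-≡ (<⇒≤ (proj₂ (bounded τ) u)) (<⇒≤ (proj₂ (bounded τ) v))
      (lex-injective {a = level u j} {b = level v j} (s≤s (m∸n≤m H (τ u))) (s≤s (m∸n≤m H (τ v))) eq)))

    extent : Fin k → ℕ
    extent u = width (depth (ρ u)) ∸ 1

    curve : Fin k → Curve
    curve u = plot (profile u) (first (ρ u)) (extent u)

    suc-extent : ∀ u → suc (first (ρ u) + extent u) ≡ last (ρ u)
    suc-extent u = trans (sym (+-suc (first (ρ u)) (extent u))) (cong (first (ρ u) +_) (m+[n∸m]≡n (width-pos (depth (ρ u)))))

    dom⇒column : ∀ u {j} → first (ρ u) ≤ j → j ≤ first (ρ u) + extent u → Column (ρ u) j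
    dom⇒column u lo hi = lo , ≤-trans (s≤s hi) (≤-reflexive (suc-extent u))

    column⇒dom : ∀ u {j} → Column (ρ u) j → j ≤ first (ρ u) + extent u
    column⇒dom u {j} (_ , hi) = s≤s⁻¹ (≤-trans hi (≤-reflexive (sym (suc-extent u))))

    -- Over the top of `v` the earlier `u` runs above `v`; over the gap `z` it has dived and `v` has
    -- not. Somewhere between the order flips.
    curves-cross : ∀ {u v z} → τ u < τ v → ρ v ∈ μ u → Gap u z → z ∈ μ v → CurvesIntersect (curve u) (curve v)
    curves-cross {u} {v} {z} lt ρ∈ g z∈ = by (m≤n⇒∃[o]m+o≡n (anc-first ρvz))
      where
      ne : u ≢ v
      ne refl = <-irrefl refl lt
      ρvz : Anc (ρ v) z
      ρvz = closed-anc (closed v) z∈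
      above : profile v (first (ρ v)) < profile u (first (ρ v))
      above = profile-τ {u} {v} lt (≤-trans (level≤D v _) (≤-reflexive (sym (level-member ρ∈))))
      under : profile u (first z) < profile v (first z)
      under = profile-level {u} {v} (begin-strict
        level u (first z) ≡⟨ level-gap (g , column-first z) ⟩
        depth z <⟨ depth<D z ⟩
        D ≡⟨ sym (level-member z∈) ⟩
        level v (first z) ∎)
        where open ≤-Reasoning
      by : (∃ λ d → first (ρ v) + d ≡ first z) → CurvesIntersect (curve u) (curve v)
      by (d , eq) = at (sign-change (profile u) (profile v) d (first (ρ v)) (profile-distinct ne) above
          (subst (λ j → profile u j < profile v j) (sym eq) under))
        where
        at : (Σ ℕ λ i → first (ρ v) ≤ i × i < first (ρ v) + d × profile v i < profile u i × profile u (suc i) < profile v (suc i)) →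
          CurvesIntersect (curve u) (curve v)
        at (i , lo , hi , p , q) = plots-cross (profile u) (profile v) i
          (≤-trans (anc-first (closed-anc (closed u) ρ∈)) lo)
          (≤-trans hi (subst (_≤ first (ρ u) + extent u) (sym eq) (column⇒dom u (column-anc (gap-anc g) (column-first z)))))
          lo (≤-trans hi (subst (_≤ first (ρ v) + extent v) (sym eq) (column⇒dom v (column-anc ρvz (column-first z))))) p q

    curves-meet : ∀ {u v} → τ u < τ v → Overlap (μ u) (μ v) → CurvesIntersect (curve u) (curve v)
    curves-meet {u} {v} lt ((x , xu , xv) , _ , ¬vu) = by (any? λ y → (y ∈? μ v) ×-dec ¬? (y ∈? μ u))
      where
      ρ∈ : ρ v ∈ μ u
      ρ∈ = closed-meet (closed u) (closed v) xu xv (τ-depth lt)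
      by : Dec (∃ λ y → y ∈ μ v × ¬ y ∈ μ u) → CurvesIntersect (curve u) (curve v)
      by (no none) = contradiction (λ {y} y∈ → decidable-stable (y ∈? μ u) λ y∉ → none (y , y∈ , y∉)) ¬vu
      -- On the way from `ρ v` to a node of `μ v` outside `μ u` there is a gap of `u`, and convexity
      -- puts it in `μ v`.
      by (yes (y , y∈v , y∉u)) with exit u (anc-trans (closed-anc (closed u) ρ∈) (closed-anc (closed v) y∈v)) y∉u
      ... | z , g , zy with anc-linear (closed-anc (closed v) y∈v) zy
      ...   | inj₂ b = contradiction ρ∈ (gap-above-member g b)
      ...   | inj₁ a = curves-cross lt ρ∈ g (closed-mid (closed v) y∈v a zy)

    -- If `ρ v` is in `μ u`, then `v` is inside `u`, each gap of `u` over columns of `v` is at or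
    -- below a gap of `v`, and `v` runs lower. If `ρ v` hangs below a gap of `u`, then `u` has dived
    -- under all of `v`. Otherwise no column is shared.
    curves-apart : ∀ {u v} → τ u < τ v → ¬ Overlap (μ u) (μ v) → ¬ CurvesIntersect (curve u) (curve v)
    curves-apart {u} {v} lt ¬o = by (ρ v ∈? μ u) (anc? (ρ u) (ρ v))
      where
      swap : CurvesIntersect (curve u) (curve v) → CurvesIntersect (curve v) (curve u)
      swap (p , a , b) = p , b , a
      by : Dec (ρ v ∈ μ u) → Dec (Anc (ρ u) (ρ v)) → ¬ CurvesIntersect (curve u) (curve v)
      by (yes ρ∈) _ = plots-disjoint (profile u) (profile v) λ j lo hi lo′ hi′ → profile-τ {u} {v} lt (lower j (dom⇒column v lo′ hi′))
        where
        vu : μ v ⊆ μ u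
        vu with μ v ⊆? μ u | μ u ⊆? μ v
        ... | yes h | _ = h
        ... | no _ | yes h = contradiction (⊆-τ {v} {u} h λ { refl → <-irrefl refl lt }) (<-asym lt)
        ... | no h | no h′ = contradiction ((ρ v , ρ∈ , proj₁ (closed v)) , h′ , h) ¬o
        lower : ∀ j → Column (ρ v) j → level v j ≤ level u j
        lower j c with level-cases u j
        ... | inj₂ eq = ≤-trans (level≤D v j) (≤-reflexive (sym eq))
        ... | inj₁ (y , (g , cy) , eq) with column-comparable c cy
        ...   | inj₂ a = contradiction ρ∈ (gap-above-member g a)
        ...   | inj₁ a with exit v a (λ y∈ → proj₂ (proj₂ g) (vu y∈))
        ...     | z , gz , zy = ≤-trans (≤-reflexive (level-gap (gz , column-anc zy cy))) (≤-trans (anc-depth zy) (≤-reflexive (sym eq)))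
      by (no ρ∉) (yes a) (p , x , y) = plots-disjoint (profile v) (profile u) {first (ρ v)} {extent v} {first (ρ u)} {extent u}
          (λ j lo hi _ _ → profile-level {u} {v} (dive j (dom⇒column v lo hi))) (p , y , x)
        where
        dive : ∀ j → Column (ρ v) j → level u j < level v j
        dive j c with exit u a ρ∉
        ... | z , g , zv = subst (_< level v j) (sym (level-gap (g , column-anc zv c))) (≤-<-trans (anc-depth zv) (above (level-cases v j)))
          where
          above : _ → depth (ρ v) < level v j
          above (inj₁ (y , (gy , _) , eq)) = ≤-trans (gap-deep gy) (≤-reflexive (sym eq))
          above (inj₂ eq) = ≤-trans (depth<D (ρ v)) (≤-reflexive (sym eq))
      by (no ρ∉) (no ¬a) = plots-disjoint (profile u) (profile v) λ j lo hi lo′ hi′ →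
          ⊥-elim (none (column-comparable (dom⇒column u lo hi) (dom⇒column v lo′ hi′)))
        where
        none : Anc (ρ u) (ρ v) ⊎ Anc (ρ v) (ρ u) → ⊥
        none (inj₁ a) = ¬a a
        none (inj₂ b) = ¬a (subst (Anc (ρ u)) (sym (anc-eq b (τ-depth lt))) self)

  subtreeOverlap⇒string : ∀ G → IsSubtreeOverlapGraph G → IsStringGraph G
  subtreeOverlap⇒string G (T , tree , μ , sub , inj , ov) = curve , λ u v ne → to u v ne , from u v ne
    where
    open Drawing T tree μ sub inj
    open Members T tree μ sub inj using (τ; τ-inj)
    to : ∀ u v → u ≢ v → Adj G u v → CurvesIntersect (curve u) (curve v)
    to u v ne e with <-cmp (τ u) (τ v)
    ... | tri< lt _ _ = curves-meet lt (proj₁ (ov u v) e)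
    ... | tri≈ _ eq _ = contradiction (τ-inj eq) ne
    ... | tri> _ _ gt with curves-meet gt (overlap-sym (proj₁ (ov u v) e))
    ...   | p , a , b = p , b , a
    from : ∀ u v → u ≢ v → CurvesIntersect (curve u) (curve v) → Adj G u v
    from u v ne h@(p , a , b) with overlap? (μ u) (μ v)
    ... | yes o = proj₂ (ov u v) o
    ... | no ¬o with <-cmp (τ u) (τ v)
    ...   | tri< lt _ _ = contradiction h (curves-apart lt ¬o)
    ...   | tri≈ _ eq _ = contradiction (τ-inj eq) ne
    ...   | tri> _ _ gt = contradiction (p , b , a) (curves-apart gt λ o → ¬o (overlap-sym o))

-- Clean families by recursive composition: forced colours and cliques.

module Scenes where

  open import Data.Nat using (⌈_/2⌉)
  open import Data.Fin.Subset using (Subset; _∈_; _∪_; ∣_∣; inside; outside) renaming (⊥ to ∅; ⁅_⁆ to single)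
  open import Data.Fin.Subset.Properties using (x∈p∪q⁻; ∉⊥; x∈⁅y⁆⇒x≡y; ∣⁅x⁆∣≡1)
  open import Data.Vec using ([]; _∷_; here; there)
  open import Data.Unit using (⊤; tt)
  open import Data.Maybe using (Maybe; just; nothing; map)

  -- A tree-like presentation of a clean family. A u v: u is alive when v arrives, C u v: u contains v,
  -- Al u l: u is alive at the end l. The alive members at an end form a chain.
  record Scene : Set₁ where
    field
      V L : Set
      A C : V → V → Set
      Al : V → L → Set
      _≟ᴸ_ : (l m : L) → Dec (l ≡ m)
      A? : ∀ u v → Dec (A u v)
      C? : ∀ u v → Dec (C u v)
      Al? : ∀ u l → Dec (Al u l)
      -- The tree of arrivals: `prev` and `prevᴸ` give the arrival directly before a member or an
      -- end.
      prev : V → Maybe V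
      prevᴸ : L → Maybe V
      dep : V → ℕ
      H : ℕ
      dep<H : ∀ v → dep v < H
      A-refl : ∀ {u} → A u u
      C-refl : ∀ {u} → C u u
      C⇒A : ∀ {u v} → C u v → A u v
      A-prev : ∀ {u v} → A u v → v ≡ u ⊎ Σ V λ p → prev v ≡ just p × A u p
      prev-dep : ∀ {v p} → prev v ≡ just p → dep p < dep v
      Al-prev : ∀ {u l} → Al u l → Σ V λ p → prevᴸ l ≡ just p × A u p
      C-A : ∀ {u v w} → C u v → A v w → A u w
      C-C : ∀ {u v w} → C u v → C v w → C u w
      C-Al : ∀ {u v l} → C u v → Al v l → Al u l
      C-chain : ∀ {u v w} → C u w → C v w → C u v ⊎ C v u
      Al-chain : ∀ {u v l} → Al u l → Al v l → C u v ⊎ C v u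
      C-antisym : ∀ {u v} → C u v → C v u → u ≡ v

    O : V → V → Set
    O u v = (A u v ⊎ A v u) × ¬ C u v × ¬ C v u

    O-sym : ∀ {u v} → O u v → O v u
    O-sym (inj₁ a , b , c) = inj₂ a , c , b
    O-sym (inj₂ a , b , c) = inj₁ a , c , b

  emptyScene : Scene
  emptyScene = record
    { V = ⊥ ; L = ⊤ ; A = λ () ; C = λ () ; Al = λ () ; _≟ᴸ_ = λ _ _ → yes refl ; A? = λ () ; C? = λ () ; Al? = λ ()
    ; prev = λ () ; prevᴸ = λ _ → nothing ; dep = λ () ; H = 0 ; dep<H = λ ()
    ; A-refl = λ { {()} } ; C-refl = λ { {()} } ; C⇒A = λ { {()} } ; A-prev = λ { {()} } ; prev-dep = λ { {()} } ; Al-prev = λ { {()} }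
    ; C-A = λ { {()} } ; C-C = λ { {()} } ; C-Al = λ { {()} } ; C-chain = λ { {()} } ; Al-chain = λ { {()} } ; C-antisym = λ { {()} }
    }

  singleScene : Scene
  singleScene = record
    { V = ⊤ ; L = ⊤ ; A = λ _ _ → ⊤ ; C = λ _ _ → ⊤ ; Al = λ _ _ → ⊤ ; _≟ᴸ_ = λ _ _ → yes refl
    ; A? = λ _ _ → yes tt ; C? = λ _ _ → yes tt ; Al? = λ _ _ → yes tt
    ; prev = λ _ → nothing ; prevᴸ = λ _ → just tt ; dep = λ _ → 0 ; H = 1 ; dep<H = λ _ → s≤s z≤n
    ; A-refl = tt ; C-refl = tt ; C⇒A = λ _ → tt ; A-prev = λ _ → inj₁ refl ; prev-dep = λ () ; Al-prev = λ _ → tt , refl , tt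
    ; C-A = λ _ _ → tt ; C-C = λ _ _ → tt ; C-Al = λ _ _ → tt ; C-chain = λ _ _ → inj₁ tt ; Al-chain = λ _ _ → inj₁ tt
    ; C-antisym = λ _ _ → refl
    }

  -- At every end l of P a copy of P is played inside the members alive at l; at every end m of the copy one may either
  -- stop, or play B so that its members lie inside the members alive at l and overlap those of the copy alive at m,
  -- and then let the latter die.
  module Compose (P B : Scene) where
    open Scene P
    module Bl = Scene B

    V′ L′ : Set
    V′ = V ⊎ (L × (V ⊎ (L × Bl.V)))
    L′ = L × (L × (⊤ ⊎ Bl.L))

    pattern out u = inj₁ u
    pattern cpy l u = inj₂ (l , inj₁ u)
    pattern blk l m b = inj₂ (l , inj₂ (m , b))
    pattern keep l m = l , (m , inj₁ tt)
    pattern drop l m k = l , (m , inj₂ k)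

    A′ C′ : V′ → V′ → Set
    A′ (out u) (out v) = A u v
    A′ (out u) (cpy l _) = Al u l
    A′ (out u) (blk l _ _) = Al u l
    A′ (cpy l u) (cpy l′ v) = l ≡ l′ × A u v
    A′ (cpy l u) (blk l′ m _) = l ≡ l′ × Al u m
    A′ (blk l m b) (blk l′ m′ b′) = l ≡ l′ × m ≡ m′ × Bl.A b b′
    A′ (cpy _ _) (out _) = ⊥
    A′ (blk _ _ _) (out _) = ⊥
    A′ (blk _ _ _) (cpy _ _) = ⊥
    C′ (out u) (out v) = C u v
    C′ (out u) (cpy l _) = Al u l
    C′ (out u) (blk l _ _) = Al u l
    C′ (cpy l u) (cpy l′ v) = l ≡ l′ × C u v
    C′ (cpy _ _) (blk _ _ _) = ⊥
    C′ (blk l m b) (blk l′ m′ b′) = l ≡ l′ × m ≡ m′ × Bl.C b b′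
    C′ (cpy _ _) (out _) = ⊥
    C′ (blk _ _ _) (out _) = ⊥
    C′ (blk _ _ _) (cpy _ _) = ⊥

    Al′ : V′ → L′ → Set
    Al′ (out u) (l , _) = Al u l
    Al′ (cpy l u) (keep l′ m) = l ≡ l′ × Al u m
    Al′ (cpy _ _) (drop _ _ _) = ⊥
    Al′ (blk _ _ _) (keep _ _) = ⊥
    Al′ (blk l m b) (drop l′ m′ k) = l ≡ l′ × m ≡ m′ × Bl.Al b k

    A′? : ∀ u v → Dec (A′ u v)
    A′? (out u) (out v) = A? u v
    A′? (out u) (cpy l _) = Al? u l
    A′? (out u) (blk l _ _) = Al? u l
    A′? (cpy l u) (cpy l′ v) = (l ≟ᴸ l′) ×-dec A? u v
    A′? (cpy l u) (blk l′ m _) = (l ≟ᴸ l′) ×-dec Al? u m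
    A′? (blk l m b) (blk l′ m′ b′) = (l ≟ᴸ l′) ×-dec ((m ≟ᴸ m′) ×-dec Bl.A? b b′)
    A′? (cpy _ _) (out _) = no (λ ())
    A′? (blk _ _ _) (out _) = no (λ ())
    A′? (blk _ _ _) (cpy _ _) = no (λ ())

    C′? : ∀ u v → Dec (C′ u v)
    C′? (out u) (out v) = C? u v
    C′? (out u) (cpy l _) = Al? u l
    C′? (out u) (blk l _ _) = Al? u l
    C′? (cpy l u) (cpy l′ v) = (l ≟ᴸ l′) ×-dec C? u v
    C′? (cpy l u) (blk l′ m _) = no (λ ())
    C′? (blk l m b) (blk l′ m′ b′) = (l ≟ᴸ l′) ×-dec ((m ≟ᴸ m′) ×-dec Bl.C? b b′)
    C′? (cpy _ _) (out _) = no (λ ())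
    C′? (blk _ _ _) (out _) = no (λ ())
    C′? (blk _ _ _) (cpy _ _) = no (λ ())

    Al′? : ∀ u l → Dec (Al′ u l)
    Al′? (out u) (l , _) = Al? u l
    Al′? (cpy l u) (keep l′ m) = (l ≟ᴸ l′) ×-dec Al? u m
    Al′? (cpy _ _) (drop _ _ _) = no (λ ())
    Al′? (blk _ _ _) (keep _ _) = no (λ ())
    Al′? (blk l m b) (drop l′ m′ k) = (l ≟ᴸ l′) ×-dec ((m ≟ᴸ m′) ×-dec Bl.Al? b k)

    _≟′_ : (x y : L′) → Dec (x ≡ y)
    keep l m ≟′ keep l′ m′ with l ≟ᴸ l′ | m ≟ᴸ m′
    ... | yes refl | yes refl = yes refl
    ... | no ne | _ = no λ { refl → ne refl }
    ... | _ | no ne = no λ { refl → ne refl }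
    drop l m k ≟′ drop l′ m′ k′ with l ≟ᴸ l′ | m ≟ᴸ m′ | k Bl.≟ᴸ k′
    ... | yes refl | yes refl | yes refl = yes refl
    ... | no ne | _ | _ = no λ { refl → ne refl }
    ... | _ | no ne | _ = no λ { refl → ne refl }
    ... | _ | _ | no ne = no λ { refl → ne refl }
    keep _ _ ≟′ drop _ _ _ = no λ ()
    drop _ _ _ ≟′ keep _ _ = no λ ()

    cpyPrev : L → Maybe V → Maybe V′
    cpyPrev l (just p) = just (cpy l p)
    cpyPrev l nothing = map out (prevᴸ l)

    blkPrev : L → L → Maybe Bl.V → Maybe V′
    blkPrev l m (just p) = just (blk l m p)
    blkPrev l m nothing = cpyPrev l (prevᴸ m)

    prev′ : V′ → Maybe V′
    prev′ (out u) = map out (prev u)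
    prev′ (cpy l u) = cpyPrev l (prev u)
    prev′ (blk l m b) = blkPrev l m (Bl.prev b)

    prevᴸ′ : L′ → Maybe V′
    prevᴸ′ (keep l m) = cpyPrev l (prevᴸ m)
    prevᴸ′ (drop l m k) = blkPrev l m (Bl.prevᴸ k)

    Through : V′ → Maybe V′ → Set
    Through u mp = Σ V′ λ p → mp ≡ just p × A′ u p

    out-end : ∀ {u l} → Al u l → Through (out u) (map out (prevᴸ l))
    out-end a with Al-prev a
    ... | p , eq , a′ = out p , cong (map out) eq , a′

    out-cpy : ∀ {u l} → Al u l → ∀ mp → Through (out u) (cpyPrev l mp)
    out-cpy {l = l} a (just p) = cpy l p , refl , a
    out-cpy a nothing = out-end a

    out-blk : ∀ {u l m} → Al u l → ∀ mp → Through (out u) (blkPrev l m mp)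
    out-blk {l = l} {m} a (just p) = blk l m p , refl , a
    out-blk {m = m} a nothing = out-cpy a (prevᴸ m)

    cpy-cpy : ∀ {u l mp} → (Σ V λ p → mp ≡ just p × A u p) → Through (cpy l u) (cpyPrev l mp)
    cpy-cpy {l = l} (p , refl , a) = cpy l p , refl , refl , a

    cpy-blk : ∀ {u l m} → Al u m → ∀ mp → Through (cpy l u) (blkPrev l m mp)
    cpy-blk {l = l} {m} a (just p) = blk l m p , refl , refl , a
    cpy-blk a nothing = cpy-cpy (Al-prev a)

    A-prev′ : ∀ {u v} → A′ u v → v ≡ u ⊎ Through u (prev′ v)
    A-prev′ {out u} {out v} a with A-prev a
    ... | inj₁ refl = inj₁ refl
    ... | inj₂ (p , eq , a′) = inj₂ (out p , cong (map out) eq , a′)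
    A-prev′ {out u} {cpy l v} a = inj₂ (out-cpy a (prev v))
    A-prev′ {out u} {blk l m b} a = inj₂ (out-blk a (Bl.prev b))
    A-prev′ {cpy l u} {cpy .l v} (refl , a) with A-prev a
    ... | inj₁ refl = inj₁ refl
    ... | inj₂ t = inj₂ (cpy-cpy t)
    A-prev′ {cpy l u} {blk .l m b} (refl , a) = inj₂ (cpy-blk a (Bl.prev b))
    A-prev′ {blk l m b} {blk .l .m b′} (refl , refl , a) with Bl.A-prev a
    ... | inj₁ refl = inj₁ refl
    ... | inj₂ (p , eq , a′) = inj₂ (blk l m p , cong (blkPrev l m) eq , refl , refl , a′)

    Al-prev′ : ∀ {u l} → Al′ u l → Through u (prevᴸ′ l)
    Al-prev′ {out u} {keep l m} a = out-cpy a (prevᴸ m)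
    Al-prev′ {out u} {drop l m k} a = out-blk a (Bl.prevᴸ k)
    Al-prev′ {cpy l u} {keep .l m} (refl , a) = cpy-cpy (Al-prev a)
    Al-prev′ {blk l m b} {drop .l .m k} (refl , refl , a) with Bl.Al-prev a
    ... | p , eq , a′ = blk l m p , cong (blkPrev l m) eq , refl , refl , a′

    dep′ : V′ → ℕ
    dep′ (out u) = dep u
    dep′ (cpy l u) = H + dep u
    dep′ (blk l m b) = H + (H + Bl.dep b)

    dep<H′ : ∀ v → dep′ v < H + (H + Bl.H)
    dep<H′ (out u) = ≤-trans (dep<H u) (m≤m+n H _)
    dep<H′ (cpy l u) = +-monoʳ-< H (≤-trans (dep<H u) (m≤m+n H _))
    dep<H′ (blk l m b) = +-monoʳ-< H (+-monoʳ-< H (Bl.dep<H b))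

    end-dep : ∀ l {p} → map out (prevᴸ l) ≡ just p → ∀ d → dep′ p < H + d
    end-dep l eq d with prevᴸ l
    end-dep l refl d | just q = ≤-trans (dep<H q) (m≤m+n H d)

    cpy-dep : ∀ l mp {p} → cpyPrev l mp ≡ just p → ∀ d → (∀ {q} → mp ≡ just q → dep q < d) → dep′ p < H + d
    cpy-dep l (just q) refl d h = +-monoʳ-< H (h refl)
    cpy-dep l nothing eq d h = end-dep l eq d

    prev-dep′ : ∀ {v p} → prev′ v ≡ just p → dep′ p < dep′ v
    prev-dep′ {out u} eq with prev u in e
    prev-dep′ {out u} refl | just q = prev-dep e
    prev-dep′ {cpy l u} eq = cpy-dep l (prev u) eq (dep u) prev-dep
    prev-dep′ {blk l m b} eq with Bl.prev b in e
    prev-dep′ {blk l m b} refl | just q = +-monoʳ-< H (+-monoʳ-< H (Bl.prev-dep e))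
    ... | nothing = cpy-dep l (prevᴸ m) eq (H + Bl.dep b) λ {q} _ → ≤-trans (dep<H q) (m≤m+n H _)

    A-refl′ : ∀ {u} → A′ u u
    A-refl′ {out u} = A-refl
    A-refl′ {cpy l u} = refl , A-refl
    A-refl′ {blk l m b} = refl , refl , Bl.A-refl

    C-refl′ : ∀ {u} → C′ u u
    C-refl′ {out u} = C-refl
    C-refl′ {cpy l u} = refl , C-refl
    C-refl′ {blk l m b} = refl , refl , Bl.C-refl

    C⇒A′ : ∀ {u v} → C′ u v → A′ u v
    C⇒A′ {out u} {out v} c = C⇒A c
    C⇒A′ {out u} {cpy l v} c = c
    C⇒A′ {out u} {blk l m b} c = c
    C⇒A′ {cpy l u} {cpy l′ v} (eq , c) = eq , C⇒A c
    C⇒A′ {blk l m b} {blk l′ m′ b′} (eq , eq′ , c) = eq , eq′ , Bl.C⇒A c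

    C-A′ : ∀ {u v w} → C′ u v → A′ v w → A′ u w
    C-A′ {out _} {out _} {out _} c a = C-A c a
    C-A′ {out _} {out _} {cpy _ _} c a = C-Al c a
    C-A′ {out _} {out _} {blk _ _ _} c a = C-Al c a
    C-A′ {out _} {cpy _ _} {cpy _ _} c (refl , _) = c
    C-A′ {out _} {cpy _ _} {blk _ _ _} c (refl , _) = c
    C-A′ {out _} {blk _ _ _} {blk _ _ _} c (refl , _) = c
    C-A′ {cpy _ _} {cpy _ _} {cpy _ _} (refl , c) (refl , a) = refl , C-A c a
    C-A′ {cpy _ _} {cpy _ _} {blk _ _ _} (refl , c) (refl , a) = refl , C-Al c a
    C-A′ {blk _ _ _} {blk _ _ _} {blk _ _ _} (refl , refl , c) (refl , refl , a) = refl , refl , Bl.C-A c a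

    C-C′ : ∀ {u v w} → C′ u v → C′ v w → C′ u w
    C-C′ {out _} {out _} {out _} c a = C-C c a
    C-C′ {out _} {out _} {cpy _ _} c a = C-Al c a
    C-C′ {out _} {out _} {blk _ _ _} c a = C-Al c a
    C-C′ {out _} {cpy _ _} {cpy _ _} c (refl , _) = c
    C-C′ {out _} {blk _ _ _} {blk _ _ _} c (refl , _) = c
    C-C′ {cpy _ _} {cpy _ _} {cpy _ _} (refl , c) (refl , a) = refl , C-C c a
    C-C′ {blk _ _ _} {blk _ _ _} {blk _ _ _} (refl , refl , c) (refl , refl , a) = refl , refl , Bl.C-C c a

    C-Al′ : ∀ {u v l} → C′ u v → Al′ v l → Al′ u l
    C-Al′ {out _} {out _} {_ , _} c a = C-Al c a
    C-Al′ {out _} {cpy _ _} {keep _ _} c (refl , _) = c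
    C-Al′ {out _} {blk _ _ _} {drop _ _ _} c (refl , _) = c
    C-Al′ {cpy _ _} {cpy _ _} {keep _ _} (refl , c) (refl , a) = refl , C-Al c a
    C-Al′ {blk _ _ _} {blk _ _ _} {drop _ _ _} (refl , refl , c) (refl , refl , a) = refl , refl , Bl.C-Al c a

    C-chain′ : ∀ {u v w} → C′ u w → C′ v w → C′ u v ⊎ C′ v u
    C-chain′ {out _} {out _} {out _} c d = C-chain c d
    C-chain′ {out _} {out _} {cpy _ _} c d = Al-chain c d
    C-chain′ {out _} {out _} {blk _ _ _} c d = Al-chain c d
    C-chain′ {out _} {cpy _ _} {cpy _ _} c (refl , _) = inj₁ c
    C-chain′ {out _} {blk _ _ _} {blk _ _ _} c (refl , _) = inj₁ c
    C-chain′ {cpy _ _} {out _} {cpy _ _} (refl , _) c = inj₂ c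
    C-chain′ {blk _ _ _} {out _} {blk _ _ _} (refl , _) c = inj₂ c
    C-chain′ {cpy _ _} {cpy _ _} {cpy _ _} (refl , c) (refl , d) with C-chain c d
    ... | inj₁ h = inj₁ (refl , h)
    ... | inj₂ h = inj₂ (refl , h)
    C-chain′ {blk _ _ _} {blk _ _ _} {blk _ _ _} (refl , refl , c) (refl , refl , d) with Bl.C-chain c d
    ... | inj₁ h = inj₁ (refl , refl , h)
    ... | inj₂ h = inj₂ (refl , refl , h)

    Al-chain′ : ∀ {u v l} → Al′ u l → Al′ v l → C′ u v ⊎ C′ v u
    Al-chain′ {out _} {out _} {_ , _} c d = Al-chain c d
    Al-chain′ {out _} {cpy _ _} {keep _ _} c (refl , _) = inj₁ c
    Al-chain′ {out _} {blk _ _ _} {drop _ _ _} c (refl , _) = inj₁ c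
    Al-chain′ {cpy _ _} {out _} {keep _ _} (refl , _) c = inj₂ c
    Al-chain′ {blk _ _ _} {out _} {drop _ _ _} (refl , _) c = inj₂ c
    Al-chain′ {cpy _ _} {cpy _ _} {keep _ _} (refl , c) (refl , d) with Al-chain c d
    ... | inj₁ h = inj₁ (refl , h)
    ... | inj₂ h = inj₂ (refl , h)
    Al-chain′ {blk _ _ _} {blk _ _ _} {drop _ _ _} (refl , refl , c) (refl , refl , d) with Bl.Al-chain c d
    ... | inj₁ h = inj₁ (refl , refl , h)
    ... | inj₂ h = inj₂ (refl , refl , h)

    C-antisym′ : ∀ {u v} → C′ u v → C′ v u → u ≡ v
    C-antisym′ {out _} {out _} c d = cong out (C-antisym c d)
    C-antisym′ {out _} {cpy _ _} _ ()
    C-antisym′ {out _} {blk _ _ _} _ ()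
    C-antisym′ {cpy l _} {cpy _ _} (refl , c) (_ , d) = cong (λ u → cpy l u) (C-antisym c d)
    C-antisym′ {blk l m _} {blk _ _ _} (refl , refl , c) (_ , _ , d) = cong (λ b → blk l m b) (Bl.C-antisym c d)

    scene′ : Scene
    scene′ = record
      { V = V′ ; L = L′ ; A = A′ ; C = C′ ; Al = Al′ ; _≟ᴸ_ = _≟′_ ; A? = A′? ; C? = C′? ; Al? = Al′?
      ; prev = prev′ ; prevᴸ = prevᴸ′ ; dep = dep′ ; H = H + (H + Bl.H) ; dep<H = dep<H′
      ; A-refl = λ {u} → A-refl′ {u} ; C-refl = λ {u} → C-refl′ {u} ; C⇒A = λ {u} {v} → C⇒A′ {u} {v}
      ; A-prev = λ {u} {v} → A-prev′ {u} {v} ; prev-dep = λ {v} → prev-dep′ {v} ; Al-prev = λ {u} {l} → Al-prev′ {u} {l}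
      ; C-A = λ {u} {v} {w} → C-A′ {u} {v} {w} ; C-C = λ {u} {v} {w} → C-C′ {u} {v} {w} ; C-Al = λ {u} {v} {l} → C-Al′ {u} {v} {l}
      ; C-chain = λ {u} {v} {w} → C-chain′ {u} {v} {w} ; Al-chain = λ {u} {v} {l} → Al-chain′ {u} {v} {l}
      ; C-antisym = λ {u} {v} → C-antisym′ {u} {v}
      }

  -- All the colours must occur at one end, because a composition continues inside the members alive
  -- there.
  Forces : Scene → ℕ → Set
  Forces S g = ∀ {k} (c : V → Fin k) → (∀ u v → O u v → c u ≢ c v) →
    Σ L λ l → Σ (Subset k) λ p → g ≤ ∣ p ∣ × (∀ {x} → x ∈ p → Σ V λ u → Al u l × c u ≡ x)
    where open Scene S

  -- Elementwise: an element of `p` counts twice on the right and at most twice on the left, `q` and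
  -- `r` being disjoint; outside `p` both sides agree.
  union-count : ∀ {k} (p q r : Subset k) → (∀ {x} → x ∈ q → x ∈ r → ⊥) → ∣ p ∣ + (∣ q ∣ + ∣ r ∣) ≤ ∣ p ∪ q ∣ + ∣ p ∪ r ∣
  union-count [] [] [] _ = z≤n
  union-count (x ∷ p) (y ∷ q) (z ∷ r) h = add x y z (λ e e′ → h (top e) (top e′)) (union-count p q r λ a b → h (there a) (there b))
    where
    top : ∀ {k x} {p : Subset k} → x ≡ inside → zero ∈ x ∷ p
    top refl = here
    add : ∀ x y z → (y ≡ inside → z ≡ inside → ⊥) → ∣ p ∣ + (∣ q ∣ + ∣ r ∣) ≤ ∣ p ∪ q ∣ + ∣ p ∪ r ∣ →
      ∣ x ∷ p ∣ + (∣ y ∷ q ∣ + ∣ z ∷ r ∣) ≤ ∣ (x ∷ p) ∪ (y ∷ q) ∣ + ∣ (x ∷ p) ∪ (z ∷ r) ∣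
    add outside outside outside _ le = le
    add outside outside inside _ le = subst₂≤ (trans (sym (+-suc ∣ p ∣ _)) (cong (∣ p ∣ +_) (sym (+-suc ∣ q ∣ ∣ r ∣)))) (sym (+-suc _ _)) (s≤s le)
      where
      subst₂≤ : ∀ {a b c d} → a ≡ b → c ≡ d → a ≤ c → b ≤ d
      subst₂≤ refl refl le = le
    add outside inside outside _ le = ≤-trans (≤-reflexive (+-suc ∣ p ∣ _)) (s≤s le)
    add outside inside inside excl _ = ⊥-elim (excl refl refl)
    add inside outside outside _ le = s≤s (≤-trans le (+-monoʳ-≤ ∣ p ∪ q ∣ (n≤1+n _)))
    add inside outside inside _ le = s≤s (≤-trans (≤-reflexive (trans (cong (∣ p ∣ +_) (+-suc ∣ q ∣ ∣ r ∣)) (+-suc ∣ p ∣ _)))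
      (≤-trans (s≤s le) (≤-reflexive (sym (+-suc _ _)))))
    add inside inside outside _ le = s≤s (≤-trans (≤-reflexive (+-suc ∣ p ∣ _)) (≤-trans (s≤s le) (≤-reflexive (sym (+-suc _ _)))))
    add inside inside inside excl _ = ⊥-elim (excl refl refl)

  half-upper : ∀ n → ⌈ n /2⌉ + ⌈ n /2⌉ ≤ suc n
  half-upper n = ≤-trans (+-monoʳ-≤ ⌈ n /2⌉ (⌊n/2⌋≤⌈n/2⌉ (suc n))) (≤-reflexive (⌊n/2⌋+⌈n/2⌉≡n (suc n)))

  half-lower : ∀ n → n ≤ ⌈ n /2⌉ + ⌈ n /2⌉
  half-lower n = ≤-trans (≤-reflexive (sym (⌊n/2⌋+⌈n/2⌉≡n n))) (+-monoˡ-≤ ⌈ n /2⌉ (⌊n/2⌋≤⌈n/2⌉ n))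

  -- If both failed, `x + y` would fall at least 2 short of twice `g + ⌈ h /2⌉`, while rounding up
  -- costs only 1 in total.
  one-is-large : ∀ {x y} g h → g + (g + h) ≤ x + y → g + ⌈ h /2⌉ ≤ x ⊎ g + ⌈ h /2⌉ ≤ y
  one-is-large {x} {y} g h le with g + ⌈ h /2⌉ ≤? x | g + ⌈ h /2⌉ ≤? y
  ... | yes p | _ = inj₁ p
  ... | no _ | yes q = inj₂ q
  ... | no ¬p | no ¬q = contradiction (begin
      suc (suc (x + y)) ≡⟨ cong suc (sym (+-suc x y)) ⟩
      suc x + suc y ≤⟨ +-mono-≤ (≰⇒> ¬p) (≰⇒> ¬q) ⟩
      (g + ⌈ h /2⌉) + (g + ⌈ h /2⌉) ≡⟨ +-assoc g ⌈ h /2⌉ _ ⟩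
      g + (⌈ h /2⌉ + (g + ⌈ h /2⌉)) ≡⟨ cong (g +_) (trans (sym (+-assoc ⌈ h /2⌉ g ⌈ h /2⌉)) (trans (cong (_+ ⌈ h /2⌉) (+-comm ⌈ h /2⌉ g)) (+-assoc g ⌈ h /2⌉ ⌈ h /2⌉))) ⟩
      g + (g + (⌈ h /2⌉ + ⌈ h /2⌉)) ≤⟨ +-monoʳ-≤ g (+-monoʳ-≤ g (half-upper h)) ⟩
      g + (g + suc h) ≡⟨ cong (g +_) (+-suc g h) ⟩
      g + suc (g + h) ≡⟨ +-suc g (g + h) ⟩
      suc (g + (g + h)) ≤⟨ s≤s le ⟩
      suc (x + y) ∎) (<-irrefl refl)
    where open ≤-Reasoning

  -- `p₁`, `p₂`, `p₃` are the colours forced outside, in the copy and in `B`. The last two are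
  -- disjoint, since members of `B` overlap those of the copy alive at `m`. One of them therefore
  -- enlarges `p₁` enough, and `keep` or `drop` provides the end where the union is alive.
  compose-forces : ∀ P B {g h} → Forces P g → Forces B h → Forces (Compose.scene′ P B) (g + ⌈ h /2⌉)
  compose-forces P B {g} {h} fP fB {k} c proper = combine (one-is-large g h
      (≤-trans (+-mono-≤ g₁ (+-mono-≤ g₂ g₃)) (union-count p₁ p₂ p₃ disjoint)))
    where
    open Compose P B
    open Scene P
    r₁ = fP (λ u → c (out u)) (λ u v o → proper (out u) (out v) o)
    l = proj₁ r₁
    p₁ = proj₁ (proj₂ r₁)
    g₁ = proj₁ (proj₂ (proj₂ r₁))
    r₂ = fP (λ u → c (cpy l u)) (λ { u v (a , ¬c , ¬c′) → proper (cpy l u) (cpy l v) (both a , (λ z → ¬c (proj₂ z)) , λ z → ¬c′ (proj₂ z)) })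
      where
      both : ∀ {u v} → A u v ⊎ A v u → (l ≡ l × A u v) ⊎ (l ≡ l × A v u)
      both (inj₁ a) = inj₁ (refl , a)
      both (inj₂ a) = inj₂ (refl , a)
    m = proj₁ r₂
    p₂ = proj₁ (proj₂ r₂)
    g₂ = proj₁ (proj₂ (proj₂ r₂))
    r₃ = fB (λ b → c (blk l m b)) (λ { u v (a , ¬c , ¬c′) → proper (blk l m u) (blk l m v)
           (both a , (λ z → ¬c (proj₂ (proj₂ z))) , λ z → ¬c′ (proj₂ (proj₂ z))) })
      where
      both : ∀ {u v} → Bl.A u v ⊎ Bl.A v u → (l ≡ l × m ≡ m × Bl.A u v) ⊎ (l ≡ l × m ≡ m × Bl.A v u)
      both (inj₁ a) = inj₁ (refl , refl , a)
      both (inj₂ a) = inj₂ (refl , refl , a)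
    e = proj₁ r₃
    p₃ = proj₁ (proj₂ r₃)
    g₃ = proj₁ (proj₂ (proj₂ r₃))
    disjoint : ∀ {x} → x ∈ p₂ → x ∈ p₃ → ⊥
    disjoint x∈ x∈′ with proj₂ (proj₂ (proj₂ r₂)) x∈ | proj₂ (proj₂ (proj₂ r₃)) x∈′
    ... | u , a , refl | b , _ , eq = proper (cpy l u) (blk l m b) (inj₁ (refl , a) , (λ x → x) , (λ x → x)) (sym eq)
    combine : g + ⌈ h /2⌉ ≤ ∣ p₁ ∪ p₂ ∣ ⊎ g + ⌈ h /2⌉ ≤ ∣ p₁ ∪ p₃ ∣ →
      Σ L′ λ l → Σ (Subset k) λ p → g + ⌈ h /2⌉ ≤ ∣ p ∣ × (∀ {x} → x ∈ p → Σ V′ λ u → Al′ u l × c u ≡ x)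
    combine (inj₁ le) = keep l m , p₁ ∪ p₂ , le , λ x∈ → find (x∈p∪q⁻ p₁ p₂ x∈)
      where
      find : ∀ {x} → x ∈ p₁ ⊎ x ∈ p₂ → Σ V′ λ u → Al′ u (keep l m) × c u ≡ x
      find (inj₁ x∈) with proj₂ (proj₂ (proj₂ r₁)) x∈
      ... | u , a , eq = out u , a , eq
      find (inj₂ x∈) with proj₂ (proj₂ (proj₂ r₂)) x∈
      ... | u , a , eq = cpy l u , (refl , a) , eq
    combine (inj₂ le) = drop l m e , p₁ ∪ p₃ , le , λ x∈ → find (x∈p∪q⁻ p₁ p₃ x∈)
      where
      find : ∀ {x} → x ∈ p₁ ⊎ x ∈ p₃ → Σ V′ λ u → Al′ u (drop l m e) × c u ≡ x
      find (inj₁ x∈) with proj₂ (proj₂ (proj₂ r₁)) x∈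
      ... | u , a , eq = out u , a , eq
      find (inj₂ x∈) with proj₂ (proj₂ (proj₂ r₃)) x∈
      ... | b , a , eq = blk l m b , (refl , refl , a) , eq

  -- A clique bound by recursion on neighbourhoods, so that it can be proved by splitting
  -- neighbourhoods into classes.
  Bnd : {V : Set} (E : V → V → Set) → (V → Set) → ℕ → Set
  Bnd E X zero = ∀ v → ¬ X v
  Bnd E X (suc j) = ∀ v → X v → Bnd E (λ u → X u × E v u) j

  Full : {V : Set} → V → Set
  Full _ = ⊤

  bnd-image : ∀ {V V′ : Set} {E : V → V → Set} {E′ : V′ → V′ → Set} (R : V′ → V → Set) → ∀ j {X : V → Set} {X′ : V′ → Set} →
    (∀ x → X′ x → Σ V λ y → X y × R x y) → (∀ {x x′ y y′} → E′ x x′ → R x y → R x′ y′ → E y y′) → Bnd E X j → Bnd E′ X′ j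
  bnd-image R zero f h b x Xx with f x Xx
  ... | y , Xy , _ = b y Xy
  bnd-image R (suc j) f h b x Xx with f x Xx
  ... | y , Xy , r = bnd-image R j (λ { x′ (Xx′ , e) → let y′ , Xy′ , r′ = f x′ Xx′ in y′ , (Xy′ , h e r r′) , r′ }) h (b y Xy)

  bnd-sub : ∀ {V : Set} {E : V → V → Set} j {X Y : V → Set} → (∀ x → Y x → X x) → Bnd E X j → Bnd E Y j
  bnd-sub j sub = bnd-image _≡_ j (λ x Yx → x , sub x Yx , refl) λ { e refl refl → e }

  bnd-separate : ∀ {V : Set} {E : V → V → Set} j {X Y Z : V → Set} → (∀ x → X x → Y x ⊎ Z x) →
    (∀ {y z} → Y y → Z z → ¬ E y z × ¬ E z y) → Bnd E Y j → Bnd E Z j → Bnd E X j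
  bnd-separate zero split sep bY bZ x Xx with split x Xx
  ... | inj₁ Yx = bY x Yx
  ... | inj₂ Zx = bZ x Zx
  bnd-separate {E = E} (suc j) {X} {Y} {Z} split sep bY bZ x Xx with split x Xx
  ... | inj₁ Yx = bnd-sub j onlyY (bY x Yx)
    where
    onlyY : ∀ u → X u × E x u → Y u × E x u
    onlyY u (Xu , e) with split u Xu
    ... | inj₁ Yu = Yu , e
    ... | inj₂ Zu = contradiction e (proj₁ (sep Yx Zu))
  ... | inj₂ Zx = bnd-sub j onlyZ (bZ x Zx)
    where
    onlyZ : ∀ u → X u × E x u → Z u × E x u
    onlyZ u (Xu , e) with split u Xu
    ... | inj₂ Zu = Zu , e
    ... | inj₁ Yu = contradiction e (proj₂ (sep Yu Zx))

  bnd-join : ∀ {V : Set} {E : V → V → Set} j {X Y Z : V → Set} → (∀ x → X x → Y x ⊎ Z x) →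
    (∀ {z z′} → Z z → Z z′ → ¬ E z z′) → Bnd E Y j → Bnd E X (suc j)
  bnd-join {E = E} j {X} {Y} {Z} split indep bY x Xx with split x Xx
  ... | inj₂ Zx = bnd-sub j onlyY bY
    where
    onlyY : ∀ u → X u × E x u → Y u
    onlyY u (Xu , e) with split u Xu
    ... | inj₁ Yu = Yu
    ... | inj₂ Zu = contradiction e (indep Zx Zu)
  bnd-join zero split indep bY x Xx | inj₁ Yx = contradiction Yx (bY x)
  bnd-join {E = E} (suc j) {X} {Y} {Z} split indep bY x Xx | inj₁ Yx = bnd-join j both indep (bY x Yx)
    where
    both : ∀ u → X u × E x u → (Y u × E x u) ⊎ Z u
    both u (Xu , e) with split u Xu
    ... | inj₁ Yu = inj₁ (Yu , e)
    ... | inj₂ Zu = inj₂ Zu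

  bnd-clique : ∀ {V : Set} {E : V → V → Set} j {X : V → Set} → Bnd E X j → ∀ m (f : Fin m → V) → (∀ i → X (f i)) →
    (∀ i i′ → i ≢ i′ → E (f i) (f i′)) → m ≤ j
  bnd-clique j b zero f _ _ = z≤n
  bnd-clique zero b (suc m) f Xf _ = contradiction (Xf zero) (b (f zero))
  bnd-clique (suc j) b (suc m) f Xf Ef = s≤s (bnd-clique j (b (f zero) (Xf zero)) m (λ i → f (suc i))
    (λ i → Xf (suc i) , Ef zero (suc i) λ ()) (λ i i′ ne → Ef (suc i) (suc i′) λ { refl → ne refl }))

  -- Neighbours of a copy member are copy members or members of `B` played across it. The two kinds
  -- do not overlap, since what is alive at one end is a chain. A member of `B` meets, besides `B`,
  -- just such a chain, which adds one to a clique.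
  compose-bnd : ∀ P B w → Bnd (Scene.O P) Full (suc w) → Bnd (Scene.O B) Full w → Bnd (Scene.O (Compose.scene′ P B)) Full (suc w)
  compose-bnd P B w bP bB = go
    where
    open Compose P B
    open Scene P
    O′ : V′ → V′ → Set
    O′ = Scene.O scene′
    out-out : ∀ {u x} → O′ (out u) x → Σ V λ y → x ≡ out y × O u y
    out-out {u} {out y} o = y , refl , o
    out-out {u} {cpy l y} (inj₁ a , ¬c , _) = contradiction a ¬c
    out-out {u} {blk l m b} (inj₁ a , ¬c , _) = contradiction a ¬c
    cpy-O : ∀ {l u v} → O′ (cpy l u) (cpy l v) → O u v
    cpy-O (a , ¬c , ¬c′) = either a , (λ c → ¬c (refl , c)) , λ c → ¬c′ (refl , c)
      where
      either : ∀ {l l′ u v} → (l ≡ l′ × A u v) ⊎ (l′ ≡ l × A v u) → A u v ⊎ A v u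
      either (inj₁ (_ , a)) = inj₁ a
      either (inj₂ (_ , a)) = inj₂ a
    cpy-same : ∀ {l l′ u v} → O′ (cpy l u) (cpy l′ v) → l ≡ l′
    cpy-same (inj₁ (eq , _) , _) = eq
    cpy-same (inj₂ (eq , _) , _) = sym eq
    blk-same : ∀ {l l′ m m′ b b′} → O′ (blk l m b) (blk l′ m′ b′) → l ≡ l′ × m ≡ m′ × Bl.O b b′
    blk-same (inj₁ (refl , refl , a) , ¬c , ¬c′) = refl , refl , inj₁ a , (λ c → ¬c (refl , refl , c)) , λ c → ¬c′ (refl , refl , c)
    blk-same (inj₂ (refl , refl , a) , ¬c , ¬c′) = refl , refl , inj₂ a , (λ c → ¬c (refl , refl , c)) , λ c → ¬c′ (refl , refl , c)
    no-chain : ∀ {u v m} → Al u m → Al v m → ¬ O u v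
    no-chain a a′ (_ , ¬c , ¬c′) with Al-chain a a′
    ... | inj₁ c = ¬c c
    ... | inj₂ c = ¬c′ c
    Out : V′ → V → Set
    Out x y = x ≡ out y
    Cpy : L → V′ → V → Set
    Cpy l x y = x ≡ cpy l y
    Blk : V′ → Bl.V → Set
    Blk x b = Σ L λ l → Σ L λ m → x ≡ blk l m b
    CpyNext : L → V → V′ → Set
    CpyNext l u x = Σ V λ y → x ≡ cpy l y × O u y
    BlkOver : L → V → V′ → Set
    BlkOver l u x = Σ L λ m → Σ Bl.V λ b → x ≡ blk l m b × Al u m
    BlkNext : L → L → Bl.V → V′ → Set
    BlkNext l m b x = Σ Bl.V λ b′ → x ≡ blk l m b′ × Bl.O b b′
    CpyAt : L → L → V′ → Set
    CpyAt l m x = Σ V λ u → x ≡ cpy l u × Al u m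
    cpy-split : ∀ l u x → O′ (cpy l u) x → CpyNext l u x ⊎ BlkOver l u x
    cpy-split l u (out y) (inj₂ a , _ , ¬c) = contradiction a ¬c
    cpy-split l u (cpy l′ y) o with cpy-same {l} {l′} {u} {y} o
    ... | refl = inj₁ (y , refl , cpy-O o)
    cpy-split l u (blk l′ m b) (inj₁ (refl , al) , _) = inj₂ (m , b , refl , al)
    cpy-sep : ∀ {l u y z} → CpyNext l u y → BlkOver l u z → ¬ O′ y z × ¬ O′ z y
    cpy-sep (y , refl , o) (m , b , refl , al) =
      (λ { (inj₁ (_ , al′) , _) → no-chain al al′ o ; (inj₂ () , _) }) , λ { (inj₂ (_ , al′) , _) → no-chain al al′ o ; (inj₁ () , _) }
    blk-split : ∀ l m b x → O′ (blk l m b) x → BlkNext l m b x ⊎ CpyAt l m x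
    blk-split l m b (out y) (inj₂ a , _ , ¬c) = contradiction a ¬c
    blk-split l m b (cpy l′ y) (inj₂ (refl , al) , _) = inj₂ (y , refl , al)
    blk-split l m b (blk l′ m′ b′) o with blk-same {l} {l′} {m} {m′} {b} {b′} o
    ... | refl , refl , o′ = inj₁ (b′ , refl , o′)
    cpy-indep : ∀ {l m z z′} → CpyAt l m z → CpyAt l m z′ → ¬ O′ z z′
    cpy-indep (u , refl , al) (u′ , refl , al′) o = no-chain al al′ (cpy-O o)
    blk-O : ∀ {x x′ b b′} → O′ x x′ → Blk x b → Blk x′ b′ → Bl.O b b′
    blk-O {b = b} {b′} o (l , m , refl) (l′ , m′ , refl) = proj₂ (proj₂ (blk-same {l} {l′} {m} {m′} {b} {b′} o))
    blk-join : ∀ l m b w → Bnd Bl.O Full w → Bnd O′ (λ x → ⊤ × O′ (blk l m b) x) w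
    blk-join l m b zero bB = contradiction tt (bB b)
    blk-join l m b (suc w) bB = bnd-join w {Y = BlkNext l m b} {Z = CpyAt l m} (λ x Xx → blk-split l m b x (proj₂ Xx)) cpy-indep
      (bnd-image Blk w (λ { x (b′ , eq , o) → b′ , (tt , o) , l , m , eq }) blk-O (bB b tt))
    go : Bnd O′ Full (suc w)
    go (out u) _ = bnd-image Out w (λ x Xx → let y , eq , o = out-out {u} {x} (proj₂ Xx) in y , (tt , o) , eq) (λ { o refl refl → o }) (bP u tt)
    go (cpy l u) _ = bnd-separate w {Y = CpyNext l u} {Z = BlkOver l u} (λ x Xx → cpy-split l u x (proj₂ Xx)) cpy-sep
      (bnd-image (Cpy l) w (λ { x (y , eq , o) → y , (tt , o) , eq }) (λ { o refl refl → cpy-O o }) (bP u tt))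
      (bnd-image Blk w (λ { x (m , b , eq , _) → b , tt , l , m , eq }) blk-O bB)
    go (blk l m b) _ = blk-join l m b w bB

  -- `w` bounds the clique number and `i` is the depth of the composition.
  scene : ℕ → ℕ → Scene
  scene zero i = emptyScene
  scene (suc w) zero = singleScene
  scene (suc w) (suc i) = Compose.scene′ (scene (suc w) i) (scene w i)

  force : ℕ → ℕ → ℕ
  force zero i = 0
  force (suc w) zero = 1
  force (suc w) (suc i) = force (suc w) i + ⌈ force w i /2⌉

  scene-forces : ∀ w i → Forces (scene w i) (force w i)
  scene-forces zero i {k} c _ = tt , ∅ , z≤n , λ x∈ → contradiction x∈ ∉⊥
  scene-forces (suc w) zero c _ = tt , single (c tt) , ≤-reflexive (sym (∣⁅x⁆∣≡1 (c tt))) , λ x∈ → tt , tt , sym (x∈⁅y⁆⇒x≡y _ x∈)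
  scene-forces (suc w) (suc i) = compose-forces (scene (suc w) i) (scene w i) (scene-forces (suc w) i) (scene-forces w i)

  scene-bnd : ∀ w i → Bnd (Scene.O (scene w i)) Full w
  scene-bnd zero i ()
  scene-bnd (suc w) zero v _ = bnd-none w λ { u (_ , (_ , ¬c , _)) → ¬c tt }
    where
    bnd-none : ∀ j {X : ⊤ → Set} → (∀ v → ¬ X v) → Bnd (Scene.O singleScene) X j
    bnd-none zero h = h
    bnd-none (suc j) h v Xv = contradiction Xv (h v)
  scene-bnd (suc w) (suc i) = compose-bnd (scene (suc w) i) (scene w i) w (scene-bnd (suc w) i) (scene-bnd w i)

  alive : ∀ w i → Σ (Scene.L (scene (suc w) i)) λ l → Σ (Scene.V (scene (suc w) i)) λ u → Scene.Al (scene (suc w) i) u l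
  alive w zero = tt , tt , tt
  alive w (suc i) with alive w i
  ... | l , u , a = (l , l , inj₁ tt) , inj₁ u , a

  -- A clique of the inner scene, played across a living copy member, gains that member. This takes
  -- one level of composition per vertex after the first, hence `w ≤ i`.
  scene-clique : ∀ w i → w ≤ i → Σ (Fin (suc w) → Scene.V (scene (suc w) i)) λ f → ∀ a b → a ≢ b → Scene.O (scene (suc w) i) (f a) (f b)
  scene-clique zero i _ = (λ _ → proj₁ (proj₂ (alive zero i))) , λ { zero zero ne → contradiction refl ne }
  scene-clique (suc w) (suc i) (s≤s le) with scene-clique w i le | alive (suc w) i
  ... | f , h | l , u , a = f′ , h′
    where
    S = Compose.scene′ (scene (suc (suc w)) i) (scene (suc w) i)
    f′ : Fin (suc (suc w)) → Scene.V S
    f′ zero = inj₂ (l , inj₁ u)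
    f′ (suc j) = inj₂ (l , inj₂ (l , f j))
    hit : ∀ j → Scene.O S (f′ zero) (f′ (suc j))
    hit j = inj₁ (refl , a) , (λ x → x) , λ x → x
    lift : ∀ {b b′} → Scene.O (scene (suc w) i) b b′ → Scene.O S (inj₂ (l , inj₂ (l , b))) (inj₂ (l , inj₂ (l , b′)))
    lift (inj₁ a , ¬c , ¬c′) = inj₁ (refl , refl , a) , (λ z → ¬c (proj₂ (proj₂ z))) , λ z → ¬c′ (proj₂ (proj₂ z))
    lift (inj₂ a , ¬c , ¬c′) = inj₂ (refl , refl , a) , (λ z → ¬c (proj₂ (proj₂ z))) , λ z → ¬c′ (proj₂ (proj₂ z))
    h′ : ∀ x y → x ≢ y → Scene.O S (f′ x) (f′ y)
    h′ zero zero ne = contradiction refl ne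
    h′ zero (suc j) _ = hit j
    h′ (suc j) zero _ = inj₂ (refl , a) , (λ x → x) , λ x → x
    h′ (suc j) (suc j′) ne = lift (h j j′ λ { refl → ne refl })

-- Scenes as subtree families, and their size against the forced colours.

module LowerBounds where

  open import Defs renaming (sym to Adj-sym; irrefl to Adj-irrefl)
  open import Data.Nat using (⌈_/2⌉)
  open import Data.Nat.Logarithm using (⌊log₂_⌋; ⌊log₂⌋-mono-≤; ⌊log₂[2^n]⌋≡n)
  open import Data.Nat.Solver using (module +-*-Solver)
  open +-*-Solver using (solve; _:+_; _:*_; _:=_; con)
  open import Data.Fin using (fromℕ; inject₁; fromℕ<)
  open import Data.Fin.Properties using (toℕ-fromℕ; toℕ-fromℕ<; toℕ-inject₁; +↔⊎; *↔×; 0↔⊥; 1↔⊤)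
  open import Data.Fin.Subset using (Subset; _∈_; _⊆_)
  open import Data.Fin.Subset.Properties using (∈⊤; ∣p∣≤n)
  open import Data.Vec using (tabulate)
  open import Data.Vec.Properties using ([]=⇒lookup; lookup⇒[]=; lookup∘tabulate)
  open import Data.Product.Function.NonDependent.Propositional using (_×-↔_)
  open import Data.Sum.Function.Propositional using (_⊎-↔_)
  open import Data.Unit using (⊤; tt)
  open import Data.Maybe using (just; nothing; maybe′)
  open import Function.Bundles using (_↔_; Inverse)
  open import Function.Construct.Composition using (_↔-∘_)
  open import Relation.Nullary.Decidable using (dec-true)
  open Finite
  open SubtreeFamilies
  open StringCurves
  open Scenes

  module ParentTree {m : ℕ} (root : Fin m) (par : Fin m → Fin m) (dep : Fin m → ℕ) (down : ∀ {x} → x ≢ root → dep (par x) < dep x) where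

    Edge : Fin m → Fin m → Set
    Edge x y = (x ≢ root × par x ≡ y) ⊎ (y ≢ root × par y ≡ x)

    edge-sym : ∀ {x y} → Edge x y → Edge y x
    edge-sym (inj₁ h) = inj₂ h
    edge-sym (inj₂ h) = inj₁ h

    edge-irrefl : ∀ {x} → ¬ Edge x x
    edge-irrefl {x} (inj₁ (ne , eq)) = <-irrefl (cong dep eq) (down ne)
    edge-irrefl {x} (inj₂ (ne , eq)) = <-irrefl (cong dep eq) (down ne)

    graph : Graph
    graph = record { n = m ; Adj = Edge ; sym = edge-sym ; irrefl = edge-irrefl }

    walk-++ : ∀ {S x y z} → WalkIn graph S x y → WalkIn graph S y z → WalkIn graph S x z
    walk-++ (here _) w = w
    walk-++ (step x∈ e w) w′ = step x∈ e (walk-++ w w′)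

    walk-reverse : ∀ {S x y} → WalkIn graph S x y → WalkIn graph S y x
    walk-reverse (here x∈) = here x∈
    walk-reverse (step x∈ e w) = walk-++ (walk-reverse w) (step (start w) (edge-sym e) (here x∈))
      where
      start : ∀ {S x y} → WalkIn graph S x y → x ∈ S
      start (here x∈) = x∈
      start (step x∈ _ _) = x∈

    connected : ∀ S ρ → ρ ∈ S → (∀ {x} → x ∈ S → x ≢ ρ → x ≢ root × par x ∈ S) → ConnectedIn graph S
    connected S ρ ρ∈ closed u v u∈ v∈ = walk-++ (climb u (<-wellFounded _) u∈) (walk-reverse (climb v (<-wellFounded _) v∈))
      where
      climb : ∀ x → Acc _<_ (dep x) → x ∈ S → WalkIn graph S x ρ
      climb x (acc rec) x∈ with x ≟ᶠ ρ
      ... | yes refl = here x∈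
      ... | no ne with closed x∈ ne
      ...   | nr , p∈ = step x∈ (inj₁ (nr , refl)) (climb (par x) (rec (down nr)) p∈)

    only-parent : ∀ {x y} → Edge x y → dep y ≤ dep x → par x ≡ y
    only-parent (inj₁ (_ , eq)) _ = eq
    only-parent (inj₂ (ne , refl)) le = contradiction le (<⇒≱ (down ne))

    -- The two neighbours of the deepest vertex of a cycle would both be its parent.
    acyclic : ¬ HasCycle graph
    acyclic (k , f , inj , next , close) with largest {P = λ _ → ⊤} (λ _ → yes tt) (λ i → dep (f i))
    ... | inj₂ none = none zero tt
    ... | inj₁ (i , _ , top) = two i top
      where
      both : ∀ i p q → p ≢ q → (∀ j → ⊤ → dep (f j) ≤ dep (f i)) → Edge (f i) (f p) → Edge (f i) (f q) → ⊥
      both i p q ne top e e′ = ne (inj p q (trans (sym (only-parent e (top p tt))) (only-parent e′ (top q tt))))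
      two : ∀ i → (∀ j → ⊤ → dep (f j) ≤ dep (f i)) → ⊥
      two zero top = both zero (fromℕ (2 + k)) (suc zero) (λ ()) top (edge-sym close) (next zero (suc zero) refl)
      -- On the cycle the last index `2 + k` is followed by `zero`.
      two (suc i) top with toℕ i Data.Nat.≟ suc k
      ... | yes eq = both (suc i) (inject₁ i) zero (λ e → 0≢ (trans (sym eq) (trans (sym (toℕ-inject₁ i)) (cong toℕ e)))) top
            (edge-sym (next (inject₁ i) (suc i) (cong suc (toℕ-inject₁ i))))
            (subst (λ j → Edge (f j) (f zero)) (toℕ-injective (trans (toℕ-fromℕ (2 + k)) (cong suc (sym eq)))) close)
        where
        0≢ : suc k ≢ 0
        0≢ ()
      ... | no ne = both (suc i) (inject₁ i) (suc (fromℕ< lt)) (λ e → <⇒≢ (m<n+m (toℕ i) (s≤s z≤n)) (trans (sym (toℕ-inject₁ i)) (trans (cong toℕ e) (cong suc (toℕ-fromℕ< lt))))) top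
            (edge-sym (next (inject₁ i) (suc i) (cong suc (toℕ-inject₁ i))))
            (next (suc i) (suc (fromℕ< lt)) (cong suc (sym (toℕ-fromℕ< lt))))
        where
        lt : suc (toℕ i) < suc (suc k)
        lt = s≤s (≤∧≢⇒< (s≤s⁻¹ (toℕ<n i)) ne)

    isTree : IsTree graph
    isTree = (root , ∈⊤) , connected _ root ∈⊤ (λ _ ne → ne , ∈⊤) , acyclic

  module Decide {m : ℕ} {P : Fin m → Set} (P? : ∀ x → Dec (P x)) where

    decide : Subset m
    decide = tabulate λ x → does (P? x)

    ∈-decide : ∀ {x} → P x → x ∈ decide
    ∈-decide {x} p = lookup⇒[]= x decide (trans (lookup∘tabulate (λ x → does (P? x)) x) (dec-true (P? x) p))

    decide-∈ : ∀ {x} → x ∈ decide → P x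
    decide-∈ {x} x∈ with P? x | trans (sym (lookup∘tabulate (λ x → does (P? x)) x)) ([]=⇒lookup x∈)
    ... | yes p | _ = p
    ... | no _ | ()

  -- The subtree of u has a node for every member arriving while u is alive, and a leaf for every member inside u;
  -- the leaves keep overlapping members from containing each other.
  module Realise (S : Scene) {k : ℕ} (φ : Fin k ↔ Scene.V S) where
    open Scene S

    pattern hub = inj₁ tt
    pattern node v = inj₂ (inj₁ v)
    pattern leaf v = inj₂ (inj₂ v)

    N : Set
    N = ⊤ ⊎ (V ⊎ V)

    index : Fin (1 + (k + k)) ↔ N
    index = (1↔⊤ ⊎-↔ ((φ ⊎-↔ φ) ↔-∘ +↔⊎)) ↔-∘ +↔⊎

    open Inverse index using () renaming (to to name; from to code; strictlyInverseˡ to name-code; strictlyInverseʳ to code-name)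
    open Inverse φ using () renaming (to to mem; from to num; strictlyInverseˡ to mem-num; strictlyInverseʳ to num-mem)

    parᴺ : N → N
    parᴺ hub = hub
    parᴺ (node v) = maybe′ (λ p → node p) hub (prev v)
    parᴺ (leaf v) = node v

    depᴺ : N → ℕ
    depᴺ hub = 0
    depᴺ (node v) = suc (dep v)
    depᴺ (leaf v) = suc (suc (dep v))

    downᴺ : ∀ x → x ≢ hub → depᴺ (parᴺ x) < depᴺ x
    downᴺ hub ne = contradiction refl ne
    downᴺ (node v) _ with prev v in eq
    ... | just p = s≤s (prev-dep eq)
    ... | nothing = s≤s z≤n
    downᴺ (leaf v) _ = ≤-refl

    root : Fin (1 + (k + k))
    root = code hub

    par : Fin (1 + (k + k)) → Fin (1 + (k + k))
    par x = code (parᴺ (name x))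

    name-root : ∀ {x} → name x ≡ hub → x ≡ root
    name-root {x} eq = trans (sym (code-name x)) (cong code eq)

    down : ∀ {x} → x ≢ root → depᴺ (name (par x)) < depᴺ (name x)
    down {x} ne = subst (λ y → depᴺ y < depᴺ (name x)) (sym (name-code (parᴺ (name x)))) (downᴺ (name x) λ eq → ne (name-root eq))

    open ParentTree root par (λ x → depᴺ (name x)) down using (graph; isTree; connected)

    Mem : V → N → Set
    Mem u hub = ⊥
    Mem u (node v) = A u v
    Mem u (leaf v) = C u v

    mem? : ∀ u x → Dec (Mem u x)
    mem? u hub = no λ x → x
    mem? u (node v) = A? u v
    mem? u (leaf v) = C? u v

    module D (u : V) = Decide (λ x → mem? u (name x))

    μ′ : V → Subset (1 + (k + k))
    μ′ u = D.decide u

    μ-in : ∀ {u} y → Mem u y → code y ∈ μ′ u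
    μ-in {u} y h = D.∈-decide u (subst (Mem u) (sym (name-code y)) h)

    μ-out : ∀ {u} y → code y ∈ μ′ u → Mem u y
    μ-out {u} y y∈ = subst (Mem u) (name-code y) (D.decide-∈ u y∈)

    memᴺ-closed : ∀ {u} y → Mem u y → y ≢ node u → Mem u (parᴺ y)
    memᴺ-closed {u} (node v) a ne with A-prev a
    ... | inj₁ refl = contradiction refl ne
    ... | inj₂ (p , eq , a′) = subst (λ mp → Mem u (maybe′ (λ p → node p) hub mp)) (sym eq) a′
    memᴺ-closed (leaf v) c _ = C⇒A c

    closed : ∀ u {x} → x ∈ μ′ u → x ≢ code (node u) → x ≢ root × par x ∈ μ′ u
    closed u {x} x∈ ne = (λ { refl → subst (Mem u) (name-code hub) (D.decide-∈ u x∈) }) ,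
      μ-in (parᴺ (name x)) (memᴺ-closed (name x) (D.decide-∈ u x∈) λ eq → ne (trans (sym (code-name x)) (cong code eq)))

    top∈ : ∀ u → code (node u) ∈ μ′ u
    top∈ u = μ-in (node u) A-refl

    subtree : ∀ u → IsSubtree graph (μ′ u)
    subtree u = (code (node u) , top∈ u) , connected (μ′ u) (code (node u)) (top∈ u) (closed u)

    C⇒⊆ : ∀ {u v} → C u v → μ′ v ⊆ μ′ u
    C⇒⊆ {u} {v} c {x} x∈ = D.∈-decide u (by (name x) (D.decide-∈ v x∈))
      where
      by : ∀ y → Mem v y → Mem u y
      by (node w) a = C-A c a
      by (leaf w) d = C-C c d

    ⊆⇒C : ∀ {u v} → μ′ v ⊆ μ′ u → C u v
    ⊆⇒C {u} {v} h = μ-out (leaf v) (h (μ-in (leaf v) C-refl))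

    -- Going back along `prev`, both members remain alive until one of them is reached.
    meet : ∀ {u v} w → Acc _<_ (dep w) → A u w → A v w → A u v ⊎ A v u
    meet w (acc rec) a b with A-prev a | A-prev b
    ... | inj₁ refl | _ = inj₂ b
    ... | inj₂ _ | inj₁ refl = inj₁ a
    ... | inj₂ (p , eq , a′) | inj₂ (q , eq′ , b′) with trans (sym eq) eq′
    ...   | refl = meet p (rec (prev-dep eq)) a′ b′

    overlap⇒O : ∀ {u v} → Overlap (μ′ u) (μ′ v) → O u v
    overlap⇒O {u} {v} ((x , xu , xv) , ¬uv , ¬vu) = by (name x) (D.decide-∈ u xu) (D.decide-∈ v xv) , (λ c → ¬vu (C⇒⊆ c)) , λ c → ¬uv (C⇒⊆ c)
      where
      by : ∀ y → Mem u y → Mem v y → A u v ⊎ A v u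
      by (node w) a b = meet w (<-wellFounded _) a b
      by (leaf w) a b = meet w (<-wellFounded _) (C⇒A a) (C⇒A b)

    O⇒overlap : ∀ {u v} → O u v → Overlap (μ′ u) (μ′ v)
    O⇒overlap {u} {v} (a , ¬c , ¬c′) = common a , (λ h → ¬c′ (⊆⇒C h)) , λ h → ¬c (⊆⇒C h)
      where
      common : A u v ⊎ A v u → ∃ λ x → x ∈ μ′ u × x ∈ μ′ v
      common (inj₁ a) = code (node v) , μ-in (node v) a , top∈ v
      common (inj₂ a) = code (node u) , top∈ u , μ-in (node u) a

    μ : Fin k → Subset (1 + (k + k))
    μ i = μ′ (mem i)

    G : Graph
    G = record { n = k ; Adj = λ i j → Overlap (μ i) (μ j) ; sym = overlap-sym ; irrefl = λ o → proj₁ (proj₂ o) (λ x∈ → x∈) }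

    mem-injective : ∀ {i j} → mem i ≡ mem j → i ≡ j
    mem-injective {i} {j} eq = trans (sym (num-mem i)) (trans (cong num eq) (num-mem j))

    clean : IsCleanSubtreeOverlapGraph G
    clean = graph , isTree , μ , (λ i → subtree (mem i)) ,
      ((λ i j eq → mem-injective (C-antisym (⊆⇒C (subst (μ j ⊆_) (sym eq) (λ x∈ → x∈))) (⊆⇒C (subst (_⊆ μ j) (sym eq) (λ x∈ → x∈))))) ,
       (λ i j → (λ o → o) , λ o → o)) ,
      λ i j w o c c′ → no-pair (overlap⇒O o) (C-chain (⊆⇒C c) (⊆⇒C c′))
      where
      no-pair : ∀ {u v} → O u v → C u v ⊎ C v u → ⊥
      no-pair (_ , ¬c , _) (inj₁ c) = ¬c c
      no-pair (_ , _ , ¬c) (inj₂ c) = ¬c c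

    cliqueNumber≤ : ∀ {w} → Bnd O Full w → CliqueNumber≤ G w
    cliqueNumber≤ {w} b m f (_ , adj) = bnd-clique w b m (λ i → mem (f i)) (λ _ → tt) λ i j ne → overlap⇒O (adj i j ne)

    clique : ∀ {w} → (Σ (Fin w → V) λ f → ∀ a b → a ≢ b → O (f a) (f b)) → Σ (Fin w → Fin k) (IsClique G w)
    clique (f , h) = (λ i → num (f i)) , inj , adj
      where
      adj : ∀ i j → i ≢ j → Overlap (μ (num (f i))) (μ (num (f j)))
      adj i j ne = subst (λ x → Overlap (μ′ x) (μ (num (f j)))) (sym (mem-num (f i)))
        (subst (λ y → Overlap (μ′ (f i)) (μ′ y)) (sym (mem-num (f j))) (O⇒overlap (h i j ne)))
      inj : ∀ i j → num (f i) ≡ num (f j) → i ≡ j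
      inj i j eq with i ≟ᶠ j
      ... | yes e = e
      ... | no ne = contradiction (λ {x} x∈ → subst (λ a → x ∈ μ a) eq x∈) (proj₁ (proj₂ (adj i j ne)))

    colours≥ : ∀ {g q} → Forces S g → Colourable G q → g ≤ q
    colours≥ f (c , h) with f (λ v → c (num v)) (λ u v o → h (num u) (num v)
        (subst (λ x → Overlap (μ′ x) (μ (num v))) (sym (mem-num u)) (subst (λ y → Overlap (μ′ u) (μ′ y)) (sym (mem-num v)) (O⇒overlap o))))
    ... | _ , p , le , _ = ≤-trans le (∣p∣≤n p)

  members ends : ℕ → ℕ → ℕ
  members zero i = 0
  members (suc w) zero = 1
  members (suc w) (suc i) = members (suc w) i + ends (suc w) i * (members (suc w) i + ends (suc w) i * members w i)
  ends zero i = 1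
  ends (suc w) zero = 1
  ends (suc w) (suc i) = ends (suc w) i * (ends (suc w) i * (1 + ends w i))

  endIndex : ∀ w i → Fin (ends w i) ↔ Scene.L (scene w i)
  endIndex zero i = 1↔⊤
  endIndex (suc w) zero = 1↔⊤
  endIndex (suc w) (suc i) = (endIndex (suc w) i ×-↔ ((endIndex (suc w) i ×-↔ ((1↔⊤ ⊎-↔ endIndex w i) ↔-∘ +↔⊎)) ↔-∘ *↔×)) ↔-∘ *↔×

  memberIndex : ∀ w i → Fin (members w i) ↔ Scene.V (scene w i)
  memberIndex zero i = 0↔⊥
  memberIndex (suc w) zero = 1↔⊤
  memberIndex (suc w) (suc i) = (memberIndex (suc w) i ⊎-↔ ((endIndex (suc w) i ×-↔ ((memberIndex (suc w) i ⊎-↔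
    ((endIndex (suc w) i ×-↔ memberIndex w i) ↔-∘ *↔×)) ↔-∘ +↔⊎)) ↔-∘ *↔×)) ↔-∘ +↔⊎

  -- Starts at 4 and is raised to the fourth power with each `i`: the recursions of `members` and
  -- `ends` have degree 3, and the fourth factor absorbs their coefficients.
  big : ℕ → ℕ
  big i = 2 ^ (2 ^ (1 + i + i))

  big-suc : ∀ i → big (suc i) ≡ big i ^ 4
  big-suc i = trans (cong (λ e → 2 ^ (2 ^ suc (suc e))) (+-suc i i))
    (trans (cong (2 ^_) (solve 1 (λ x → con 2 :* (con 2 :* x) := x :* con 4) refl (2 ^ (1 + i + i)))) (sym (^-*-assoc 2 (2 ^ (1 + i + i)) 4)))

  big≥4 : ∀ i → 4 ≤ big i
  big≥4 i = ^-monoʳ-≤ 2 {2} {2 ^ (1 + i + i)} (^-monoʳ-≤ 2 {1} {1 + i + i} (s≤s z≤n))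

  module _ {M : ℕ} (le : 4 ≤ M) where

    private
      one : 1 ≤ M
      one = ≤-trans (s≤s z≤n) le
      M³ : ℕ
      M³ = M * (M * M)
      lift : ∀ x → x ≤ M * x
      lift x = ≤-trans (≤-reflexive (sym (*-identityˡ x))) (*-monoˡ-≤ x one)
      M≤M³ : M ≤ M³
      M≤M³ = ≤-trans (lift M) (lift (M * M))
      4M³ : M³ + (M³ + M³) ≤ M ^ 4
      4M³ = ≤-trans (≤-trans (≤-reflexive (solve 1 (λ x → x :+ (x :+ x) := con 3 :* x) refl M³)) (*-monoˡ-≤ M³ (≤-trans (n≤1+n 3) le)))
        (≤-reflexive (solve 1 (λ m → m :* (m :* (m :* m)) := m :* (m :* (m :* (m :* con 1)))) refl M))

    members-step : ∀ {a b c} → a ≤ M → b ≤ M → c ≤ M → a + b * (a + b * c) ≤ M ^ 4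
    members-step {a} {b} {c} a≤ b≤ c≤ = begin
      a + b * (a + b * c) ≤⟨ +-mono-≤ a≤ (*-mono-≤ b≤ (+-mono-≤ a≤ (*-mono-≤ b≤ c≤))) ⟩
      M + M * (M + M * M) ≡⟨ cong (M +_) (*-distribˡ-+ M M (M * M)) ⟩
      M + (M * M + M³) ≤⟨ +-mono-≤ M≤M³ (+-monoˡ-≤ M³ (lift (M * M))) ⟩
      M³ + (M³ + M³) ≤⟨ 4M³ ⟩
      M ^ 4 ∎
      where open ≤-Reasoning

    ends-step : ∀ {b d} → b ≤ M → d ≤ M → b * (b * (1 + d)) ≤ M ^ 4
    ends-step {b} {d} b≤ d≤ = begin
      b * (b * (1 + d)) ≤⟨ *-mono-≤ b≤ (*-mono-≤ b≤ (s≤s d≤)) ⟩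
      M * (M * (1 + M)) ≡⟨ cong (M *_) (*-suc M M) ⟩
      M * (M + M * M) ≡⟨ *-distribˡ-+ M M (M * M) ⟩
      M * M + M³ ≤⟨ +-mono-≤ (lift (M * M)) (m≤m+n M³ M³) ⟩
      M³ + (M³ + M³) ≤⟨ 4M³ ⟩
      M ^ 4 ∎
      where open ≤-Reasoning

  ends≤ : ∀ w i → ends w i ≤ big i
  ends≤ zero i = ≤-trans (s≤s z≤n) (big≥4 i)
  ends≤ (suc w) zero = s≤s z≤n
  ends≤ (suc w) (suc i) = ≤-trans (ends-step (big≥4 i) (ends≤ (suc w) i) (ends≤ w i)) (≤-reflexive (sym (big-suc i)))

  members≤ : ∀ w i → members w i ≤ big i
  members≤ zero i = z≤n
  members≤ (suc w) zero = s≤s z≤n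
  members≤ (suc w) (suc i) = ≤-trans (members-step (big≥4 i) (members≤ (suc w) i) (ends≤ (suc w) i) (members≤ w i)) (≤-reflexive (sym (big-suc i)))

  ends-pos : ∀ w i → 1 ≤ ends w i
  ends-pos zero i = ≤-refl
  ends-pos (suc w) zero = ≤-refl
  ends-pos (suc w) (suc i) = *-mono-≤ (ends-pos (suc w) i) (*-mono-≤ (ends-pos (suc w) i) (s≤s z≤n))

  members≥ : ∀ w i → suc i ≤ members (suc w) i
  members≥ w zero = ≤-refl
  members≥ w (suc i) = begin
    suc (suc i) ≡⟨ +-comm 1 (suc i) ⟩
    suc i + 1 ≤⟨ +-mono-≤ (members≥ w i) (*-mono-≤ (ends-pos (suc w) i) (≤-trans (≤-trans (s≤s z≤n) (members≥ w i)) (m≤m+n (members (suc w) i) _))) ⟩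
    members (suc w) i + ends (suc w) i * (members (suc w) i + ends (suc w) i * members w i) ∎
    where open ≤-Reasoning

  loglog≤ : ∀ w i → loglog (members w i) ≤ 1 + i + i
  loglog≤ w i = ≤-trans (⌊log₂⌋-mono-≤ (⌊log₂⌋-mono-≤ (members≤ w i)))
    (≤-reflexive (trans (cong ⌊log₂_⌋ (⌊log₂[2^n]⌋≡n (2 ^ (1 + i + i)))) (⌊log₂[2^n]⌋≡n (1 + i + i))))

  force-mono : ∀ w i t → force (suc w) i ≤ force (suc w) (i + t)
  force-mono w i zero = ≤-reflexive (cong (force (suc w)) (sym (+-identityʳ i)))
  force-mono w i (suc t) = ≤-trans (force-mono w i t) (≤-trans (m≤m+n _ _) (≤-reflexive (cong (force (suc w)) (sym (+-suc i t)))))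

  -- Each of `t` further compositions gains at least half of `force (suc w) i`; doubling clears the
  -- halves.
  force-sum : ∀ w i t → t * force (suc w) i ≤ force (suc (suc w)) (i + t) + force (suc (suc w)) (i + t)
  force-sum w i zero = z≤n
  force-sum w i (suc t) = begin
    force (suc w) i + t * force (suc w) i ≤⟨ +-mono-≤ (≤-trans (force-mono w i t) (half-lower (force (suc w) (i + t)))) (force-sum w i t) ⟩
    (h + h) + (g + g) ≡⟨ solve 2 (λ h g → (h :+ h) :+ (g :+ g) := (g :+ h) :+ (g :+ h)) refl h g ⟩
    (g + h) + (g + h) ≡⟨ cong (λ j → force (suc (suc w)) j + force (suc (suc w)) j) (sym (+-suc i t)) ⟩
    force (suc (suc w)) (i + suc t) + force (suc (suc w)) (i + suc t) ∎
    where
    open ≤-Reasoning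
    h = ⌈ force (suc w) (i + t) /2⌉
    g = force (suc (suc w)) (i + t)

  force-zero : ∀ i → 1 ≤ force 1 i
  force-zero zero = ≤-refl
  force-zero (suc i) = ≤-trans (force-zero i) (m≤m+n _ _)

  -- Of the `2 ^ suc w * j` compositions, the first half raises the force for the smaller clique
  -- number, and each one in the second half gains at least half of that.
  force-power : ∀ w j → j ^ w ≤ 2 ^ w * force (suc w) (2 ^ w * j)
  force-power zero j = ≤-trans (force-zero (1 * j)) (≤-reflexive (sym (*-identityˡ _)))
  force-power (suc w) j = begin
    j * j ^ w ≤⟨ *-monoʳ-≤ j (force-power w j) ⟩
    j * (2 ^ w * f) ≤⟨ *-monoˡ-≤ (2 ^ w * f) (≤-trans (≤-reflexive (sym (*-identityˡ j))) (*-monoˡ-≤ j (m^n>0 2 w))) ⟩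
    i * (2 ^ w * f) ≡⟨ solve 3 (λ i p f → i :* (p :* f) := p :* (i :* f)) refl i (2 ^ w) f ⟩
    2 ^ w * (i * f) ≤⟨ *-monoʳ-≤ (2 ^ w) (force-sum w i i) ⟩
    2 ^ w * (force (suc (suc w)) (i + i) + force (suc (suc w)) (i + i)) ≡⟨ cong (λ e → 2 ^ w * (force (suc (suc w)) e + force (suc (suc w)) e))
        (solve 2 (λ p j → p :* j :+ p :* j := con 2 :* p :* j) refl (2 ^ w) j) ⟩
    2 ^ w * (F + F) ≡⟨ solve 2 (λ p F → p :* (F :+ F) := con 2 :* p :* F) refl (2 ^ w) F ⟩
    2 ^ suc w * F ∎
    where
    open ≤-Reasoning
    i = 2 ^ w * j
    f = force (suc w) i
    F = force (suc (suc w)) (2 ^ suc w * j)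

  w≤2^w : ∀ w → w ≤ 2 ^ w
  w≤2^w zero = z≤n
  w≤2^w (suc w) = ≤-trans (+-mono-≤ (m^n>0 2 w) (w≤2^w w)) (≤-reflexive (cong (2 ^ w +_) (sym (+-identityʳ (2 ^ w)))))

  -- The first factor passes from log log of the number of vertices to `j`, the second comes from
  -- `force-power`.
  loss : ℕ → ℕ
  loss w = (4 * 2 ^ w) ^ w * 2 ^ w

  module Lower (w N : ℕ) where

    j i k : ℕ
    -- 16 vertices are needed for the matching upper bound from (b); the factor `2 ^ w` in `i` is
    -- the one in `force-power`.
    j = 16 + N
    i = 2 ^ w * j
    k = members (suc w) i

    j≤i : j ≤ i
    j≤i = ≤-trans (≤-reflexive (sym (*-identityˡ j))) (*-monoˡ-≤ j (m^n>0 2 w))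

    open Realise (scene (suc w) i) (memberIndex (suc w) i) public using (G; clean; cliqueNumber≤; clique; colours≥)

    large : j ≤ k
    large = ≤-trans j≤i (≤-trans (n≤1+n i) (members≥ w i))

    cliqueNumber : CliqueNumber≡ G (suc w)
    cliqueNumber = cliqueNumber≤ (scene-bnd (suc w) i) ,
      clique (scene-clique w i (≤-trans (w≤2^w w) (≤-trans (≤-reflexive (sym (*-identityʳ (2 ^ w)))) (*-monoʳ-≤ (2 ^ w) {1} {j} (s≤s z≤n)))))

    chromatic : ∀ q → Colourable G q → loglog k ^ w ≤ loss w * q
    chromatic q c = begin
      loglog k ^ w ≤⟨ ^-monoˡ-≤ w (≤-trans (loglog≤ (suc w) i) linear) ⟩
      (4 * 2 ^ w * j) ^ w ≡⟨ ^-distrib-* (4 * 2 ^ w) j w ⟩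
      (4 * 2 ^ w) ^ w * j ^ w ≤⟨ *-monoʳ-≤ ((4 * 2 ^ w) ^ w) (≤-trans (force-power w j) (*-monoʳ-≤ (2 ^ w) (colours≥ (scene-forces (suc w) i) c))) ⟩
      (4 * 2 ^ w) ^ w * (2 ^ w * q) ≡⟨ sym (*-assoc ((4 * 2 ^ w) ^ w) (2 ^ w) q) ⟩
      loss w * q ∎
      where
      open ≤-Reasoning
      linear : 1 + i + i ≤ 4 * 2 ^ w * j
      linear = begin
        1 + i + i ≤⟨ +-monoˡ-≤ i (+-monoˡ-≤ i (≤-trans {1} {j} {i} (s≤s z≤n) j≤i)) ⟩
        i + i + i ≤⟨ m≤m+n (i + i + i) i ⟩
        i + i + i + i ≡⟨ solve 2 (λ p j → p :* j :+ p :* j :+ p :* j :+ p :* j := con 4 :* p :* j) refl (2 ^ w) j ⟩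
        4 * 2 ^ w * j ∎

  loss-pos : ∀ w → 1 ≤ loss w
  loss-pos w = *-mono-≤ (m^n>0 (4 * 2 ^ w) ⦃ Data.Nat.>-nonZero (*-mono-≤ {1} {4} (s≤s z≤n) (m^n>0 2 w)) ⦄ w) (m^n>0 2 w)

  part-c : ∀ ω → 1 ≤ ω → Σ ℕ λ K → Σ ℕ λ D → 1 ≤ D × (∀ N → Σ Graph λ G →
    IsCleanSubtreeOverlapGraph G × CliqueNumber≡ G ω × N ≤ n G ×
    Colourable G (K * loglog (n G) ^ (ω ∸ 1)) × (∀ k → Colourable G k → loglog (n G) ^ (ω ∸ 1) ≤ D * k))
  part-c (suc w) 1≤ω = proj₁ (part-b (suc w) 1≤ω) , loss w , loss-pos w , λ N →
    Lower.G w N , Lower.clean w N , Lower.cliqueNumber w N , ≤-trans (m≤n+m N 16) (Lower.large w N) ,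
    proj₂ (part-b (suc w) 1≤ω) (Lower.G w N) (Lower.clean w N) (proj₁ (Lower.cliqueNumber w N)) (≤-trans (m≤m+n 16 N) (Lower.large w N)) ,
    Lower.chromatic w N

  clean⇒subtree : ∀ G → IsCleanSubtreeOverlapGraph G → IsSubtreeOverlapGraph G
  clean⇒subtree G (T , tree , μ , sub , om , _) = T , tree , μ , sub , om

  part-c-string : ∀ ω → 1 ≤ ω → Σ ℕ λ K → Σ ℕ λ D → 1 ≤ D × (∀ N → Σ Graph λ G →
    IsStringGraph G × CliqueNumber≡ G ω × N ≤ n G ×
    Colourable G (K * loglog (n G) ^ (ω ∸ 1)) × (∀ k → Colourable G k → loglog (n G) ^ (ω ∸ 1) ≤ D * k))
  part-c-string ω 1≤ω with part-c ω 1≤ω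
  ... | K , D , 1≤D , h = K , D , 1≤D , λ N → proj₁ (h N) , subtreeOverlap⇒string (proj₁ (h N)) (clean⇒subtree (proj₁ (h N)) (proj₁ (proj₂ (h N)))) ,
    proj₂ (proj₂ (h N))

open import Defs
open import Data.Nat.Combinatorics using (_C_)
open SubtreeFamilies using (part-a; part-b)
open LowerBounds using (part-c; part-c-string)

theorem1p2 : (∀ (ω : ℕ) → 1 ≤ ω → Σ ℕ λ K → ∀ (G : Graph) → IsSubtreeOverlapGraph G →
    CliqueNumber≤ G ω → 16 ≤ n G → Colourable G (K * loglog (n G) ^ (ω C 2)))
    × (∀ (ω : ℕ) → 1 ≤ ω → Σ ℕ λ K → ∀ (G : Graph) → IsCleanSubtreeOverlapGraph G →
    CliqueNumber≤ G ω → 16 ≤ n G → Colourable G (K * loglog (n G) ^ (ω ∸ 1)))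
    × (∀ (ω : ℕ) → 1 ≤ ω → Σ ℕ λ K → Σ ℕ λ D → 1 ≤ D × (∀ (N : ℕ) → Σ Graph λ G →
    IsCleanSubtreeOverlapGraph G × CliqueNumber≡ G ω × N ≤ n G ×
    Colourable G (K * loglog (n G) ^ (ω ∸ 1)) ×
    (∀ k → Colourable G k → loglog (n G) ^ (ω ∸ 1) ≤ D * k)))
    × (∀ (ω : ℕ) → 1 ≤ ω → Σ ℕ λ K → Σ ℕ λ D → 1 ≤ D × (∀ (N : ℕ) → Σ Graph λ G →
    IsStringGraph G × CliqueNumber≡ G ω × N ≤ n G ×
    Colourable G (K * loglog (n G) ^ (ω ∸ 1)) ×
    (∀ k → Colourable G k → loglog (n G) ^ (ω ∸ 1) ≤ D * k)))
theorem1p2 = part-a , part-b , part-c , part-c-string
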